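{- Let $T$ be a tree on $n$ vertices which is DLS. Then for every positive integer $r$, the graph $T\sqcup rK_2$ is DLS. Moreover, if $n$ is odd and $r=1$, then $T\sqcup rK_2$ (that is, $T\sqcup K_2$) is DQS.
   Context: All graphs are finite, simple and undirected. For a graph $G$ with adjacency matrix $A_G$ and diagonal degree matrix $D_G$, the Laplacian matrix is $L_G=D_G-A_G$ and the signless Laplacian matrix is $Q_G=D_G+A_G$. The $L$-spectrum (resp. $Q$-spectrum) of $G$ is the multiset of eigenvalues of $L_G$ (resp. $Q_G$). Two graphs are $L$-cospectral (resp. $Q$-cospectral) if they have the same $L$-spectrum (resp. $Q$-spectrum). A graph $G$ is DLS (resp. DQS) if every graph $L$-cospectral (resp. $Q$-cospectral) with $G$ is isomorphic to $G$. $G\sqcup H$ denotes the disjoint union of $G$ and $H$, $rG$ denotes the disjoint union of $r$ copies of $G$, and $K_2$ is the complete graph on two vertices. -}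

module Defs where

open import Data.Nat using (ℕ; zero; suc; _+_; _*_; _∸_; _≤_)
open import Data.Bool using (Bool; true; false; if_then_else_; _∧_)
open import Data.Fin using (Fin; zero; suc; punchIn; splitAt; _≟_; _<?_)
open import Data.Fin.Properties using ()
open import Data.Integer using (ℤ; +_; -_; -1ℤ; 0ℤ; 1ℤ) renaming (_+_ to _+ℤ_; _*_ to _*ℤ_; _-_ to _-ℤ_)
open import Data.Sum using (_⊎_; inj₁; inj₂)
open import Relation.Nullary using (does)
open import Relation.Binary.PropositionalEquality using (_≡_; refl)
open import Data.Product using (_×_)
open import Function.Bundles using (_↔_; Inverse)

record Graph (n : ℕ) : Set where
  field
    adj   : Fin n → Fin n → Bool
    sym   : ∀ i j → adj i j ≡ adj j i
    irrefl : ∀ i → adj i i ≡ false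
open Graph public

record _≅_ {n m : ℕ} (G : Graph n) (H : Graph m) : Set where
  field
    bij  : Fin n ↔ Fin m
    pres : ∀ i j → adj H (Inverse.to bij i) (Inverse.to bij j) ≡ adj G i j

sumℕ : ∀ {n} → (Fin n → ℕ) → ℕ
sumℕ {zero} f = 0
sumℕ {suc n} f = f zero + sumℕ (λ i → f (suc i))

sumℤ : ∀ {n} → (Fin n → ℤ) → ℤ
sumℤ {zero} f = 0ℤ
sumℤ {suc n} f = f zero +ℤ sumℤ (λ i → f (suc i))

b2ℕ : Bool → ℕ
b2ℕ true = 1
b2ℕ false = 0

degree : ∀ {n} → Graph n → Fin n → ℕ
degree G i = sumℕ (λ j → b2ℕ (adj G i j))

edgeCount : ∀ {n} → Graph n → ℕ
edgeCount G = sumℕ (λ i → sumℕ (λ j → b2ℕ (does (i <? j) ∧ adj G i j)))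

Matrix : ℕ → Set
Matrix n = Fin n → Fin n → ℤ

det : ∀ {n} → Matrix n → ℤ
det {zero} M = 1ℤ
det {suc n} M = sumℤ (λ j → sign j *ℤ (M zero j *ℤ det (λ a b → M (suc a) (punchIn j b))))
  where
  sign : ∀ {k} → Fin k → ℤ
  sign zero = 1ℤ
  sign (suc j) = - sign j

adjMatrix : ∀ {n} → Graph n → Matrix n
adjMatrix G i j = if adj G i j then 1ℤ else 0ℤ

degMatrix : ∀ {n} → Graph n → Matrix n
degMatrix G i j = if does (i ≟ j) then + degree G i else 0ℤ

laplacian : ∀ {n} → Graph n → Matrix n
laplacian G i j = degMatrix G i j -ℤ adjMatrix G i j

signlessLaplacian : ∀ {n} → Graph n → Matrix n
signlessLaplacian G i j = degMatrix G i j +ℤ adjMatrix G i j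

charPoly : ∀ {n} → Matrix n → ℤ → ℤ
charPoly M x = det (λ i j → (if does (i ≟ j) then x else 0ℤ) -ℤ M i j)

-- Same spectrum (as multisets) ⇔ same characteristic polynomial (monic integer
-- polynomials, equal iff they agree on all integers).
LCospectral : ∀ {n m} → Graph n → Graph m → Set
LCospectral {n} {m} G H = (n ≡ m) × (∀ x → charPoly (laplacian G) x ≡ charPoly (laplacian H) x)

QCospectral : ∀ {n m} → Graph n → Graph m → Set
QCospectral {n} {m} G H = (n ≡ m) × (∀ x → charPoly (signlessLaplacian G) x ≡ charPoly (signlessLaplacian H) x)

DLS : ∀ {n} → Graph n → Set
DLS G = ∀ {m} (H : Graph m) → LCospectral G H → G ≅ H

DQS : ∀ {n} → Graph n → Set
DQS G = ∀ {m} (H : Graph m) → QCospectral G H → G ≅ H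

data Reach {n} (G : Graph n) : Fin n → Fin n → Set where
  here : ∀ {i} → Reach G i i
  step : ∀ {i j k} → adj G i j ≡ true → Reach G j k → Reach G i k

record IsTree {n} (G : Graph n) : Set where
  field
    nonempty  : 1 ≤ n
    connected : ∀ i j → Reach G i j
    edges     : edgeCount G ≡ n ∸ 1

sumAdj : ∀ {n m} → Graph n → Graph m → Fin n ⊎ Fin m → Fin n ⊎ Fin m → Bool
sumAdj G H (inj₁ i) (inj₁ j) = adj G i j
sumAdj G H (inj₂ i) (inj₂ j) = adj H i j
sumAdj G H (inj₁ i) (inj₂ j) = false
sumAdj G H (inj₂ i) (inj₁ j) = false

sumAdj-sym : ∀ {n m} (G : Graph n) (H : Graph m) x y → sumAdj G H x y ≡ sumAdj G H y x
sumAdj-sym G H (inj₁ i) (inj₁ j) = sym G i j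
sumAdj-sym G H (inj₂ i) (inj₂ j) = sym H i j
sumAdj-sym G H (inj₁ i) (inj₂ j) = refl
sumAdj-sym G H (inj₂ i) (inj₁ j) = refl

sumAdj-irr : ∀ {n m} (G : Graph n) (H : Graph m) x → sumAdj G H x x ≡ false
sumAdj-irr G H (inj₁ i) = irrefl G i
sumAdj-irr G H (inj₂ i) = irrefl H i

_⊔_ : ∀ {n m} → Graph n → Graph m → Graph (n + m)
_⊔_ {n} {m} G H = record
  { adj = λ i j → sumAdj G H (splitAt n i) (splitAt n j)
  ; sym = λ i j → sumAdj-sym G H (splitAt n i) (splitAt n j)
  ; irrefl = λ i → sumAdj-irr G H (splitAt n i) }

emptyGraph : Graph 0
emptyGraph = record { adj = λ () ; sym = λ () ; irrefl = λ () }

K2 : Graph 2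
K2 = record { adj = a ; sym = s ; irrefl = ir }
  where
  a : Fin 2 → Fin 2 → Bool
  a zero zero = false
  a zero (suc zero) = true
  a (suc zero) zero = true
  a (suc zero) (suc zero) = false
  s : ∀ i j → a i j ≡ a j i
  s zero zero = refl
  s zero (suc zero) = refl
  s (suc zero) zero = refl
  s (suc zero) (suc zero) = refl
  ir : ∀ i → a i i ≡ false
  ir zero = refl
  ir (suc zero) = refl

rK2 : (r : ℕ) → Graph (r * 2)
rK2 zero = emptyGraph
rK2 (suc r) = K2 ⊔ rK2 r

{-# OPTIONS --safe #-}
-- Write chi_G(y) = det(yI + L). For a connected graph, chi is y times a polynomial whose value at 0 is
-- the number of vertices times the number of spanning trees. Let H be L-cospectral with T ⊔ rK₂. The order
-- of vanishing at 0 gives r + 1 components and the trace of L the number of edges, so H is a forest, whose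
-- component sizes have the product n·2^r and the sum n + 2r. An eigenvalue 2 of a tree is simple and
-- forces an even number of vertices: modulo 2 the principal minors of L − 2I are those of L, that is 1.
-- Hence r of the r + 1 sizes are even. The equations for the sizes then leave {n, 2, …, 2} and, for n = 9,
-- {1, 6, 6, 2, …, 2}. The second is excluded by a cubic function of the degrees whose sum is determined by
-- the traces of L, L² and L³. In the first, cancelling the factors of the copies of K₂ leaves a graph
-- L-cospectral with T.
--
-- For Q, a component that is not bipartite has a non-zero determinant (its double cover is connected, and
-- chi of the double cover is the product of those of L and Q), divisible by 4 (as Q = L + 2A with A
-- symmetric). The lowest coefficient for T ⊔ K₂ is 2n with n odd, so H is bipartite, and there Q is similar to L.
module Submission where

open import Defs renaming (sym to adj-sym; irrefl to adj-irrefl)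
open import Data.Bool using (Bool; true; false; if_then_else_; not; _∧_; _xor_)
import Data.Bool.Properties as Bool
open import Data.Empty using (⊥; ⊥-elim)
open import Data.Fin using (Fin; zero; suc; punchIn; punchOut; splitAt; toℕ; fromℕ<; _≟_; _<?_; _↑ˡ_; _↑ʳ_)
import Data.Fin as Fin
import Data.Fin.Permutation as Perm
import Data.Fin.Permutation.Components as PC
open import Data.Fin.Permutation.Transposition.List using (TranspositionList; eval; decompose; eval-decompose)
import Data.Fin.Properties as Fin
open import Data.Fin.Subset.Properties using (anySubset?)
open import Data.Integer using (ℤ; -_; _+_; _*_; _-_; 0ℤ; 1ℤ; -1ℤ) renaming (+_ to pos)
import Data.Integer as ℤ
import Data.Integer.Properties as ℤ
open import Data.Integer.Tactic.RingSolver using (solve-∀)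
open import Data.List using (List; []; _∷_; _++_; length; replicate)
import Data.List.Properties as List
open import Data.List.Relation.Binary.Permutation.Propositional using (_↭_)
import Data.List.Relation.Binary.Permutation.Propositional as ↭
open import Data.List.Relation.Binary.Permutation.Propositional.Properties using (shift; ↭-length; All-resp-↭)
open import Data.List.Relation.Unary.All using (All; []; _∷_)
import Data.List.Relation.Unary.All.Properties as All
open import Data.Nat using (ℕ; zero; suc; _≤_; _%_)
import Data.Nat as ℕ
open import Data.Nat.DivMod using (m*n%n≡0)
open import Data.Nat.Induction using (<-wellFounded)
import Data.Nat.Properties as ℕ
open import Data.Nat.Tactic.RingSolver using () renaming (solve-∀ to ℕ-solve-∀)
import Algebra.Properties.CommutativeMonoid.Sum ℕ.+-0-commutativeMonoid as ℕSum
open import Data.Product using (Σ; ∃; _×_; _,_; proj₁; proj₂)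
import Data.Sign.Base as Sign
open import Data.Sum using (_⊎_; inj₁; inj₂)
open import Data.Sum.Algebra using (⊎-comm; ⊎-assoc)
open import Data.Sum.Function.Propositional using (_⊎-↔_)
open import Data.Vec using (lookup; tabulate)
open import Data.Vec.Functional using (updateAt; insertAt)
open import Data.Vec.Functional.Properties using (updateAt-updates; updateAt-minimal; insertAt-lookup; insertAt-punchIn)
open import Data.Vec.Properties using (lookup∘tabulate)
open import Function using (_∘_; id; case_of_)
open import Function.Bundles using (_↔_; Inverse; mk↔ₛ′)
open import Function.Properties.Inverse using (↔-refl; ↔-sym; ↔-trans)
open import Induction.WellFounded using (Acc; acc)
open import Level using (0ℓ)
open import Relation.Binary.Definitions using (tri<; tri≈; tri>)
open import Relation.Binary.PropositionalEquality using (_≡_; _≢_; refl; sym; trans; cong; cong₂; subst; subst₂; module ≡-Reasoning)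
open import Relation.Nullary using (¬_; Dec; yes; no; does; _→-dec_; _×-dec_)
open import Relation.Nullary.Decidable using (dec-true; dec-false)
open Inverse using (to; from; strictlyInverseˡ; strictlyInverseʳ)
open ≡-Reasoning

-- Sums and determinants

-- Spectra enter only as functions on the integers. A multiplicity is a factorisation h^k (c + h q)
-- at every integer h, and k and c are unique because 0 is the only integer divisible by all
-- non-zero integers. The eigenvalue 2 is singled out because it is the non-zero eigenvalue of K₂:
-- the copies of K₂ give it multiplicity at least r, whereas each of the r + 1 trees of H
-- contributes at most 1. Let m be the size of the remaining component and 2h the sizes of the
-- others. Components with h = 1 cancel against the copies of K₂, which leaves m ∏ h = n and m + 2 ∑
-- (h - 1) = n. The product soon outgrows the sum, so at most two values h exceed 1. For m = 1 and h
-- = 3, 3 both equations hold, and each size is compatible with the parity condition; this is why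
-- degrees have to be consulted. The cubic is as large as possible at an isolated vertex while it
-- stays small on the tree with nine vertices.

sumℤ-cong : ∀ {n} {f g : Fin n → ℤ} → (∀ i → f i ≡ g i) → sumℤ f ≡ sumℤ g
sumℤ-cong {zero}  h = refl
sumℤ-cong {suc n} h = cong₂ _+_ (h zero) (sumℤ-cong (λ i → h (suc i)))

sumℤ-zero : ∀ n → sumℤ {n} (λ _ → 0ℤ) ≡ 0ℤ
sumℤ-zero zero    = refl
sumℤ-zero (suc n) = trans (ℤ.+-identityˡ _) (sumℤ-zero n)

sumℤ-all-zero : ∀ {n} {f : Fin n → ℤ} → (∀ i → f i ≡ 0ℤ) → sumℤ f ≡ 0ℤ
sumℤ-all-zero {n} h = trans (sumℤ-cong h) (sumℤ-zero n)

+-interchange : ∀ a b c d → (a + b) + (c + d) ≡ (a + c) + (b + d)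
+-interchange = solve-∀

sumℤ-+ : ∀ {n} (f g : Fin n → ℤ) → sumℤ (λ i → f i + g i) ≡ sumℤ f + sumℤ g
sumℤ-+ {zero}  f g = refl
sumℤ-+ {suc n} f g =
  trans (cong (f zero + g zero +_) (sumℤ-+ (f ∘ suc) (g ∘ suc)))
        (+-interchange (f zero) (g zero) (sumℤ (f ∘ suc)) (sumℤ (g ∘ suc)))

sumℤ-* : ∀ {n} c (f : Fin n → ℤ) → sumℤ (λ i → c * f i) ≡ c * sumℤ f
sumℤ-* {zero}  c f = sym (ℤ.*-zeroʳ c)
sumℤ-* {suc n} c f =
  trans (cong (c * f zero +_) (sumℤ-* c (f ∘ suc))) (sym (ℤ.*-distribˡ-+ c (f zero) _))

sumℤ-*ʳ : ∀ {n} (f : Fin n → ℤ) c → sumℤ (λ i → f i * c) ≡ sumℤ f * c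
sumℤ-*ʳ f c = trans (sumℤ-cong (λ i → ℤ.*-comm (f i) c)) (trans (sumℤ-* c f) (ℤ.*-comm c _))

-‿as-* : ∀ a → - a ≡ -1ℤ * a
-‿as-* = solve-∀

sumℤ-neg : ∀ {n} (f : Fin n → ℤ) → sumℤ (λ i → - f i) ≡ - sumℤ f
sumℤ-neg f =
  trans (sumℤ-cong (λ i → -‿as-* (f i))) (trans (sumℤ-* -1ℤ f) (sym (-‿as-* (sumℤ f))))

sumℤ-swap : ∀ {m n} (f : Fin m → Fin n → ℤ) →
            sumℤ (λ i → sumℤ (λ j → f i j)) ≡ sumℤ (λ j → sumℤ (λ i → f i j))
sumℤ-swap {zero}  {n} f = sym (sumℤ-zero n)
sumℤ-swap {suc m} {n} f =
  trans (cong (sumℤ (f zero) +_) (sumℤ-swap (λ i → f (suc i))))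
        (sym (sumℤ-+ (f zero) (λ j → sumℤ (λ i → f (suc i) j))))

sumℤ-++ : ∀ m {n} (f : Fin (m ℕ.+ n) → ℤ) →
          sumℤ f ≡ sumℤ (λ i → f (i ↑ˡ n)) + sumℤ (λ j → f (m ↑ʳ j))
sumℤ-++ zero        f = sym (ℤ.+-identityˡ _)
sumℤ-++ (suc m) {n} f =
  trans (cong (f zero +_) (sumℤ-++ m (f ∘ suc)))
        (sym (ℤ.+-assoc (f zero) (sumℤ (λ i → f (suc i ↑ˡ n))) (sumℤ (λ j → f (suc m ↑ʳ j)))))

δ : ∀ {n} → Fin n → Fin n → ℤ
δ i j = if does (i ≟ j) then 1ℤ else 0ℤ

δ-refl : ∀ {n} (i : Fin n) → δ i i ≡ 1ℤ
δ-refl i with i ≟ i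
... | yes _  = refl
... | no i≢i = ⊥-elim (i≢i refl)

δ-off : ∀ {n} {i j : Fin n} → i ≢ j → δ i j ≡ 0ℤ
δ-off {i = i} {j} i≢j with i ≟ j
... | yes i≡j = ⊥-elim (i≢j i≡j)
... | no _    = refl

δ-suc : ∀ {n} (i j : Fin n) → δ (suc i) (suc j) ≡ δ i j
δ-suc i j with i ≟ j
... | yes _ = refl
... | no _  = refl

δ-sym : ∀ {n} (i j : Fin n) → δ i j ≡ δ j i
δ-sym i j with i ≟ j
... | yes refl = sym (δ-refl i)
... | no i≢j   = sym (δ-off (i≢j ∘ sym))

sumℤ-δ : ∀ {n} (i : Fin n) (f : Fin n → ℤ) → sumℤ (λ j → δ i j * f j) ≡ f i
sumℤ-δ {suc n} zero f =
  trans (cong₂ _+_ (ℤ.*-identityˡ (f zero)) (sumℤ-all-zero {n} (λ j → ℤ.*-zeroˡ (f (suc j)))))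
        (ℤ.+-identityʳ (f zero))
sumℤ-δ (suc i) f =
  trans (cong₂ _+_ (ℤ.*-zeroˡ (f zero))
                   (trans (sumℤ-cong (λ j → cong (_* f (suc j)) (δ-suc i j))) (sumℤ-δ i (f ∘ suc))))
        (ℤ.+-identityˡ (f (suc i)))

sumℤ-δʳ : ∀ {n} (i : Fin n) (f : Fin n → ℤ) → sumℤ (λ j → f j * δ j i) ≡ f i
sumℤ-δʳ i f =
  trans (sumℤ-cong (λ j → trans (ℤ.*-comm (f j) (δ j i)) (cong (_* f j) (δ-sym j i)))) (sumℤ-δ i f)

sg : ∀ {k} → Fin k → ℤ
sg zero    = 1ℤ
sg (suc j) = - sg j

minor : ∀ {n} → Fin (suc n) → Fin (suc n) → Matrix (suc n) → Matrix n
minor i j M a b = M (punchIn i a) (punchIn j b)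

cof : ∀ {n} → Matrix (suc n) → Fin (suc n) → ℤ
cof M j = M zero j * det (minor zero j M)

-- The signs in the definition of det are a function local to that definition and have no
-- name outside it. Abstracting the size index and the head symbols around it leaves a goal
-- from which unification recovers the function, so that it can be compared with sg.
private
  det-unfold : ∀ m (M : Matrix (suc (suc m))) →
               Σ (Fin m → ℤ) λ f →
               det M ≡ 1ℤ * cof M zero + (- 1ℤ * cof M (suc zero) + sumℤ f)
  det-unfold m M = _ , refl

  local-sign : ∀ n (M : Matrix (suc n)) w (j : Fin w) → _ ≡ sg j
  det-unfold-sg : ∀ m (M : Matrix (suc (suc m))) i →
                  proj₁ (det-unfold m M) i ≡ sg (suc (suc i)) * cof M (suc (suc i))
  det-unfold-sg m M i with cof M (suc (suc i))
  ... | y with suc m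
  ...   | v with -_ | ℤ.sign | ℤ.∣_∣
  ...     | neg | sn | ab =
    cong (λ z → (sn (neg (neg z)) Sign.* sn y) ℤ.◃ (ab (neg (neg z)) ℕ.* ab y)) (local-sign v M m i)
  local-sign n M (suc w) zero    = refl
  local-sign n M (suc w) (suc j) = cong -_ (local-sign n M w j)

det-row : ∀ {n} (M : Matrix (suc n)) → det M ≡ sumℤ (λ j → sg j * cof M j)
det-row {zero}  M = refl
det-row {suc m} M =
  trans (proj₂ (det-unfold m M))
        (cong (λ s → 1ℤ * cof M zero + (- 1ℤ * cof M (suc zero) + s)) (sumℤ-cong (det-unfold-sg m M)))

det-cong : ∀ {n} {M N : Matrix n} → (∀ i j → M i j ≡ N i j) → det M ≡ det N
det-cong {zero}          h = refl
det-cong {suc n} {M} {N} h = begin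
  det M                       ≡⟨ det-row M ⟩
  sumℤ (λ j → sg j * cof M j) ≡⟨ sumℤ-cong (λ j → cong (sg j *_) (cong₂ _*_ (h zero j)
                                   (det-cong (λ a b → h (suc a) (punchIn j b))))) ⟩
  sumℤ (λ j → sg j * cof N j) ≡⟨ det-row N ⟨
  det N                       ∎

coc : ∀ {n} → Matrix (suc n) → Fin (suc n) → ℤ
coc M i = M i zero * det (minor i zero M)

pull-sum : ∀ s m d → - s * (m * d) ≡ (- s * m) * d
pull-sum = solve-∀

reorder-cofactors : ∀ s t a b d → (- s * a) * (t * (b * d)) ≡ (- t * b) * (s * (a * d))
reorder-cofactors = solve-∀

-- The corner entry contributes the same term to both expansions. Once the minors are expanded as
-- well, every other term deletes rows 0 and i + 1 and columns 0 and j + 1, and this double sum may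
-- be taken in either order.
det-col : ∀ {n} (M : Matrix (suc n)) → det M ≡ sumℤ (λ i → sg i * coc M i)
det-col {zero}  M = det-row M
det-col {suc n} M = begin
  det M                                ≡⟨ det-row M ⟩
  head + sumℤ (λ j → - sg j * cof M (suc j))
    ≡⟨ cong (head +_) (sumℤ-cong λ j → begin
         - sg j * cof M (suc j)                         ≡⟨ cong (λ z → - sg j * (M zero (suc j) * z)) (det-col (minor zero (suc j) M)) ⟩
         - sg j * (M zero (suc j) * sumℤ (λ i → sg i * (M (suc i) zero * dd i j)))
                                                        ≡⟨ pull-sum (sg j) (M zero (suc j)) (sumℤ (λ i → sg i * (M (suc i) zero * dd i j))) ⟩
         (- sg j * M zero (suc j)) * sumℤ (λ i → sg i * (M (suc i) zero * dd i j))
                                                        ≡⟨ sumℤ-* (- sg j * M zero (suc j)) (λ i → sg i * (M (suc i) zero * dd i j)) ⟨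
         sumℤ (λ i → (- sg j * M zero (suc j)) * (sg i * (M (suc i) zero * dd i j)))
                                                        ≡⟨ sumℤ-cong (λ i → reorder-cofactors (sg j) (sg i) (M zero (suc j)) (M (suc i) zero) (dd i j)) ⟩
         sumℤ (λ i → (- sg i * M (suc i) zero) * (sg j * (M zero (suc j) * dd i j))) ∎) ⟩
  head + sumℤ (λ j → sumℤ (λ i → (- sg i * M (suc i) zero) * (sg j * (M zero (suc j) * dd i j))))
    ≡⟨ cong (head +_) (sumℤ-swap (λ j i → (- sg i * M (suc i) zero) * (sg j * (M zero (suc j) * dd i j)))) ⟩
  head + sumℤ (λ i → sumℤ (λ j → (- sg i * M (suc i) zero) * (sg j * (M zero (suc j) * dd i j))))
    ≡⟨ cong (head +_) (sumℤ-cong λ i → begin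
         sumℤ (λ j → (- sg i * M (suc i) zero) * (sg j * (M zero (suc j) * dd i j)))
           ≡⟨ sumℤ-* (- sg i * M (suc i) zero) (λ j → sg j * (M zero (suc j) * dd i j)) ⟩
         (- sg i * M (suc i) zero) * sumℤ (λ j → sg j * (M zero (suc j) * dd i j))
           ≡⟨ pull-sum (sg i) (M (suc i) zero) (sumℤ (λ j → sg j * (M zero (suc j) * dd i j))) ⟨
         - sg i * (M (suc i) zero * sumℤ (λ j → sg j * (M zero (suc j) * dd i j)))
           ≡⟨ cong (λ z → - sg i * (M (suc i) zero * z)) (det-row (minor (suc i) zero M)) ⟨
         - sg i * coc M (suc i) ∎) ⟩
  head + sumℤ (λ i → - sg i * coc M (suc i)) ∎
  where
  head = 1ℤ * (M zero zero * det (minor zero zero M))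
  dd : Fin (suc n) → Fin (suc n) → ℤ
  dd i j = det (λ a b → M (suc (punchIn i a)) (suc (punchIn j b)))

_ᵀ : ∀ {n} → Matrix n → Matrix n
(M ᵀ) i j = M j i

det-ᵀ : ∀ {n} (M : Matrix n) → det (M ᵀ) ≡ det M
det-ᵀ {zero}  M = refl
det-ᵀ {suc n} M = begin
  det (M ᵀ)                       ≡⟨ det-row (M ᵀ) ⟩
  sumℤ (λ j → sg j * cof (M ᵀ) j) ≡⟨ sumℤ-cong (λ j → cong (λ z → sg j * (M j zero * z)) (det-ᵀ (minor j zero M))) ⟩
  sumℤ (λ j → sg j * coc M j)     ≡⟨ det-col M ⟨
  det M                           ∎

-- Replacing rows: multilinearity and alternation

infixl 9 _[_≔_]
_[_≔_] : ∀ {n} → Matrix n → Fin n → (Fin n → ℤ) → Matrix n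
M [ i ≔ r ] = updateAt M i (λ _ → r)

≔-at : ∀ {n} (M : Matrix n) i r → (M [ i ≔ r ]) i ≡ r
≔-at M i r = updateAt-updates i M

≔-off : ∀ {n} (M : Matrix n) {i} r {a} → a ≢ i → (M [ i ≔ r ]) a ≡ M a
≔-off M {i} r {a} a≢i = updateAt-minimal a i M a≢i

≔-elim : ∀ {n} (P : Fin n → (Fin n → ℤ) → Set) (M : Matrix n) i r →
         P i r → (∀ a → a ≢ i → P a (M a)) → ∀ a → P a ((M [ i ≔ r ]) a)
≔-elim P M i r p q a with a ≟ i
... | yes refl = subst (P a) (sym (≔-at M a r)) p
... | no a≢i   = subst (P a) (sym (≔-off M r a≢i)) (q a a≢i)

-- `X` stands for the rows below the first one, which do not form a square matrix; hence the free
-- index `m`.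
tail-minor-≔ : ∀ {m n} (X : Fin m → Fin (suc n) → ℤ) i r j a b →
               updateAt X i (λ _ → r) a (punchIn j b) ≡
               updateAt (λ a b → X a (punchIn j b)) i (λ _ b → r (punchIn j b)) a b
tail-minor-≔ X zero    r j zero    b = refl
tail-minor-≔ X zero    r j (suc a) b = refl
tail-minor-≔ X (suc i) r j zero    b = refl
tail-minor-≔ X (suc i) r j (suc a) b = tail-minor-≔ (X ∘ suc) i r j a b

lin-head : ∀ s c r t d → s * ((c * r + t) * d) ≡ c * (s * (r * d)) + s * (t * d)
lin-head = solve-∀

lin-tail : ∀ s m c x y → s * (m * (c * x + y)) ≡ c * (s * (m * x)) + s * (m * y)
lin-tail = solve-∀

det-≔-lin : ∀ {n} (M : Matrix n) i c r t →
            det (M [ i ≔ (λ b → c * r b + t b) ]) ≡ c * det (M [ i ≔ r ]) + det (M [ i ≔ t ])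
det-≔-lin {suc n} M zero c r t = begin
  det (M [ zero ≔ (λ b → c * r b + t b) ])    ≡⟨ det-row (M [ zero ≔ (λ b → c * r b + t b) ]) ⟩
  sumℤ (λ j → sg j * ((c * r j + t j) * d j)) ≡⟨ sumℤ-cong (λ j → lin-head (sg j) c (r j) (t j) (d j)) ⟩
  sumℤ (λ j → c * (sg j * (r j * d j)) + sg j * (t j * d j))
                                              ≡⟨ sumℤ-+ (λ j → c * (sg j * (r j * d j))) (λ j → sg j * (t j * d j)) ⟩
  sumℤ (λ j → c * (sg j * (r j * d j))) + sumℤ (λ j → sg j * (t j * d j))
                                              ≡⟨ cong (_+ sumℤ (λ j → sg j * (t j * d j))) (sumℤ-* c (λ j → sg j * (r j * d j))) ⟩
  c * sumℤ (λ j → sg j * (r j * d j)) + sumℤ (λ j → sg j * (t j * d j))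
                                              ≡⟨ cong₂ (λ x y → c * x + y) (det-row (M [ zero ≔ r ])) (det-row (M [ zero ≔ t ])) ⟨
  c * det (M [ zero ≔ r ]) + det (M [ zero ≔ t ]) ∎
  where
  d : Fin (suc n) → ℤ
  d j = det (minor zero j M)
det-≔-lin {suc n} M (suc i) c r t = begin
  det (M [ suc i ≔ (λ b → c * r b + t b) ])    ≡⟨ det-row (M [ suc i ≔ (λ b → c * r b + t b) ]) ⟩
  sumℤ (λ j → sg j * (m j * det (minor zero j (M [ suc i ≔ (λ b → c * r b + t b) ]))))
    ≡⟨ sumℤ-cong (λ j → cong (λ z → sg j * (m j * z))
         (trans (det-cong (tail-minor-≔ (M ∘ suc) i (λ b → c * r b + t b) j)) (det-≔-lin (minor zero j M) i c (r ∘ punchIn j) (t ∘ punchIn j)))) ⟩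
  sumℤ (λ j → sg j * (m j * (c * d r j + d t j)))
    ≡⟨ sumℤ-cong (λ j → lin-tail (sg j) (m j) c (d r j) (d t j)) ⟩
  sumℤ (λ j → c * (sg j * (m j * d r j)) + sg j * (m j * d t j))
    ≡⟨ sumℤ-+ (λ j → c * (sg j * (m j * d r j))) (λ j → sg j * (m j * d t j)) ⟩
  sumℤ (λ j → c * (sg j * (m j * d r j))) + sumℤ (λ j → sg j * (m j * d t j))
    ≡⟨ cong (_+ sumℤ (λ j → sg j * (m j * d t j))) (sumℤ-* c (λ j → sg j * (m j * d r j))) ⟩
  c * sumℤ (λ j → sg j * (m j * d r j)) + sumℤ (λ j → sg j * (m j * d t j))
    ≡⟨ cong₂ (λ x y → c * x + y) (fold r) (fold t) ⟩
  c * det (M [ suc i ≔ r ]) + det (M [ suc i ≔ t ]) ∎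
  where
  m = M zero
  d : (Fin (suc n) → ℤ) → Fin (suc n) → ℤ
  d u j = det (minor zero j M [ i ≔ u ∘ punchIn j ])
  fold : ∀ u → sumℤ (λ j → sg j * (m j * d u j)) ≡ det (M [ suc i ≔ u ])
  fold u = trans (sumℤ-cong (λ j → cong (λ z → sg j * (m j * z)) (sym (det-cong (tail-minor-≔ (M ∘ suc) i u j)))))
                 (sym (det-row (M [ suc i ≔ u ])))

≔-cong : ∀ {n} (M : Matrix n) i {r t} → (∀ b → r b ≡ t b) → ∀ a b → (M [ i ≔ r ]) a b ≡ (M [ i ≔ t ]) a b
≔-cong M zero    h zero    b = h b
≔-cong M zero    h (suc a) b = refl
≔-cong {suc n} M (suc i) h zero    b = refl
≔-cong {suc n} M (suc i) {r} {t} h (suc a) b = go (M ∘ suc) i a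
  where
  go : ∀ {m} (X : Fin m → Fin (suc n) → ℤ) i a →
       updateAt X i (λ _ → r) a b ≡ updateAt X i (λ _ → t) a b
  go X zero    zero    = h b
  go X zero    (suc a) = refl
  go X (suc i) zero    = refl
  go X (suc i) (suc a) = go (X ∘ suc) i a

det-≔-cong : ∀ {n} (M : Matrix n) i {r t} → (∀ b → r b ≡ t b) → det (M [ i ≔ r ]) ≡ det (M [ i ≔ t ])
det-≔-cong M i h = det-cong (≔-cong M i h)

-- Row linearity with coefficient -1 on zero rows gives z = -z + z.
det-≔-zero : ∀ {n} (M : Matrix n) i → det (M [ i ≔ (λ _ → 0ℤ) ]) ≡ 0ℤ
det-≔-zero M i = begin
  z           ≡⟨ det-≔-cong M i (λ _ → refl) ⟩
  det (M [ i ≔ (λ b → -1ℤ * 0ℤ + 0ℤ) ]) ≡⟨ det-≔-lin M i -1ℤ (λ _ → 0ℤ) (λ _ → 0ℤ) ⟩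
  -1ℤ * z + z ≡⟨ cancel z ⟩
  0ℤ          ∎
  where
  z = det (M [ i ≔ (λ _ → 0ℤ) ])
  cancel : ∀ z → -1ℤ * z + z ≡ 0ℤ
  cancel = solve-∀

det-≔-+ : ∀ {n} (M : Matrix n) i r t →
          det (M [ i ≔ (λ b → r b + t b) ]) ≡ det (M [ i ≔ r ]) + det (M [ i ≔ t ])
det-≔-+ M i r t = begin
  det (M [ i ≔ (λ b → r b + t b) ])      ≡⟨ det-≔-cong M i (λ b → cong (_+ t b) (sym (ℤ.*-identityˡ (r b)))) ⟩
  det (M [ i ≔ (λ b → 1ℤ * r b + t b) ]) ≡⟨ det-≔-lin M i 1ℤ r t ⟩
  1ℤ * det (M [ i ≔ r ]) + det (M [ i ≔ t ]) ≡⟨ cong (_+ det (M [ i ≔ t ])) (ℤ.*-identityˡ (det (M [ i ≔ r ]))) ⟩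
  det (M [ i ≔ r ]) + det (M [ i ≔ t ])  ∎

det-≔-sum : ∀ {n m} (M : Matrix n) i (v : Fin m → ℤ) (R : Fin m → Fin n → ℤ) →
            det (M [ i ≔ (λ b → sumℤ (λ k → v k * R k b)) ]) ≡ sumℤ (λ k → v k * det (M [ i ≔ R k ]))
det-≔-sum {m = zero}  M i v R = det-≔-zero M i
det-≔-sum {m = suc m} M i v R =
  trans (det-≔-lin M i (v zero) (R zero) (λ b → sumℤ (λ k → v (suc k) * R (suc k) b)))
        (cong (v zero * det (M [ i ≔ R zero ]) +_) (det-≔-sum M i (v ∘ suc) (R ∘ suc)))

≔-id : ∀ {n} (M : Matrix n) i a b → (M [ i ≔ M i ]) a b ≡ M a b
≔-id M i a b = ≔-elim (λ a r → r b ≡ M a b) M i (M i) refl (λ _ _ → refl) a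

cancel-signs : ∀ a b d r → 1ℤ * (a * d) + (- 1ℤ * (a * d) + r) ≡ r
cancel-signs = solve-∀

-- In the expansion along the first row the first two terms cancel. Every other minor still contains
-- both columns, so induction applies to it.
det-cols01 : ∀ {n} (M : Matrix (suc (suc n))) → (∀ a → M a zero ≡ M a (suc zero)) → det M ≡ 0ℤ
det-cols01 {n} M h = begin
  det M ≡⟨ det-row M ⟩
  1ℤ * cof M zero + (- 1ℤ * cof M (suc zero) + sumℤ (λ j → sg (suc (suc j)) * cof M (suc (suc j))))
    ≡⟨ cong₂ (λ x y → 1ℤ * x + (- 1ℤ * cof M (suc zero) + y)) first (sumℤ-all-zero (rest M h)) ⟩
  1ℤ * cof M (suc zero) + (- 1ℤ * cof M (suc zero) + 0ℤ)
    ≡⟨ cancel-signs (M zero (suc zero)) 0ℤ (det (minor zero (suc zero) M)) 0ℤ ⟩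
  0ℤ ∎
  where
  cols : ∀ a b → minor zero zero M a b ≡ minor zero (suc zero) M a b
  cols a zero    = sym (h (suc a))
  cols a (suc b) = refl
  first : cof M zero ≡ cof M (suc zero)
  first = cong₂ _*_ (h zero) (det-cong cols)
  rest : ∀ {n} (M : Matrix (suc (suc n))) → (∀ a → M a zero ≡ M a (suc zero)) →
         ∀ j → sg (suc (suc j)) * cof M (suc (suc j)) ≡ 0ℤ
  rest {suc n} M h j = begin
    sg (suc (suc j)) * (M zero (suc (suc j)) * det (minor zero (suc (suc j)) M))
      ≡⟨ cong (λ z → sg (suc (suc j)) * (M zero (suc (suc j)) * z))
              (det-cols01 (minor zero (suc (suc j)) M) (λ a → h (suc a))) ⟩
    sg (suc (suc j)) * (M zero (suc (suc j)) * 0ℤ) ≡⟨ cong (sg (suc (suc j)) *_) (ℤ.*-zeroʳ (M zero (suc (suc j)))) ⟩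
    sg (suc (suc j)) * 0ℤ ≡⟨ ℤ.*-zeroʳ (sg (suc (suc j))) ⟩
    0ℤ ∎

det-rows01 : ∀ {n} (M : Matrix (suc (suc n))) → (∀ b → M zero b ≡ M (suc zero) b) → det M ≡ 0ℤ
det-rows01 M h = trans (sym (det-ᵀ M)) (det-cols01 (M ᵀ) h)

-- Named per size, so that it can be assumed for the minors while it is being proved one size up.
Alternating : ℕ → Set
Alternating n = ∀ (M : Matrix n) i j → i ≢ j → (∀ b → M i b ≡ M j b) → det M ≡ 0ℤ

-- Polarisation: with the sum of both rows in both places the determinant is 0, and expanding it
-- leaves the two mixed determinants with sum 0.
det-transpose : ∀ {n} → Alternating n → (M : Matrix n) (i j : Fin n) → i ≢ j →
                det (λ a → M (PC.transpose i j a)) ≡ - det M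
det-transpose {n} alt M i j i≢j = begin
  det (λ a → M (PC.transpose i j a)) ≡⟨ det-cong {M = λ a → M (PC.transpose i j a)} {N = W (M j) (M i)} (λ a b → cong (λ r → r b) (rows a)) ⟩
  det (W (M j) (M i))                ≡⟨ solve4 (det (W (M i) (M i))) (det (W (M i) (M j))) (det (W (M j) (M i))) (det (W (M j) (M j)))
                                          (W-same (M i)) (W-same (M j)) sum-zero ⟩
  - det (W (M i) (M j))              ≡⟨ cong -_ (det-cong {M = W (M i) (M j)} {N = M} (λ a b → trans (trans (cong (λ r → r b) (back a)) refl) refl)) ⟩
  - det M                            ∎
  where
  W : (r t : Fin n → ℤ) → Matrix n
  W r t = M [ i ≔ r ] [ j ≔ t ]
  W-i : ∀ r t → W r t i ≡ r
  W-i r t = trans (≔-off (M [ i ≔ r ]) t i≢j) (≔-at M i r)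
  W-j : ∀ r t → W r t j ≡ t
  W-j r t = ≔-at (M [ i ≔ r ]) j t
  W-off : ∀ r t {a} → a ≢ i → a ≢ j → W r t a ≡ M a
  W-off r t a≢i a≢j = trans (≔-off (M [ i ≔ r ]) t a≢j) (≔-off M r a≢i)
  W-same : ∀ r → det (W r r) ≡ 0ℤ
  W-same r = alt (W r r) i j i≢j (λ b → cong (λ z → z b) (trans (W-i r r) (sym (W-j r r))))
  rows : ∀ a → M (PC.transpose i j a) ≡ W (M j) (M i) a
  rows a with a ≟ i
  ... | yes refl = sym (W-i (M j) (M a))
  ... | no a≢i with a ≟ j
  ...   | yes refl = sym (W-j (M a) (M i))
  ...   | no a≢j   = sym (W-off (M j) (M i) a≢i a≢j)
  back : ∀ a → W (M i) (M j) a ≡ M a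
  back a with a ≟ i
  ... | yes refl = W-i (M a) (M j)
  ... | no a≢i with a ≟ j
  ...   | yes refl = W-j (M i) (M a)
  ...   | no a≢j   = W-off (M i) (M j) a≢i a≢j
  commute : ∀ r t a b → W r t a b ≡ (M [ j ≔ t ] [ i ≔ r ]) a b
  commute r t a b with a ≟ i
  ... | yes refl = cong (λ z → z b) (trans (W-i r t) (sym (≔-at (M [ j ≔ t ]) a r)))
  ... | no a≢i with a ≟ j
  ...   | yes refl = cong (λ z → z b) (trans (W-j r t) (sym (trans (≔-off (M [ a ≔ t ]) r a≢i) (≔-at M a t))))
  ...   | no a≢j   = cong (λ z → z b) (trans (W-off r t a≢i a≢j) (sym (trans (≔-off (M [ j ≔ t ]) r a≢i) (≔-off M t a≢j))))
  W-+ˡ : ∀ r r′ t → det (W (λ b → r b + r′ b) t) ≡ det (W r t) + det (W r′ t)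
  W-+ˡ r r′ t = begin
    det (W (λ b → r b + r′ b) t) ≡⟨ det-cong (commute (λ b → r b + r′ b) t) ⟩
    det (M [ j ≔ t ] [ i ≔ (λ b → r b + r′ b) ]) ≡⟨ det-≔-+ (M [ j ≔ t ]) i r r′ ⟩
    det (M [ j ≔ t ] [ i ≔ r ]) + det (M [ j ≔ t ] [ i ≔ r′ ])
      ≡⟨ cong₂ _+_ (det-cong (commute r t)) (det-cong (commute r′ t)) ⟨
    det (W r t) + det (W r′ t) ∎
  ri+rj : Fin n → ℤ
  ri+rj b = M i b + M j b
  sum-zero : (det (W (M i) (M i)) + det (W (M j) (M i))) + (det (W (M i) (M j)) + det (W (M j) (M j))) ≡ 0ℤ
  sum-zero = begin
    (det (W (M i) (M i)) + det (W (M j) (M i))) + (det (W (M i) (M j)) + det (W (M j) (M j)))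
      ≡⟨ cong₂ _+_ (W-+ˡ (M i) (M j) (M i)) (W-+ˡ (M i) (M j) (M j)) ⟨
    det (W ri+rj (M i)) + det (W ri+rj (M j)) ≡⟨ det-≔-+ (M [ i ≔ ri+rj ]) j (M i) (M j) ⟨
    det (W ri+rj ri+rj) ≡⟨ W-same ri+rj ⟩
    0ℤ ∎
  solve4 : ∀ x y z w → x ≡ 0ℤ → w ≡ 0ℤ → (x + z) + (y + w) ≡ 0ℤ → z ≡ - y
  solve4 x y z w refl refl e = begin
    z                           ≡⟨ rearrange z y ⟩
    ((0ℤ + z) + (y + 0ℤ)) + - y ≡⟨ cong (_+ - y) e ⟩
    0ℤ + - y                    ≡⟨ ℤ.+-identityˡ (- y) ⟩
    - y                         ∎
    where
    rearrange : ∀ z y → z ≡ ((0ℤ + z) + (y + 0ℤ)) + - y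
    rearrange = solve-∀

*-zero-inner : ∀ s m {d} → d ≡ 0ℤ → s * (m * d) ≡ 0ℤ
*-zero-inner s m refl = trans (cong (s *_) (ℤ.*-zeroʳ m)) (ℤ.*-zeroʳ s)

neg-inner : ∀ s m d → s * (m * - d) ≡ - (s * (m * d))
neg-inner = solve-∀

-‿zero : ∀ {a} → 0ℤ ≡ - a → a ≡ 0ℤ
-‿zero {a} e = trans (sym (ℤ.neg-involutive a)) (cong -_ (sym e))

-- The row equal to the first is exchanged with row 1. This exchange takes place inside the minors
-- of the first row, where alternation is already available, and makes the first two rows equal.
alt-zero-row : ∀ {n} → Alternating (suc n) → (M : Matrix (suc (suc n))) → ∀ j →
               (∀ b → M zero b ≡ M (suc j) b) → det M ≡ 0ℤ
alt-zero-row {n} alt M zero    h = det-rows01 M h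
alt-zero-row {n} alt M (suc j) h = -‿zero (begin
  0ℤ    ≡⟨ det-rows01 N h ⟨
  det N ≡⟨ det-row N ⟩
  sumℤ (λ k → sg k * (M zero k * det (minor zero k N)))
    ≡⟨ sumℤ-cong (λ k → trans (cong (λ z → sg k * (M zero k * z))
         (det-transpose alt (minor zero k M) zero (suc j) λ ()))
         (neg-inner (sg k) (M zero k) (det (minor zero k M)))) ⟩
  sumℤ (λ k → - (sg k * (M zero k * det (minor zero k M)))) ≡⟨ sumℤ-neg (λ k → sg k * cof M k) ⟩
  - sumℤ (λ k → sg k * cof M k) ≡⟨ cong -_ (det-row M) ⟨
  - det M ∎)
  where
  N : Matrix (suc (suc n))
  N zero    = M zero
  N (suc a) = M (suc (PC.transpose zero (suc j) a))

det-alt : ∀ {n} → Alternating n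
det-alt {suc n} M zero zero i≢j h = ⊥-elim (i≢j refl)
det-alt {suc n} M (suc i) (suc j) i≢j h =
  trans (det-row M) (sumℤ-all-zero (λ k → *-zero-inner (sg k) (M zero k)
    (det-alt (minor zero k M) i j (i≢j ∘ cong suc) (λ b → h (punchIn k b)))))
det-alt {suc (suc n)} M zero (suc j) i≢j h = alt-zero-row det-alt M j h
det-alt {suc (suc n)} M (suc j) zero i≢j h = alt-zero-row det-alt M j (λ b → sym (h b))

-- The sign from the rows cancels the one from the columns. Equal indices are treated apart, because
-- a sign change takes two different rows.
det-transpose² : ∀ {n} (M : Matrix n) i j →
                 det (λ a b → M (PC.transpose i j a) (PC.transpose i j b)) ≡ det M
det-transpose² M i j with i ≟ j
... | yes refl = det-cong {N = M} (λ a b → cong₂ M (same a) (same b))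
  where
  same : ∀ a → PC.transpose i i a ≡ a
  same a with a ≟ i
  ... | yes a≡i = sym a≡i
  ... | no a≢i with a ≟ i
  ...   | yes a≡i = ⊥-elim (a≢i a≡i)
  ...   | no _    = refl
... | no i≢j = begin
  det (λ a b → M (τ a) (τ b)) ≡⟨ det-transpose det-alt (λ a b → M a (τ b)) i j i≢j ⟩
  - det (λ a b → M a (τ b))   ≡⟨ cong -_ (det-ᵀ (λ a b → M a (τ b))) ⟨
  - det (λ a b → M b (τ a))   ≡⟨ cong -_ (det-transpose det-alt (M ᵀ) i j i≢j) ⟩
  - - det (M ᵀ)               ≡⟨ ℤ.neg-involutive (det (M ᵀ)) ⟩
  det (M ᵀ)                   ≡⟨ det-ᵀ M ⟩
  det M                       ∎
  where τ = PC.transpose i j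

-- Permuting rows and columns together keeps the sign of a permutation out of the development.
det-perm : ∀ {n} (π : Perm.Permutation′ n) (M : Matrix n) →
           det (λ a b → M (π Perm.⟨$⟩ʳ a) (π Perm.⟨$⟩ʳ b)) ≡ det M
det-perm π M =
  trans (det-cong (λ a b → cong₂ M (sym (eval-decompose π a)) (sym (eval-decompose π b))))
        (go (decompose π) M)
  where
  go : ∀ {n} (ts : TranspositionList n) (M : Matrix n) →
       det (λ a b → M (eval ts Perm.⟨$⟩ʳ a) (eval ts Perm.⟨$⟩ʳ b)) ≡ det M
  go []             M = refl
  go ((i , j) ∷ ts) M =
    trans (det-transpose² (λ a b → M (eval ts Perm.⟨$⟩ʳ a) (eval ts Perm.⟨$⟩ʳ b)) i j) (go ts M)

-- Conjugating with the permutation that moves index i to the front and keeps the order of the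
-- others leaves a single non-zero entry in the first row.
det-≔-δ : ∀ {n} (M : Matrix (suc n)) i → det (M [ i ≔ δ i ]) ≡ det (minor i i M)
det-≔-δ {n} M i = begin
  det X ≡⟨ det-perm π X ⟨
  det Y ≡⟨ det-row Y ⟩
  1ℤ * (Y zero zero * det (minor zero zero Y)) + sumℤ (λ j → sg (suc j) * (Y zero (suc j) * det (minor zero (suc j) Y)))
        ≡⟨ cong₂ (λ y s → 1ℤ * (y * det (minor zero zero Y)) + s) Y00 (sumℤ-all-zero tail-zero) ⟩
  1ℤ * (1ℤ * det (minor zero zero Y)) + 0ℤ ≡⟨ tidy (det (minor zero zero Y)) ⟩
  det (minor zero zero Y) ≡⟨ det-cong Y-minor ⟩
  det (minor i i M) ∎
  where
  X = M [ i ≔ δ i ]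
  π = Perm.insert zero i Perm.id
  Y : Matrix (suc n)
  Y a b = X (π Perm.⟨$⟩ʳ a) (π Perm.⟨$⟩ʳ b)
  π-suc : ∀ a → π Perm.⟨$⟩ʳ suc a ≡ punchIn i a
  π-suc a = Perm.insert-punchIn zero i Perm.id a
  Y00 : Y zero zero ≡ 1ℤ
  Y00 = trans (cong (λ r → r i) (≔-at M i (δ i))) (δ-refl i)
  Y0s : ∀ j → Y zero (suc j) ≡ 0ℤ
  Y0s j = trans (cong (λ r → r (π Perm.⟨$⟩ʳ suc j)) (≔-at M i (δ i)))
                (trans (cong (δ i) (π-suc j)) (δ-off (Fin.punchInᵢ≢i i j ∘ sym)))
  tail-zero : ∀ j → sg (suc j) * (Y zero (suc j) * det (minor zero (suc j) Y)) ≡ 0ℤ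
  tail-zero j = trans (cong (λ y → sg (suc j) * (y * det (minor zero (suc j) Y))) (Y0s j))
                      (zero-mid (sg (suc j)) (det (minor zero (suc j) Y)))
    where
    zero-mid : ∀ s d → s * (0ℤ * d) ≡ 0ℤ
    zero-mid = solve-∀
  Y-minor : ∀ a b → Y (suc a) (suc b) ≡ M (punchIn i a) (punchIn i b)
  Y-minor a b = trans (cong₂ X (π-suc a) (π-suc b))
                      (cong (λ r → r (punchIn i b)) (≔-off M (δ i) (Fin.punchInᵢ≢i i a)))
  tidy : ∀ d → 1ℤ * (1ℤ * d) + 0ℤ ≡ d
  tidy = solve-∀

sumℤ-pick : ∀ {n} (i : Fin n) (v : Fin n → ℤ) (f : Fin n → ℤ) → (∀ k → k ≢ i → f k ≡ 0ℤ) →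
            sumℤ (λ k → v k * f k) ≡ v i * f i
sumℤ-pick i v f h = trans (sumℤ-cong pick) (sumℤ-δ i (λ k → v k * f k))
  where
  pick : ∀ k → v k * f k ≡ δ i k * (v k * f k)
  pick k with i ≟ k
  ... | yes refl = sym (ℤ.*-identityˡ (v k * f k))
  ... | no i≢k   = trans (cong (v k *_) (h k (i≢k ∘ sym))) (trans (ℤ.*-zeroʳ (v k)) (sym (ℤ.*-zeroˡ (v k * f k))))

det-≔-comb : ∀ {n} (M : Matrix n) i (v : Fin n → ℤ) →
             det (M [ i ≔ (λ b → sumℤ (λ k → v k * M k b)) ]) ≡ v i * det M
det-≔-comb M i v = begin
  det (M [ i ≔ (λ b → sumℤ (λ k → v k * M k b)) ]) ≡⟨ det-≔-sum M i v M ⟩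
  sumℤ (λ k → v k * det (M [ i ≔ M k ]))
    ≡⟨ sumℤ-pick i v (λ k → det (M [ i ≔ M k ])) (λ k k≢i →
         det-alt (M [ i ≔ M k ]) i k (k≢i ∘ sym) (λ b → cong (λ r → r b)
           (trans (≔-at M i (M k)) (sym (≔-off M (M k) k≢i))))) ⟩
  v i * det (M [ i ≔ M i ]) ≡⟨ cong (v i *_) (det-cong (≔-id M i)) ⟩
  v i * det M ∎

-- Putting the combination with coefficients `v` into row i multiplies the determinant by `v i`, and
-- this combination is zero. One non-zero entry of `v` thus makes the determinant vanish, without
-- division.
left-kernel : ∀ {n} (M : Matrix n) (v : Fin n → ℤ) → (∀ b → sumℤ (λ k → v k * M k b) ≡ 0ℤ) →
              ∀ i → v i * det M ≡ 0ℤ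
left-kernel M v h i =
  trans (sym (det-≔-comb M i v)) (trans (det-≔-cong M i h) (det-≔-zero M i))

-- A unit vector in row j produces the signed minor together with its sign.
adjugate : ∀ {n} → Matrix n → Matrix n
adjugate M i j = det (M [ j ≔ δ i ])

M·adj : ∀ {n} (M : Matrix n) i j → sumℤ (λ k → M i k * adjugate M k j) ≡ δ i j * det M
M·adj M i j = begin
  sumℤ (λ k → M i k * det (M [ j ≔ δ k ]))        ≡⟨ det-≔-sum M j (M i) δ ⟨
  det (M [ j ≔ (λ b → sumℤ (λ k → M i k * δ k b)) ]) ≡⟨ det-≔-cong M j (λ b → sumℤ-δʳ b (M i)) ⟩
  det (M [ j ≔ M i ])                              ≡⟨ det-≔-cong M j (λ b → sym (sumℤ-δ i (λ k → M k b))) ⟩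
  det (M [ j ≔ (λ b → sumℤ (λ k → δ i k * M k b)) ]) ≡⟨ det-≔-comb M j (δ i) ⟩
  δ i j * det M                                    ∎

det-zero-row : ∀ {n} (M : Matrix n) i → (∀ b → M i b ≡ 0ℤ) → det M ≡ 0ℤ
det-zero-row M i h =
  trans (sym (det-cong (≔-id M i))) (trans (det-≔-cong M i h) (det-≔-zero M i))

-- Split along the unit vectors, only the i-th part of column j survives because row i is δ j.
det-≔-δ-cross : ∀ {n} (M : Matrix n) i j →
                det (M [ i ≔ δ j ]) ≡ det ((M [ i ≔ δ j ]) ᵀ [ j ≔ δ i ])
det-≔-δ-cross M i j = begin
  det X                                                        ≡⟨ det-ᵀ X ⟨
  det (X ᵀ)                                                    ≡⟨ det-cong (≔-id (X ᵀ) j) ⟨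
  det (X ᵀ [ j ≔ (X ᵀ) j ])                                    ≡⟨ det-≔-cong (X ᵀ) j (λ b → sym (sumℤ-δʳ b ((X ᵀ) j))) ⟩
  det (X ᵀ [ j ≔ (λ b → sumℤ (λ k → X k j * δ k b)) ])         ≡⟨ det-≔-sum (X ᵀ) j (λ k → X k j) δ ⟩
  sumℤ (λ k → X k j * det (X ᵀ [ j ≔ δ k ]))                   ≡⟨ sumℤ-pick i (λ k → X k j) (λ k → det (X ᵀ [ j ≔ δ k ])) vanish ⟩
  X i j * det (X ᵀ [ j ≔ δ i ])                                ≡⟨ cong (_* det (X ᵀ [ j ≔ δ i ])) (trans (cong (λ r → r j) (≔-at M i (δ j))) (δ-refl j)) ⟩
  1ℤ * det (X ᵀ [ j ≔ δ i ])                                   ≡⟨ ℤ.*-identityˡ (det (X ᵀ [ j ≔ δ i ])) ⟩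
  det (X ᵀ [ j ≔ δ i ])                                        ∎
  where
  X = M [ i ≔ δ j ]
  vanish : ∀ k → k ≢ i → det (X ᵀ [ j ≔ δ k ]) ≡ 0ℤ
  vanish k k≢i = trans (sym (det-ᵀ (X ᵀ [ j ≔ δ k ])))
    (det-zero-row ((X ᵀ [ j ≔ δ k ]) ᵀ) i (≔-elim (λ a r → r i ≡ 0ℤ) (X ᵀ) j (δ k) (δ-off k≢i)
      (λ a a≢j → trans (cong (λ r → r a) (≔-at M i (δ j))) (δ-off (a≢j ∘ sym)))))

-- In the form given by `det-≔-δ-cross`, a row and a column are both replaced by unit vectors, and
-- the matrices of the two sides are transposes of each other.
adjugate-ᵀ : ∀ {n} (M : Matrix n) i j → adjugate (M ᵀ) i j ≡ adjugate M j i
adjugate-ᵀ {n} M i j = begin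
  det (M ᵀ [ j ≔ δ i ])                 ≡⟨ det-≔-δ-cross (M ᵀ) j i ⟩
  det ((M ᵀ [ j ≔ δ i ]) ᵀ [ i ≔ δ j ]) ≡⟨ det-cong same ⟩
  det (((M [ i ≔ δ j ]) ᵀ [ j ≔ δ i ]) ᵀ) ≡⟨ det-ᵀ ((M [ i ≔ δ j ]) ᵀ [ j ≔ δ i ]) ⟩
  det ((M [ i ≔ δ j ]) ᵀ [ j ≔ δ i ])   ≡⟨ det-≔-δ-cross M i j ⟨
  det (M [ i ≔ δ j ])                   ∎
  where
  same : ∀ a b → ((M ᵀ [ j ≔ δ i ]) ᵀ [ i ≔ δ j ]) a b ≡ ((M [ i ≔ δ j ]) ᵀ [ j ≔ δ i ]) b a
  same a b with a ≟ i | b ≟ j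
  ... | yes refl | yes refl = trans (cong (λ r → r b) (≔-at ((M ᵀ [ b ≔ δ a ]) ᵀ) a (δ b)))
        (trans (δ-refl b) (sym (trans (cong (λ r → r a) (≔-at ((M [ a ≔ δ b ]) ᵀ) b (δ a))) (δ-refl a))))
  ... | yes refl | no b≢j = trans (cong (λ r → r b) (≔-at ((M ᵀ [ j ≔ δ a ]) ᵀ) a (δ j)))
        (sym (trans (cong (λ r → r a) (≔-off ((M [ a ≔ δ j ]) ᵀ) (δ a) b≢j)) (cong (λ r → r b) (≔-at M a (δ j)))))
  ... | no a≢i | yes refl = trans (cong (λ r → r b) (≔-off ((M ᵀ [ b ≔ δ i ]) ᵀ) (δ b) a≢i))
        (trans (cong (λ r → r a) (≔-at (M ᵀ) b (δ i))) (sym (cong (λ r → r a) (≔-at ((M [ i ≔ δ b ]) ᵀ) b (δ i)))))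
  ... | no a≢i | no b≢j = trans (cong (λ r → r b) (≔-off ((M ᵀ [ j ≔ δ i ]) ᵀ) (δ j) a≢i))
        (trans (cong (λ r → r a) (≔-off (M ᵀ) (δ i) b≢j))
          (sym (trans (cong (λ r → r a) (≔-off ((M [ i ≔ δ j ]) ᵀ) (δ i) b≢j)) (cong (λ r → r b) (≔-off M (δ j) a≢i)))))

punchIn-↑ˡ : ∀ {n} m (j : Fin (suc n)) (b : Fin n) → punchIn (j ↑ˡ m) (b ↑ˡ m) ≡ punchIn j b ↑ˡ m
punchIn-↑ˡ m zero    b       = refl
punchIn-↑ˡ m (suc j) zero    = refl
punchIn-↑ˡ m (suc j) (suc b) = cong suc (punchIn-↑ˡ m j b)

punchIn-↑ʳ : ∀ n {m} (j : Fin (suc n)) (b : Fin m) → punchIn (j ↑ˡ m) (n ↑ʳ b) ≡ suc n ↑ʳ b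
punchIn-↑ʳ n       zero    b = refl
punchIn-↑ʳ (suc n) (suc j) b = cong suc (punchIn-↑ʳ n j b)

sg-↑ˡ : ∀ {n} m (j : Fin n) → sg (j ↑ˡ m) ≡ sg j
sg-↑ˡ m zero    = refl
sg-↑ˡ m (suc j) = cong -_ (sg-↑ˡ m j)

-- Along the first row the entries of the zero block drop out, and each remaining minor is again
-- block triangular.
det-block : ∀ {n m} (X : Matrix (n ℕ.+ m)) (A : Matrix n) (B : Matrix m) →
            (∀ i j → X (i ↑ˡ m) (j ↑ˡ m) ≡ A i j) →
            (∀ i j → X (i ↑ˡ m) (n ↑ʳ j) ≡ 0ℤ) →
            (∀ i j → X (n ↑ʳ i) (n ↑ʳ j) ≡ B i j) →
            det X ≡ det A * det B
det-block {zero}      X A B hA h0 hB = trans (det-cong hB) (sym (ℤ.*-identityˡ (det B)))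
det-block {suc n} {m} X A B hA h0 hB = begin
  det X                           ≡⟨ det-row X ⟩
  sumℤ (λ j → sg j * cof X j)     ≡⟨ sumℤ-++ (suc n) (λ j → sg j * cof X j) ⟩
  sumℤ (λ j → sg (j ↑ˡ m) * cof X (j ↑ˡ m)) + sumℤ (λ j → sg (suc n ↑ʳ j) * cof X (suc n ↑ʳ j))
    ≡⟨ cong₂ _+_ (sumℤ-cong left) (sumℤ-all-zero right) ⟩
  sumℤ (λ j → (sg j * cof A j) * det B) + 0ℤ ≡⟨ ℤ.+-identityʳ (sumℤ (λ j → (sg j * cof A j) * det B)) ⟩
  sumℤ (λ j → (sg j * cof A j) * det B) ≡⟨ sumℤ-*ʳ (λ j → sg j * cof A j) (det B) ⟩
  sumℤ (λ j → sg j * cof A j) * det B ≡⟨ cong (_* det B) (det-row A) ⟨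
  det A * det B                   ∎
  where
  assoc₃ : ∀ s a d b → s * (a * (d * b)) ≡ (s * (a * d)) * b
  assoc₃ = solve-∀
  zero-mid : ∀ s d → s * (0ℤ * d) ≡ 0ℤ
  zero-mid = solve-∀
  left : ∀ j → sg (j ↑ˡ m) * cof X (j ↑ˡ m) ≡ (sg j * cof A j) * det B
  left j = begin
    sg (j ↑ˡ m) * (X zero (j ↑ˡ m) * det (minor zero (j ↑ˡ m) X))
      ≡⟨ cong₂ _*_ (sg-↑ˡ m j) (cong₂ _*_ (hA zero j)
           (det-block (minor zero (j ↑ˡ m) X) (minor zero j A) B
             (λ a b → trans (cong (X (suc a ↑ˡ m)) (punchIn-↑ˡ m j b)) (hA (suc a) (punchIn j b)))
             (λ a b → trans (cong (X (suc a ↑ˡ m)) (punchIn-↑ʳ n j b)) (h0 (suc a) b))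
             (λ a b → trans (cong (X (suc n ↑ʳ a)) (punchIn-↑ʳ n j b)) (hB a b)))) ⟩
    sg j * (A zero j * (det (minor zero j A) * det B))
      ≡⟨ assoc₃ (sg j) (A zero j) (det (minor zero j A)) (det B) ⟩
    (sg j * cof A j) * det B ∎
  right : ∀ j → sg (suc n ↑ʳ j) * cof X (suc n ↑ʳ j) ≡ 0ℤ
  right j = trans (cong (λ x → sg (suc n ↑ʳ j) * (x * det (minor zero (suc n ↑ʳ j) X))) (h0 zero j))
                  (zero-mid (sg (suc n ↑ʳ j)) (det (minor zero (suc n ↑ʳ j) X)))

-- The derivative of det (M + hB) at h = 0, that is, the trace of adj(M) B.
derivative : ∀ {n} → Matrix n → Matrix n → ℤ
derivative M B = sumℤ (λ i → det (M [ i ≔ B i ]))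

-- The remainder `k` may depend on `h`. This is Taylor expansion to first order, as a congruence
-- modulo h² at each integer.
det-shift : ∀ {n} (M B : Matrix n) h →
            ∃ λ k → det (λ i j → M i j + h * B i j) ≡ det M + h * (derivative M B + h * k)
det-shift {zero}  M B h = 0ℤ , sym (vanish h)
  where
  vanish : ∀ h → 1ℤ + h * (0ℤ + h * 0ℤ) ≡ 1ℤ
  vanish = solve-∀
det-shift {suc n} M B h = sumℤ r , (begin
  det (λ i j → M i j + h * B i j) ≡⟨ det-row (λ i j → M i j + h * B i j) ⟩
  sumℤ (λ j → sg j * ((M zero j + h * B zero j) * det (λ a b → m j a b + h * β j a b)))
    ≡⟨ sumℤ-cong (λ j → trans (cong (λ z → sg j * ((M zero j + h * B zero j) * z)) (proj₂ (det-shift (m j) (β j) h)))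
         (expand (sg j) (M zero j) (B zero j) h (det (m j)) (derivative (m j) (β j)) (k j))) ⟩
  sumℤ (λ j → p j + (h * q j + (h * h) * r j))
    ≡⟨ trans (sumℤ-+ p (λ j → h * q j + (h * h) * r j)) (cong (sumℤ p +_)
         (trans (sumℤ-+ (λ j → h * q j) (λ j → (h * h) * r j)) (cong₂ _+_ (sumℤ-* h q) (sumℤ-* (h * h) r)))) ⟩
  sumℤ p + (h * sumℤ q + (h * h) * sumℤ r) ≡⟨ regroup (sumℤ p) h (sumℤ q) (sumℤ r) ⟩
  sumℤ p + h * (sumℤ q + h * sumℤ r) ≡⟨ cong₂ (λ x y → x + h * (y + h * sumℤ r)) (sym (det-row M)) q-derivative ⟩
  det M + h * (derivative M B + h * sumℤ r) ∎)
  where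
  m β : Fin (suc n) → Matrix n
  m j = minor zero j M
  β j = minor zero j B
  k p q r : Fin (suc n) → ℤ
  k j = proj₁ (det-shift (m j) (β j) h)
  p j = sg j * (M zero j * det (m j))
  q j = sg j * (B zero j * det (m j)) + sg j * (M zero j * derivative (m j) (β j))
  r j = sg j * (M zero j * k j + B zero j * derivative (m j) (β j) + h * B zero j * k j)
  expand : ∀ s m b h d e k → s * ((m + h * b) * (d + h * (e + h * k))) ≡
           s * (m * d) + (h * (s * (b * d) + s * (m * e)) + (h * h) * (s * (m * k + b * e + h * b * k)))
  expand = solve-∀
  regroup : ∀ p h q r → p + (h * q + (h * h) * r) ≡ p + h * (q + h * r)
  regroup = solve-∀
  t : Fin n → Fin (suc n) → ℤ
  t i j = det (m j [ i ≔ β j i ])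
  q-derivative : sumℤ q ≡ derivative M B
  q-derivative = begin
    sumℤ q ≡⟨ sumℤ-+ (λ j → sg j * (B zero j * det (m j))) (λ j → sg j * (M zero j * derivative (m j) (β j))) ⟩
    sumℤ (λ j → sg j * (B zero j * det (m j))) + sumℤ (λ j → sg j * (M zero j * derivative (m j) (β j)))
      ≡⟨ cong₂ _+_ (sym (det-row (M [ zero ≔ B zero ]))) (begin
           sumℤ (λ j → sg j * (M zero j * sumℤ (λ i → t i j)))
             ≡⟨ sumℤ-cong (λ j → trans (sym (ℤ.*-assoc (sg j) (M zero j) (sumℤ (λ i → t i j))))
                  (trans (sym (sumℤ-* (sg j * M zero j) (λ i → t i j))) (sumℤ-cong (λ i → ℤ.*-assoc (sg j) (M zero j) (t i j))))) ⟩
           sumℤ (λ j → sumℤ (λ i → sg j * (M zero j * t i j)))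
             ≡⟨ sumℤ-swap (λ j i → sg j * (M zero j * t i j)) ⟩
           sumℤ (λ i → sumℤ (λ j → sg j * (M zero j * t i j)))
             ≡⟨ sumℤ-cong (λ i → trans (sumℤ-cong (λ j → cong (λ z → sg j * (M zero j * z))
                  (sym (det-cong (tail-minor-≔ (M ∘ suc) i (B (suc i)) j))))) (sym (det-row (M [ suc i ≔ B (suc i) ])))) ⟩
           sumℤ (λ i → det (M [ suc i ≔ B (suc i) ])) ∎) ⟩
    derivative M B ∎

-- Lowest-order terms of functions on ℤ

-- The quotient `q` may depend on `h`. For non-zero `c`, `k` is the order of vanishing of `f` at 0
-- and `c` its lowest coefficient.
record Lead (f : ℤ → ℤ) (k : ℕ) (c : ℤ) : Set where
  constructor lead
  field expansion : ∀ h → ∃ λ q → f h ≡ h ℤ.^ k * (c + h * q)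
open Lead

Lead-* : ∀ {f g k l c d} → Lead f k c → Lead g l d → Lead (λ h → f h * g h) (k ℕ.+ l) (c * d)
Lead-* {f} {g} {k} {l} {c} {d} F G = lead λ h → case (expansion F h , expansion G h) of λ { ((q , eq) , (r , er)) →
  c * r + q * d + h * q * r , (begin
  f h * g h                                      ≡⟨ cong₂ _*_ eq er ⟩
  (h ℤ.^ k * (c + h * q)) * (h ℤ.^ l * (d + h * r)) ≡⟨ expand (h ℤ.^ k) (h ℤ.^ l) c d h q r ⟩
  (h ℤ.^ k * h ℤ.^ l) * (c * d + h * (c * r + q * d + h * q * r))
                                                 ≡⟨ cong (_* (c * d + h * (c * r + q * d + h * q * r))) (ℤ.^-distribˡ-+-* h k l) ⟨
  h ℤ.^ (k ℕ.+ l) * (c * d + h * (c * r + q * d + h * q * r)) ∎) }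
  where
  expand : ∀ x y c d h q r → (x * (c + h * q)) * (y * (d + h * r)) ≡
           (x * y) * (c * d + h * (c * r + q * d + h * q * r))
  expand = solve-∀

Lead-cong : ∀ {f g k c} → (∀ h → f h ≡ g h) → Lead f k c → Lead g k c
Lead-cong e F = lead λ h → proj₁ (expansion F h) , trans (sym (e h)) (proj₂ (expansion F h))

-- With h = |a| + 1, a non-zero multiple of h is larger than a in absolute value.
divisible-by-all⇒0 : ∀ a → (∀ h → h ≢ 0ℤ → ∃ λ q → a ≡ h * q) → a ≡ 0ℤ
divisible-by-all⇒0 a div = case q ℤ.≟ 0ℤ of λ
  { (yes q≡0) → trans e (trans (cong (h *_) q≡0) (ℤ.*-zeroʳ h))
  ; (no q≢0)  → ⊥-elim (ℕ.<⇒≢ (ℕ.≤-trans (ℕ.n<1+n ℤ.∣ a ∣)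
                 (ℕ.m≤m*n (suc ℤ.∣ a ∣) ℤ.∣ q ∣ {{ℕ.≢-nonZero (q≢0 ∘ ℤ.∣i∣≡0⇒i≡0)}}))
                 (trans (cong ℤ.∣_∣ e) (ℤ.abs-* h q))) }
  where
  h = pos (suc ℤ.∣ a ∣)
  q = proj₁ (div h λ ())
  e : a ≡ h * q
  e = proj₂ (div h λ ())

^-≢0 : ∀ {h} k → h ≢ 0ℤ → h ℤ.^ k ≢ 0ℤ
^-≢0 zero    h≢0 ()
^-≢0 {h} (suc k) h≢0 e with ℤ.i*j≡0⇒i≡0∨j≡0 h e
... | inj₁ h≡0 = h≢0 h≡0
... | inj₂ p≡0 = ^-≢0 k h≢0 p≡0

*-cancelˡ : ∀ {a b c} → a ≢ 0ℤ → a * b ≡ a * c → b ≡ c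
*-cancelˡ {a} {b} {c} a≢0 e = ℤ.*-cancelˡ-≡ a b c {{ℤ.≢-nonZero a≢0}} e

-- Otherwise cancelling h^k makes `c` divisible by every non-zero h. The coefficient `d` may be
-- zero, so `l` can be a mere lower bound for a multiplicity.
Lead-order : ∀ {f k l c d} → c ≢ 0ℤ → Lead f k c → Lead f l d → l ℕ.≤ k
Lead-order {f} {k} {l} {c} {d} c≢0 F G with l ℕ.≤? k
... | yes l≤k = l≤k
... | no  l≰k = ⊥-elim (c≢0 (divisible-by-all⇒0 c div))
  where
  e = proj₁ (ℕ.m≤n⇒∃[o]m+o≡n (ℕ.≰⇒> l≰k))
  l≡ : suc (k ℕ.+ e) ≡ l
  l≡ = proj₂ (ℕ.m≤n⇒∃[o]m+o≡n (ℕ.≰⇒> l≰k))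
  div : ∀ h → h ≢ 0ℤ → ∃ λ q → c ≡ h * q
  div h h≢0 with expansion F h | expansion G h
  ... | q , eq | r , er = h ℤ.^ e * (d + h * r) - q , (begin
    c                                    ≡⟨ isolate c h q ⟩
    (c + h * q) - h * q                  ≡⟨ cong (_- h * q) (*-cancelˡ (^-≢0 k h≢0) (begin
      h ℤ.^ k * (c + h * q)              ≡⟨ trans (sym eq) er ⟩
      h ℤ.^ l * (d + h * r)              ≡⟨ cong (λ l → h ℤ.^ l * (d + h * r)) (trans (sym l≡) (sym (ℕ.+-suc k e))) ⟩
      h ℤ.^ (k ℕ.+ suc e) * (d + h * r)  ≡⟨ cong (_* (d + h * r)) (ℤ.^-distribˡ-+-* h k (suc e)) ⟩
      (h ℤ.^ k * (h * h ℤ.^ e)) * (d + h * r) ≡⟨ reassoc (h ℤ.^ k) h (h ℤ.^ e) (d + h * r) ⟩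
      h ℤ.^ k * (h * (h ℤ.^ e * (d + h * r))) ∎)) ⟩
    h * (h ℤ.^ e * (d + h * r)) - h * q  ≡⟨ factor h (h ℤ.^ e * (d + h * r)) q ⟩
    h * (h ℤ.^ e * (d + h * r) - q)      ∎)
    where
    isolate : ∀ c h q → c ≡ (c + h * q) - h * q
    isolate = solve-∀
    reassoc : ∀ x h y z → (x * (h * y)) * z ≡ x * (h * (y * z))
    reassoc = solve-∀
    factor : ∀ h x q → h * x - h * q ≡ h * (x - q)
    factor = solve-∀

-‿≡0 : ∀ {a b} → a - b ≡ 0ℤ → a ≡ b
-‿≡0 {a} {b} e = ℤ.i-j≡0⇒i≡j a b e

Lead-coefficient : ∀ {f k c d} → Lead f k c → Lead f k d → c ≡ d
Lead-coefficient {f} {k} {c} {d} F G = -‿≡0 (divisible-by-all⇒0 (c - d) div)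
  where
  div : ∀ h → h ≢ 0ℤ → ∃ λ q → c - d ≡ h * q
  div h h≢0 with expansion F h | expansion G h
  ... | q , eq | r , er = r - q , (begin
    c - d                                      ≡⟨ widen c d h q r ⟩
    (c + h * q) - (d + h * r) + h * (r - q)    ≡⟨ cong (λ z → z - (d + h * r) + h * (r - q)) (*-cancelˡ (^-≢0 k h≢0) (trans (sym eq) er)) ⟩
    (d + h * r) - (d + h * r) + h * (r - q)    ≡⟨ collapse (d + h * r) (h * (r - q)) ⟩
    h * (r - q)                                ∎)
    where
    widen : ∀ c d h q r → c - d ≡ (c + h * q) - (d + h * r) + h * (r - q)
    widen = solve-∀
    collapse : ∀ x y → x - x + y ≡ y
    collapse = solve-∀

Lead-unique : ∀ {f k l c d} → c ≢ 0ℤ → d ≢ 0ℤ → Lead f k c → Lead f l d → k ≡ l × c ≡ d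
Lead-unique {f} {k} {l} {c} {d} c≢0 d≢0 F G with ℕ.≤-antisym (Lead-order d≢0 G F) (Lead-order c≢0 F G)
... | refl = refl , Lead-coefficient F G

-- Determinants of weighted graphs

sumℕ-cong : ∀ {n} {f g : Fin n → ℕ} → (∀ i → f i ≡ g i) → sumℕ f ≡ sumℕ g
sumℕ-cong {zero}  h = refl
sumℕ-cong {suc n} h = cong₂ ℕ._+_ (h zero) (sumℕ-cong (λ i → h (suc i)))

ℕ-interchange : ∀ a b c d → (a ℕ.+ b) ℕ.+ (c ℕ.+ d) ≡ (a ℕ.+ c) ℕ.+ (b ℕ.+ d)
ℕ-interchange = ℕ-solve-∀

sumℕ-+ : ∀ {n} (f g : Fin n → ℕ) → sumℕ (λ i → f i ℕ.+ g i) ≡ sumℕ f ℕ.+ sumℕ g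
sumℕ-+ {zero}  f g = refl
sumℕ-+ {suc n} f g =
  trans (cong (f zero ℕ.+ g zero ℕ.+_) (sumℕ-+ (f ∘ suc) (g ∘ suc)))
        (ℕ-interchange (f zero) (g zero) (sumℕ (f ∘ suc)) (sumℕ (g ∘ suc)))

sumℕ-zero : ∀ {n} {f : Fin n → ℕ} → (∀ i → f i ≡ 0) → sumℕ f ≡ 0
sumℕ-zero {zero}  h = refl
sumℕ-zero {suc n} h = cong₂ ℕ._+_ (h zero) (sumℕ-zero (h ∘ suc))

ℕ-swap-heads : ∀ a b c → a ℕ.+ (b ℕ.+ c) ≡ b ℕ.+ (a ℕ.+ c)
ℕ-swap-heads = ℕ-solve-∀

sumℕ-punchIn : ∀ {n} (i : Fin (suc n)) (f : Fin (suc n) → ℕ) →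
               sumℕ f ≡ f i ℕ.+ sumℕ (λ a → f (punchIn i a))
sumℕ-punchIn zero f = refl
sumℕ-punchIn {suc n} (suc i) f =
  trans (cong (f zero ℕ.+_) (sumℕ-punchIn i (f ∘ suc)))
        (ℕ-swap-heads (f zero) (f (suc i)) (sumℕ (λ a → f (suc (punchIn i a)))))

data PunchView {n} (i : Fin (suc n)) : Fin (suc n) → Set where
  pivot : PunchView i i
  other : ∀ a → PunchView i (punchIn i a)

punchView : ∀ {n} (i v : Fin (suc n)) → PunchView i v
punchView i v with i ≟ v
... | yes refl = pivot
... | no i≢v   = subst (PunchView i) (Fin.punchIn-punchOut i≢v) (other (punchOut i≢v))

infixl 8 _∖_
_∖_ : ∀ {n} → Graph (suc n) → Fin (suc n) → Graph n
G ∖ i = record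
  { adj    = λ a b → adj G (punchIn i a) (punchIn i b)
  ; sym    = λ a b → adj-sym G (punchIn i a) (punchIn i b)
  ; irrefl = λ a → adj-irrefl G (punchIn i a) }

nbr : ∀ {n} → Graph (suc n) → Fin (suc n) → Fin n → ℕ
nbr G i a = b2ℕ (adj G (punchIn i a) i)

degree-∖ : ∀ {n} (G : Graph (suc n)) i a → degree G (punchIn i a) ≡ degree (G ∖ i) a ℕ.+ nbr G i a
degree-∖ G i a =
  trans (sumℕ-punchIn i (λ j → b2ℕ (adj G (punchIn i a) j))) (ℕ.+-comm (nbr G i a) _)

sum-nbr : ∀ {n} (G : Graph (suc n)) i → sumℕ (nbr G i) ≡ degree G i
sum-nbr G i = sym (trans (sumℕ-punchIn i (λ j → b2ℕ (adj G i j)))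
  (trans (cong (λ x → b2ℕ x ℕ.+ sumℕ (λ a → b2ℕ (adj G i (punchIn i a)))) (adj-irrefl G i))
         (sumℕ-cong (λ a → cong b2ℕ (adj-sym G i (punchIn i a))))))

-- Laplacians, their principal minors and yI + L all have this form, for different diagonals `e`.
diag-adj : ∀ {n} → Graph n → (Fin n → ℤ) → Matrix n
diag-adj G e i j = δ i j * e i - adjMatrix G i j

δ-punchIn : ∀ {n} i (a b : Fin n) → δ (punchIn i a) (punchIn i b) ≡ δ a b
δ-punchIn i a b with a ≟ b
... | yes refl = δ-refl (punchIn i a)
... | no a≢b   = δ-off (λ e → a≢b (Fin.punchIn-injective i a b e))

det-diag-adj-∖ : ∀ {n} (G : Graph (suc n)) e i →
                 det (minor i i (diag-adj G e)) ≡ det (diag-adj (G ∖ i) (e ∘ punchIn i))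
det-diag-adj-∖ G e i = det-cong (λ a b →
  cong (λ d → d * e (punchIn i a) - adjMatrix G (punchIn i a) (punchIn i b)) (δ-punchIn i a b))

det-diag-adj-cong : ∀ {n} (G : Graph n) {e e′} → (∀ i → e i ≡ e′ i) → det (diag-adj G e) ≡ det (diag-adj G e′)
det-diag-adj-cong G h = det-cong (λ i j → cong (λ x → δ i j * x - adjMatrix G i j) (h i))

det-diag-adj-step : ∀ {n} (G : Graph (suc n)) (e e′ : Fin (suc n) → ℤ) i t →
                    e i ≡ t + e′ i → (∀ a → a ≢ i → e a ≡ e′ a) →
                    det (diag-adj G e) ≡ t * det (diag-adj (G ∖ i) (e ∘ punchIn i)) + det (diag-adj G e′)
det-diag-adj-step {n} G e e′ i t eᵢ e-off = begin
  det (diag-adj G e) ≡⟨ det-cong entries ⟩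
  det (M [ i ≔ (λ b → t * δ i b + M i b) ]) ≡⟨ det-≔-lin M i t (δ i) (M i) ⟩
  t * det (M [ i ≔ δ i ]) + det (M [ i ≔ M i ])
    ≡⟨ cong₂ (λ x y → t * x + y) (trans (det-≔-δ M i) (det-diag-adj-∖ G e′ i)) (det-cong (≔-id M i)) ⟩
  t * det (diag-adj (G ∖ i) (e′ ∘ punchIn i)) + det M
    ≡⟨ cong (λ x → t * x + det M) (det-diag-adj-cong (G ∖ i) (λ a → sym (e-off (punchIn i a) (Fin.punchInᵢ≢i i a)))) ⟩
  t * det (diag-adj (G ∖ i) (e ∘ punchIn i)) + det M ∎
  where
  M = diag-adj G e′
  distribute : ∀ d t x y → d * (t + x) - y ≡ t * d + (d * x - y)
  distribute = solve-∀
  entries : ∀ a b → diag-adj G e a b ≡ (M [ i ≔ (λ b → t * δ i b + M i b) ]) a b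
  entries a b = ≔-elim (λ a r → diag-adj G e a b ≡ r b) M i (λ b → t * δ i b + M i b)
    (trans (cong (λ x → δ i b * x - adjMatrix G i b) eᵢ) (distribute (δ i b) t (e′ i) (adjMatrix G i b)))
    (λ a a≢i → cong (λ x → δ a b * x - adjMatrix G a b) (e-off a a≢i)) a

-- The reduced Laplacian of a multigraph with one additional vertex, the ground, which is joined to
-- i by `w i` edges. Its determinant counts the spanning trees of that multigraph.
weighted : ∀ {n} → Graph n → (Fin n → ℕ) → Matrix n
weighted G w = diag-adj G (λ i → pos (degree G i ℕ.+ w i))

Closed : ∀ {n} → Graph n → (Fin n → Bool) → Set
Closed G S = ∀ i j → adj G i j ≡ true → S i ≡ S j

-- Connectedness in terms of vertex sets instead of paths: sets extend easily from a graph with a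
-- deleted vertex, and a separating one can be searched for.
Conn : ∀ {n} → Graph n → Set
Conn G = ∀ S → Closed G S → ∀ i j → S i ≡ S j

-- Every component is joined to the ground, so the multigraph with the ground is connected.
Grounded : ∀ {n} → Graph n → (Fin n → ℕ) → Set
Grounded G w = ∀ S → Closed G S → (∀ i → S i ≡ true → w i ≡ 0) → ∀ i → S i ≡ false

-- Twice the number of edges, with those to the ground included. The bound 2n in `WeightedDet` is
-- that of a spanning tree on n + 1 vertices.
mass : ∀ {n} → Graph n → (Fin n → ℕ) → ℕ
mass G w = sumℕ (λ i → degree G i ℕ.+ 2 ℕ.* w i)

-- Deleting i from the matrix contracts i into the ground: the diagonal still counts an edge to i,
-- which becomes an edge from its other end to the ground.
restrict : ∀ {n} → Graph (suc n) → Fin (suc n) → (Fin (suc n) → ℕ) → Fin n → ℕ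
restrict G i w a = w (punchIn i a) ℕ.+ nbr G i a

det-weighted-∖ : ∀ {n} (G : Graph (suc n)) i w →
  det (diag-adj (G ∖ i) ((λ v → pos (degree G v ℕ.+ w v)) ∘ punchIn i)) ≡ det (weighted (G ∖ i) (restrict G i w))
det-weighted-∖ G i w = det-diag-adj-cong (G ∖ i) (λ a → cong pos (begin
  degree G (punchIn i a) ℕ.+ w (punchIn i a)                   ≡⟨ cong (ℕ._+ w (punchIn i a)) (degree-∖ G i a) ⟩
  (degree (G ∖ i) a ℕ.+ nbr G i a) ℕ.+ w (punchIn i a)         ≡⟨ rearrange (degree (G ∖ i) a) (nbr G i a) (w (punchIn i a)) ⟩
  degree (G ∖ i) a ℕ.+ (w (punchIn i a) ℕ.+ nbr G i a)         ∎))
  where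
  rearrange : ∀ d b w → (d ℕ.+ b) ℕ.+ w ≡ d ℕ.+ (w ℕ.+ b)
  rearrange = ℕ-solve-∀

-- Contracting i into the ground loses only the `w i` edges between the two.
mass-∖ : ∀ {n} (G : Graph (suc n)) i w → mass G w ≡ 2 ℕ.* w i ℕ.+ mass (G ∖ i) (restrict G i w)
mass-∖ G i w = begin
  mass G w ≡⟨ sumℕ-punchIn i (λ v → degree G v ℕ.+ 2 ℕ.* w v) ⟩
  (degree G i ℕ.+ 2 ℕ.* w i) ℕ.+ sumℕ (λ a → degree G (punchIn i a) ℕ.+ 2 ℕ.* w (punchIn i a))
    ≡⟨ cong (λ d → (d ℕ.+ 2 ℕ.* w i) ℕ.+ sumℕ f) (sym (sum-nbr G i)) ⟩
  (sumℕ (nbr G i) ℕ.+ 2 ℕ.* w i) ℕ.+ sumℕ f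
    ≡⟨ rearrange (sumℕ (nbr G i)) (2 ℕ.* w i) (sumℕ f) ⟩
  2 ℕ.* w i ℕ.+ (sumℕ (nbr G i) ℕ.+ sumℕ f) ≡⟨ cong (2 ℕ.* w i ℕ.+_) (sym (sumℕ-+ (nbr G i) f)) ⟩
  2 ℕ.* w i ℕ.+ sumℕ (λ a → nbr G i a ℕ.+ f a) ≡⟨ cong (2 ℕ.* w i ℕ.+_) (sumℕ-cong entry) ⟩
  2 ℕ.* w i ℕ.+ mass (G ∖ i) (restrict G i w) ∎
  where
  f = λ a → degree G (punchIn i a) ℕ.+ 2 ℕ.* w (punchIn i a)
  rearrange : ∀ a b c → (a ℕ.+ b) ℕ.+ c ≡ b ℕ.+ (a ℕ.+ c)
  rearrange = ℕ-solve-∀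
  double : ∀ b d w → b ℕ.+ ((d ℕ.+ b) ℕ.+ 2 ℕ.* w) ≡ d ℕ.+ 2 ℕ.* (w ℕ.+ b)
  double = ℕ-solve-∀
  entry : ∀ a → nbr G i a ℕ.+ f a ≡ degree (G ∖ i) a ℕ.+ 2 ℕ.* (w (punchIn i a) ℕ.+ nbr G i a)
  entry a = trans (cong (λ d → nbr G i a ℕ.+ (d ℕ.+ 2 ℕ.* w (punchIn i a))) (degree-∖ G i a))
                  (double (nbr G i a) (degree (G ∖ i) a) (w (punchIn i a)))

-- A closed set without weight is extended by `false` at i. This is closed, since a member adjacent
-- to i would have received weight. The assumption concerns only sets that avoid i, so it also
-- covers the case where i itself is the ground of a connected graph.
grounded-∖ : ∀ {n} (G : Graph (suc n)) i w →
  (∀ S → Closed G S → S i ≡ false → (∀ v → S v ≡ true → w v ≡ 0) → ∀ v → S v ≡ false) →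
  Grounded (G ∖ i) (restrict G i w)
grounded-∖ G i w h S closed zero-on a =
  trans (sym (on a)) (h S⁺ closed⁺ at zero-on⁺ (punchIn i a))
  where
  S⁺ = insertAt S i false
  at : S⁺ i ≡ false
  at = insertAt-lookup S i false
  on : ∀ a → S⁺ (punchIn i a) ≡ S a
  on = insertAt-punchIn S i false
  off : ∀ a → adj G (punchIn i a) i ≡ true → S a ≡ false
  off a e with S a in eq
  ... | false = refl
  ... | true with ℕ.m+n≡0⇒n≡0 (w (punchIn i a)) (zero-on a eq)
  ...   | z rewrite e with z
  ...     | ()
  closed⁺ : Closed G S⁺
  closed⁺ u v e with punchView i u | punchView i v
  ... | pivot   | pivot   = refl
  ... | pivot   | other b = trans at (sym (trans (on b) (off b (trans (adj-sym G (punchIn i b) i) e))))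
  ... | other a | pivot   = trans (trans (on a) (off a e)) (sym at)
  ... | other a | other b = trans (on a) (trans (closed a b e) (sym (on b)))
  zero-on⁺ : ∀ v → S⁺ v ≡ true → w v ≡ 0
  zero-on⁺ v e with punchView i v
  ... | pivot   with trans (sym at) e
  ...   | ()
  zero-on⁺ v e | other a = ℕ.m+n≡0⇒m≡0 (w (punchIn i a)) (zero-on a (trans (sym (on a)) e))

find-positive : ∀ {n} (w : Fin n → ℕ) → (∀ i → w i ≡ 0) ⊎ ∃ λ i → ∃ λ k → w i ≡ suc k
find-positive {zero}  w = inj₁ λ ()
find-positive {suc n} w with w zero in eq | find-positive (w ∘ suc)
... | suc k | _                  = inj₂ (zero , k , eq)
... | zero  | inj₁ all           = inj₁ λ { zero → eq ; (suc i) → all i }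
... | zero  | inj₂ (i , k , wᵢ)  = inj₂ (suc i , k , wᵢ)

sum-adjMatrix : ∀ {n} (G : Graph n) i → sumℤ (adjMatrix G i) ≡ pos (degree G i)
sum-adjMatrix G i = go (adj G i)
  where
  go : ∀ {m} (x : Fin m → Bool) → sumℤ (λ j → if x j then 1ℤ else 0ℤ) ≡ pos (sumℕ (λ j → b2ℕ (x j)))
  go {zero}  x = refl
  go {suc m} x with x zero
  ... | true  = cong (1ℤ +_) (go (x ∘ suc))
  ... | false = trans (ℤ.+-identityˡ _) (go (x ∘ suc))

adjMatrix-sym : ∀ {n} (G : Graph n) i j → adjMatrix G i j ≡ adjMatrix G j i
adjMatrix-sym G i j = cong (λ x → if x then 1ℤ else 0ℤ) (adj-sym G i j)

laplacian-singular : ∀ {n} (G : Graph (suc n)) → det (diag-adj G (λ i → pos (degree G i))) ≡ 0ℤ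
laplacian-singular G = trans (sym (ℤ.*-identityˡ (det L))) (left-kernel L (λ _ → 1ℤ) kernel zero)
  where
  L = diag-adj G (λ i → pos (degree G i))
  d : _ → ℤ
  d i = pos (degree G i)
  kernel : ∀ b → sumℤ (λ k → 1ℤ * L k b) ≡ 0ℤ
  kernel b = begin
    sumℤ (λ k → 1ℤ * L k b) ≡⟨ sumℤ-cong (λ k → trans (split (δ k b) (d k) (adjMatrix G k b))
                                  (cong (λ x → d k * δ k b + - x) (adjMatrix-sym G k b))) ⟩
    sumℤ (λ k → d k * δ k b + - adjMatrix G b k) ≡⟨ sumℤ-+ (λ k → d k * δ k b) (λ k → - adjMatrix G b k) ⟩
    sumℤ (λ k → d k * δ k b) + sumℤ (λ k → - adjMatrix G b k)
      ≡⟨ cong₂ _+_ (sumℤ-δʳ b d) (trans (sumℤ-neg (adjMatrix G b)) (cong -_ (sum-adjMatrix G b))) ⟩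
    d b + - d b ≡⟨ ℤ.+-inverseʳ (d b) ⟩
    0ℤ ∎
    where
    split : ∀ x d a → 1ℤ * (x * d - a) ≡ d * x + - a
    split = solve-∀

-- The four properties are proved together by lowering one positive weight at a time:
-- the determinant is additive, with the graph from which that vertex is deleted as second term.
record WeightedDet {n} (G : Graph n) (w : Fin n → ℕ) : Set where
  field
    value    : ℕ
    value≡   : det (weighted G w) ≡ pos value
    light    : mass G w ℕ.< 2 ℕ.* n → value ≡ 0
    positive : Grounded G w → 1 ℕ.≤ value
    tight    : Grounded G w → mass G w ≡ 2 ℕ.* n → value ≡ 1
open WeightedDet

weightedDet : ∀ {n} (G : Graph n) w → WeightedDet G w
weightedDet {zero} G w = record
  { value = 1 ; value≡ = refl ; light = λ () ; positive = λ _ → ℕ.≤-refl ; tight = λ _ _ → refl }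
weightedDet {suc n} G w = descend (sumℕ w) w refl
  where
  descend : ∀ s w → sumℕ w ≡ s → WeightedDet G w
  descend s w sum≡ with find-positive w
  ... | inj₁ w≡0 = record
    { value    = 0
    ; value≡   = trans (det-diag-adj-cong G (λ i → cong pos (trans (cong (degree G i ℕ.+_) (w≡0 i)) (ℕ.+-identityʳ _))))
                       (laplacian-singular G)
    ; light    = λ _ → refl
    ; positive = λ g → ⊥-elim (impossible g)
    ; tight    = λ g _ → ⊥-elim (impossible g) }
    where
    impossible : Grounded G w → ⊥
    impossible g with g (λ _ → true) (λ _ _ _ → refl) (λ i _ → w≡0 i) zero
    ... | ()
  descend zero w sum≡ | inj₂ (i , k , wᵢ) with trans (sym wᵢ) (ℕ.m+n≡0⇒m≡0 (w i) (trans (sym (sumℕ-punchIn i w)) sum≡))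
  ... | ()
  descend (suc s) w sum≡ | inj₂ (i , k , wᵢ) = record
    { value    = value A ℕ.+ value B
    ; value≡   = begin
        det (weighted G w)
          ≡⟨ det-diag-adj-step G _ (λ v → pos (degree G v ℕ.+ w′ v)) i 1ℤ e-at e-off ⟩
        1ℤ * det (diag-adj (G ∖ i) ((λ v → pos (degree G v ℕ.+ w v)) ∘ punchIn i)) + det (weighted G w′)
          ≡⟨ cong₂ (λ x y → 1ℤ * x + y) (trans (det-weighted-∖ G i w) (value≡ A)) (value≡ B) ⟩
        1ℤ * pos (value A) + pos (value B) ≡⟨ cong (_+ pos (value B)) (ℤ.*-identityˡ (pos (value A))) ⟩
        pos (value A ℕ.+ value B) ∎
    ; light    = λ lt → cong₂ ℕ._+_ (light A (A-light lt)) (light B (ℕ.≤-<-trans (ℕ.m≤n+m (mass G w′) 2) (subst (ℕ._< 2 ℕ.* suc n) mass-w lt)))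
    ; positive = λ g → ℕ.≤-trans (positive A (A-grounded g)) (ℕ.m≤m+n (value A) (value B))
    ; tight    = tight′ }
    where
    w′ : Fin (suc n) → ℕ
    w′ = updateAt w i (λ _ → k)
    w′-at : w′ i ≡ k
    w′-at = updateAt-updates i w
    w′-off : ∀ a → a ≢ i → w a ≡ w′ a
    w′-off a a≢i = sym (updateAt-minimal a i w a≢i)
    e-at : pos (degree G i ℕ.+ w i) ≡ 1ℤ + pos (degree G i ℕ.+ w′ i)
    e-at = cong pos (trans (cong (degree G i ℕ.+_) (trans wᵢ (cong suc (sym w′-at)))) (ℕ.+-suc (degree G i) (w′ i)))
    e-off : ∀ a → a ≢ i → pos (degree G a ℕ.+ w a) ≡ pos (degree G a ℕ.+ w′ a)
    e-off a a≢i = cong (λ x → pos (degree G a ℕ.+ x)) (w′-off a a≢i)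
    A = weightedDet (G ∖ i) (restrict G i w)
    sum′ : sumℕ w′ ≡ s
    sum′ = ℕ.suc-injective (begin
      suc (sumℕ w′)                                   ≡⟨ cong suc (sumℕ-punchIn i w′) ⟩
      suc (w′ i ℕ.+ sumℕ (λ a → w′ (punchIn i a)))
        ≡⟨ cong₂ (λ x y → suc x ℕ.+ y) w′-at (sumℕ-cong (λ a → sym (w′-off (punchIn i a) (Fin.punchInᵢ≢i i a)))) ⟩
      suc k ℕ.+ sumℕ (λ a → w (punchIn i a))          ≡⟨ cong (ℕ._+ sumℕ (λ a → w (punchIn i a))) (sym wᵢ) ⟩
      w i ℕ.+ sumℕ (λ a → w (punchIn i a))            ≡⟨ sumℕ-punchIn i w ⟨
      sumℕ w                                          ≡⟨ sum≡ ⟩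
      suc s                                           ∎)
    B = descend s w′ sum′
    mass-w : mass G w ≡ 2 ℕ.+ mass G w′
    mass-w = begin
      mass G w                                                   ≡⟨ mass-∖ G i w ⟩
      2 ℕ.* w i ℕ.+ mass (G ∖ i) (restrict G i w)
        ≡⟨ cong₂ (λ x y → 2 ℕ.* x ℕ.+ y) (trans wᵢ (cong suc (sym w′-at)))
             (sumℕ-cong (λ a → cong (λ x → degree (G ∖ i) a ℕ.+ 2 ℕ.* (x ℕ.+ nbr G i a)) (w′-off (punchIn i a) (Fin.punchInᵢ≢i i a)))) ⟩
      2 ℕ.* suc (w′ i) ℕ.+ mass (G ∖ i) (restrict G i w′)        ≡⟨ peel (w′ i) (mass (G ∖ i) (restrict G i w′)) ⟩
      2 ℕ.+ (2 ℕ.* w′ i ℕ.+ mass (G ∖ i) (restrict G i w′))      ≡⟨ cong (2 ℕ.+_) (mass-∖ G i w′) ⟨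
      2 ℕ.+ mass G w′                                            ∎
      where
      peel : ∀ x y → 2 ℕ.* suc x ℕ.+ y ≡ 2 ℕ.+ (2 ℕ.* x ℕ.+ y)
      peel = ℕ-solve-∀
    two+ : ∀ m x → 2 ℕ.* suc m ℕ.+ x ≡ 2 ℕ.+ (2 ℕ.* m ℕ.+ x)
    two+ = ℕ-solve-∀
    mass-A : mass G w ≡ 2 ℕ.+ (2 ℕ.* k ℕ.+ mass (G ∖ i) (restrict G i w))
    mass-A = trans (mass-∖ G i w) (trans (cong (λ x → 2 ℕ.* x ℕ.+ mass (G ∖ i) (restrict G i w)) wᵢ) (two+ k _))
    2n : 2 ℕ.* suc n ≡ 2 ℕ.+ 2 ℕ.* n
    2n = trans (sym (ℕ.+-identityʳ (2 ℕ.* suc n))) (trans (two+ n 0) (cong (2 ℕ.+_) (ℕ.+-identityʳ (2 ℕ.* n))))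
    A-light : mass G w ℕ.< 2 ℕ.* suc n → mass (G ∖ i) (restrict G i w) ℕ.< 2 ℕ.* n
    A-light lt = ℕ.≤-<-trans (ℕ.m≤n+m _ (2 ℕ.* k)) (ℕ.+-cancelˡ-< 2 _ _ (subst₂ ℕ._<_ mass-A 2n lt))
    A-grounded : Grounded G w → Grounded (G ∖ i) (restrict G i w)
    A-grounded g = grounded-∖ G i w (λ S closed _ zero-on → g S closed zero-on)
    mass-A₂ : mass G w ≡ 2 ℕ.* suc n → 2 ℕ.* k ℕ.+ mass (G ∖ i) (restrict G i w) ≡ 2 ℕ.* n
    mass-A₂ eq = ℕ.+-cancelˡ-≡ 2 _ _ (trans (sym mass-A) (trans eq 2n))
    B≡0 : mass G w ≡ 2 ℕ.* suc n → value B ≡ 0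
    B≡0 eq = light B (ℕ.≤-trans (ℕ.n≤1+n _) (ℕ.≤-reflexive (trans (sym mass-w) eq)))
    A≡1 : Grounded G w → ∀ k → 2 ℕ.* k ℕ.+ mass (G ∖ i) (restrict G i w) ≡ 2 ℕ.* n → value A ≡ 1
    A≡1 g zero    eq = tight A (A-grounded g) eq
    -- Here i has at least two edges to the ground; losing them would make `A` too light to be
    -- non-zero, against its being grounded.
    A≡1 g (suc m) eq = ⊥-elim (ℕ.<⇒≢ (positive A (A-grounded g)) (sym (light A
      (ℕ.≤-trans (ℕ.s≤s (ℕ.m≤n+m _ (suc (2 ℕ.* m)))) (ℕ.≤-reflexive (trans (sym (two+ m _)) eq))))))
    tight′ : Grounded G w → mass G w ≡ 2 ℕ.* suc n → value A ℕ.+ value B ≡ 1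
    tight′ g eq = cong₂ ℕ._+_ (A≡1 g k (mass-A₂ eq)) (B≡0 eq)

-- Characteristic polynomials of Laplacians

-- With y in place of -x, the diagonal of yI + L is a degree plus a weight, so weighted determinants
-- give the values at natural numbers.
chi : ∀ {n} → Matrix n → ℤ → ℤ
chi M y = det (λ i j → M i j + y * δ i j)

det-neg : ∀ {n} (M : Matrix n) → det (λ i j → - M i j) ≡ -1ℤ ℤ.^ n * det M
det-neg {zero}  M = refl
det-neg {suc n} M = begin
  det (λ i j → - M i j) ≡⟨ det-row (λ i j → - M i j) ⟩
  sumℤ (λ j → sg j * (- M zero j * det (λ a b → - minor zero j M a b)))
    ≡⟨ sumℤ-cong (λ j → trans (cong (λ z → sg j * (- M zero j * z)) (det-neg (minor zero j M)))
         (pull (sg j) (M zero j) (-1ℤ ℤ.^ n) (det (minor zero j M)))) ⟩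
  sumℤ (λ j → -1ℤ ℤ.^ suc n * (sg j * cof M j)) ≡⟨ sumℤ-* (-1ℤ ℤ.^ suc n) (λ j → sg j * cof M j) ⟩
  -1ℤ ℤ.^ suc n * sumℤ (λ j → sg j * cof M j) ≡⟨ cong (-1ℤ ℤ.^ suc n *_) (det-row M) ⟨
  -1ℤ ℤ.^ suc n * det M ∎
  where
  pull : ∀ s m p d → s * (- m * (p * d)) ≡ (-1ℤ * p) * (s * (m * d))
  pull = solve-∀

if-δ : ∀ {n} (i j : Fin n) x → (if does (i ≟ j) then x else 0ℤ) ≡ x * δ i j
if-δ i j x with does (i ≟ j)
... | true  = sym (ℤ.*-identityʳ x)
... | false = sym (ℤ.*-zeroʳ x)

charPoly-chi : ∀ {n} (M : Matrix n) x → charPoly M x ≡ -1ℤ ℤ.^ n * chi M (- x)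
charPoly-chi M x =
  trans (det-cong (λ i j → trans (cong (_- M i j) (if-δ i j x)) (flip x (δ i j) (M i j))))
        (det-neg (λ i j → M i j + - x * δ i j))
  where
  flip : ∀ x d m → x * d - m ≡ - (m + - x * d)
  flip = solve-∀

charPoly⇒chi : ∀ {n} (M N : Matrix n) → (∀ x → charPoly M x ≡ charPoly N x) → ∀ y → chi M y ≡ chi N y
charPoly⇒chi {n} M N h y = *-cancelˡ (^-≢0 n (λ ())) (begin
  -1ℤ ℤ.^ n * chi M y       ≡⟨ cong (λ z → -1ℤ ℤ.^ n * chi M z) (ℤ.neg-involutive y) ⟨
  -1ℤ ℤ.^ n * chi M (- - y) ≡⟨ charPoly-chi M (- y) ⟨
  charPoly M (- y)          ≡⟨ h (- y) ⟩
  charPoly N (- y)          ≡⟨ charPoly-chi N (- y) ⟩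
  -1ℤ ℤ.^ n * chi N (- - y) ≡⟨ cong (λ z → -1ℤ ℤ.^ n * chi N z) (ℤ.neg-involutive y) ⟩
  -1ℤ ℤ.^ n * chi N y       ∎)

chi⇒charPoly : ∀ {n} (M N : Matrix n) → (∀ y → chi M y ≡ chi N y) → ∀ x → charPoly M x ≡ charPoly N x
chi⇒charPoly {n} M N h x =
  trans (charPoly-chi M x) (trans (cong (-1ℤ ℤ.^ n *_) (h (- x))) (sym (charPoly-chi N x)))

chi-cong : ∀ {n} {M N : Matrix n} → (∀ i j → M i j ≡ N i j) → ∀ y → chi M y ≡ chi N y
chi-cong h y = det-cong (λ i j → cong (_+ y * δ i j) (h i j))

shifted : ∀ {n} → Matrix n → ℤ → Matrix n
shifted M a i j = M i j + a * δ i j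

chi-expand : ∀ {n} (M : Matrix n) a h →
             ∃ λ q → chi M (a + h) ≡ chi M a + h * (derivative (shifted M a) δ + h * q)
chi-expand M a h with det-shift (shifted M a) δ h
... | q , e = q , trans (det-cong (λ i j → split (M i j) a h (δ i j))) e
  where
  split : ∀ m a h d → m + (a + h) * d ≡ (m + a * d) + h * d
  split = solve-∀

chi-Lead₀ : ∀ {n} (M : Matrix n) a → Lead (λ h → chi M (a + h)) 0 (chi M a)
chi-Lead₀ M a = lead λ h → case chi-expand M a h of λ { (q , e) →
  derivative (shifted M a) δ + h * q , trans e (sym (ℤ.*-identityˡ (chi M a + h * (derivative (shifted M a) δ + h * q)))) }

chi-Lead₁ : ∀ {n} (M : Matrix n) a → chi M a ≡ 0ℤ → Lead (λ h → chi M (a + h)) 1 (derivative (shifted M a) δ)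
chi-Lead₁ M a root = lead λ h → case chi-expand M a h of λ { (q , e) →
  q , trans e (trans (cong (_+ h * (derivative (shifted M a) δ + h * q)) root) (tidy h (derivative (shifted M a) δ + h * q))) }
  where
  tidy : ∀ h x → 0ℤ + h * x ≡ (h * 1ℤ) * x
  tidy = solve-∀

Lap : ∀ {n} → Graph n → Matrix n
Lap G = diag-adj G (λ i → pos (degree G i))

laplacian-Lap : ∀ {n} (G : Graph n) i j → laplacian G i j ≡ Lap G i j
laplacian-Lap G i j = cong (_- adjMatrix G i j) (trans (if-δ i j (pos (degree G i))) (ℤ.*-comm (pos (degree G i)) (δ i j)))

Lap-sym : ∀ {n} (G : Graph n) i j → Lap G i j ≡ Lap G j i
Lap-sym G i j = cong₂ _-_ diag (adjMatrix-sym G i j)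
  where
  diag : δ i j * pos (degree G i) ≡ δ j i * pos (degree G j)
  diag with i ≟ j
  ... | yes refl = cong (_* pos (degree G i)) (sym (δ-refl i))
  ... | no i≢j   = cong (_* pos (degree G j)) (sym (δ-off {i = j} {i} (i≢j ∘ sym)))

sumDeg : ∀ {n} → Graph n → ℕ
sumDeg G = sumℕ (degree G)

cofactor : ∀ {n} (G : Graph (suc n)) i → WeightedDet (G ∖ i) (restrict G i (λ _ → 0))
cofactor G i = weightedDet (G ∖ i) (restrict G i (λ _ → 0))

cofactor≡ : ∀ {n} (G : Graph (suc n)) i → det (minor i i (Lap G)) ≡ pos (value (cofactor G i))
cofactor≡ G i = begin
  det (minor i i (Lap G)) ≡⟨ det-diag-adj-∖ G (λ v → pos (degree G v)) i ⟩
  det (diag-adj (G ∖ i) ((λ v → pos (degree G v)) ∘ punchIn i))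
    ≡⟨ det-diag-adj-cong (G ∖ i) (λ a → cong pos (sym (ℕ.+-identityʳ (degree G (punchIn i a))))) ⟩
  det (diag-adj (G ∖ i) ((λ v → pos (degree G v ℕ.+ 0)) ∘ punchIn i)) ≡⟨ det-weighted-∖ G i (λ _ → 0) ⟩
  det (weighted (G ∖ i) (restrict G i (λ _ → 0))) ≡⟨ value≡ (cofactor G i) ⟩
  pos (value (cofactor G i)) ∎

cofactor-grounded : ∀ {n} (G : Graph (suc n)) → Conn G → ∀ i → Grounded (G ∖ i) (restrict G i (λ _ → 0))
cofactor-grounded G conn i = grounded-∖ G i (λ _ → 0) (λ S closed at _ v → trans (conn S closed v i) at)

cofactor-mass : ∀ {n} (G : Graph (suc n)) i → mass (G ∖ i) (restrict G i (λ _ → 0)) ≡ sumDeg G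
cofactor-mass G i = sym (trans (sumℕ-cong (λ v → sym (ℕ.+-identityʳ (degree G v)))) (mass-∖ G i (λ _ → 0)))

cofactor-positive : ∀ {n} (G : Graph (suc n)) → Conn G → ∀ i → 1 ℕ.≤ value (cofactor G i)
cofactor-positive G conn i = positive (cofactor G i) (cofactor-grounded G conn i)

cofactor-tree : ∀ {n} (G : Graph (suc n)) → Conn G → sumDeg G ≡ 2 ℕ.* n → ∀ i → value (cofactor G i) ≡ 1
cofactor-tree G conn e i = tight (cofactor G i) (cofactor-grounded G conn i) (trans (cofactor-mass G i) e)

-- A cofactor is positive by connectedness, but would be 0 if there were fewer edges.
conn-sumDeg : ∀ {n} (G : Graph (suc n)) → Conn G → 2 ℕ.* n ℕ.≤ sumDeg G
conn-sumDeg {n} G conn with 2 ℕ.* n ℕ.≤? sumDeg G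
... | yes p = p
... | no ¬p = ⊥-elim (ℕ.<⇒≢ (cofactor-positive G conn zero)
                (sym (light (cofactor G zero) (subst (ℕ._< 2 ℕ.* n) (sym (cofactor-mass G zero)) (ℕ.≰⇒> ¬p)))))

-- The number of vertices times the number of spanning trees. The proof uses that every summand is
-- at least 1 for a connected graph, and equal to 1 for a tree.
treeSum : ∀ {n} → Graph (suc n) → ℕ
treeSum G = sumℕ (λ i → value (cofactor G i))

sumℤ-pos : ∀ {n} (f : Fin n → ℕ) → sumℤ (λ i → pos (f i)) ≡ pos (sumℕ f)
sumℤ-pos {zero}  f = refl
sumℤ-pos {suc n} f = cong (pos (f zero) +_) (sumℤ-pos (f ∘ suc))

shifted-zero : ∀ {n} (M : Matrix n) i j → shifted M 0ℤ i j ≡ M i j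
shifted-zero M i j = ℤ.+-identityʳ (M i j)

chi-Lap-root : ∀ {n} (G : Graph (suc n)) → chi (Lap G) 0ℤ ≡ 0ℤ
chi-Lap-root G = trans (det-cong (shifted-zero (Lap G))) (laplacian-singular G)

Lap-Lead : ∀ {n} (G : Graph (suc n)) → Lead (chi (Lap G)) 1 (pos (treeSum G))
Lap-Lead G = Lead-cong (λ h → cong (chi (Lap G)) (ℤ.+-identityˡ h))
  (subst (Lead (λ h → chi (Lap G) (0ℤ + h)) 1) coefficient (chi-Lead₁ (Lap G) 0ℤ (chi-Lap-root G)))
  where
  coefficient : derivative (shifted (Lap G) 0ℤ) δ ≡ pos (treeSum G)
  coefficient = trans (sumℤ-cong (λ i → trans (det-≔-δ (shifted (Lap G) 0ℤ) i)
      (trans (det-cong (λ a b → shifted-zero (Lap G) (punchIn i a) (punchIn i b))) (cofactor≡ G i))))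
    (sumℤ-pos (λ i → value (cofactor G i)))

sumℕ-ones : ∀ n → sumℕ {n} (λ _ → 1) ≡ n
sumℕ-ones zero    = refl
sumℕ-ones (suc n) = cong suc (sumℕ-ones n)

sumℕ-mono : ∀ {n} {f g : Fin n → ℕ} → (∀ i → f i ℕ.≤ g i) → sumℕ f ℕ.≤ sumℕ g
sumℕ-mono {zero}  h = ℕ.z≤n
sumℕ-mono {suc n} h = ℕ.+-mono-≤ (h zero) (sumℕ-mono (h ∘ suc))

treeSum-≥ : ∀ {n} (G : Graph (suc n)) → Conn G → suc n ℕ.≤ treeSum G
treeSum-≥ {n} G conn = subst (ℕ._≤ treeSum G) (sumℕ-ones (suc n)) (sumℕ-mono (cofactor-positive G conn))

treeSum-tree : ∀ {n} (G : Graph (suc n)) → Conn G → sumDeg G ≡ 2 ℕ.* n → treeSum G ≡ suc n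
treeSum-tree {n} G conn e = trans (sumℕ-cong (cofactor-tree G conn e)) (sumℕ-ones (suc n))

-- Lowering the weight of one vertex by the whole of `y` splits off `y` times the determinant
-- without that vertex, and the rest is a natural number. The result gives the growth of `chi` at
-- natural arguments.
weighted-≥ : ∀ {n} (G : Graph n) w y → (∀ i → y ℕ.≤ w i) → y ℕ.^ n ℕ.≤ value (weightedDet G w)
weighted-≥ {zero}  G w y h = ℕ.≤-refl
weighted-≥ {suc n} G w y h = ℕ.≤-trans (ℕ.*-monoʳ-≤ y (weighted-≥ (G ∖ zero) (restrict G zero w) y
    (λ a → ℕ.≤-trans (h (suc a)) (ℕ.m≤m+n _ _)))) (ℕ.≤-trans (ℕ.m≤m+n _ (value B)) (ℕ.≤-reflexive (sym value-split)))
  where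
  w′ : Fin (suc n) → ℕ
  w′ = updateAt w zero (λ x → x ℕ.∸ y)
  A = weightedDet (G ∖ zero) (restrict G zero w)
  B = weightedDet G w′
  value-split : value (weightedDet G w) ≡ y ℕ.* value A ℕ.+ value B
  value-split = ℤ.+-injective (begin
    pos (value (weightedDet G w)) ≡⟨ value≡ (weightedDet G w) ⟨
    det (weighted G w) ≡⟨ det-diag-adj-step G (λ v → pos (degree G v ℕ.+ w v)) (λ v → pos (degree G v ℕ.+ w′ v)) zero (pos y)
                            (cong pos (trans (cong (degree G zero ℕ.+_) (sym (ℕ.m+[n∸m]≡n (h zero)))) (swap (degree G zero) y (w zero ℕ.∸ y))))
                            (λ { zero a≢0 → ⊥-elim (a≢0 refl) ; (suc a) _ → refl }) ⟩
    pos y * det (diag-adj (G ∖ zero) ((λ v → pos (degree G v ℕ.+ w v)) ∘ punchIn zero)) + det (weighted G w′)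
      ≡⟨ cong₂ (λ a b → pos y * a + b) (trans (det-weighted-∖ G zero w) (value≡ A)) (value≡ B) ⟩
    pos y * pos (value A) + pos (value B) ≡⟨ cong (_+ pos (value B)) (ℤ.pos-* y (value A)) ⟨
    pos (y ℕ.* value A ℕ.+ value B) ∎)
    where
    swap : ∀ a b c → a ℕ.+ (b ℕ.+ c) ≡ b ℕ.+ (a ℕ.+ c)
    swap = ℕ-solve-∀

chi-Lap-weighted : ∀ {n} (G : Graph n) y → chi (Lap G) (pos y) ≡ pos (value (weightedDet G (λ _ → y)))
chi-Lap-weighted G y = trans (det-cong (λ i j → trans (merge (δ i j) (pos (degree G i)) (adjMatrix G i j) (pos y)) refl))
                             (value≡ (weightedDet G (λ _ → y)))
  where
  merge : ∀ d e a y → (d * e - a) + y * d ≡ d * (e + y) - a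
  merge = solve-∀

sumℕ≡0⇒all≡0 : ∀ {n} (f : Fin n → ℕ) → sumℕ f ≡ 0 → ∀ i → f i ≡ 0
sumℕ≡0⇒all≡0 f e zero    = ℕ.m+n≡0⇒m≡0 (f zero) e
sumℕ≡0⇒all≡0 f e (suc i) = sumℕ≡0⇒all≡0 (f ∘ suc) (ℕ.m+n≡0⇒n≡0 (f zero) e) i

sum-squares≡0 : ∀ {n} (f : Fin n → ℤ) → sumℤ (λ i → f i * f i) ≡ 0ℤ → ∀ i → f i ≡ 0ℤ
sum-squares≡0 f e i = ℤ.∣i∣≡0⇒i≡0 (square≡0 (sumℕ≡0⇒all≡0 (λ i → ℤ.∣ f i ∣ ℕ.* ℤ.∣ f i ∣) total i))
  where
  total : sumℕ (λ i → ℤ.∣ f i ∣ ℕ.* ℤ.∣ f i ∣) ≡ 0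
  total = ℤ.+-injective (trans (sym (sumℤ-pos (λ i → ℤ.∣ f i ∣ ℕ.* ℤ.∣ f i ∣))) (trans (sumℤ-cong (λ i → sym (square (f i)))) e))
    where
    square : ∀ x → x * x ≡ pos (ℤ.∣ x ∣ ℕ.* ℤ.∣ x ∣)
    square x = begin
      x * x ≡⟨ ℤ.◃-inverse (x * x) ⟨
      ℤ.sign (x * x) ℤ.◃ ℤ.∣ x * x ∣ ≡⟨ nonneg x ⟩
      pos (ℤ.∣ x ∣ ℕ.* ℤ.∣ x ∣) ∎
      where
      nonneg : ∀ x → ℤ.sign (x * x) ℤ.◃ ℤ.∣ x * x ∣ ≡ pos (ℤ.∣ x ∣ ℕ.* ℤ.∣ x ∣)
      nonneg (pos zero) = refl
      nonneg ℤ.+[1+ n ] = refl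
      nonneg ℤ.-[1+ n ] = refl
  square≡0 : ∀ {m} → m ℕ.* m ≡ 0 → m ≡ 0
  square≡0 {zero} _ = refl

adjugate-sym : ∀ {n} (M : Matrix n) → (∀ i j → M i j ≡ M j i) → ∀ i j → adjugate M i j ≡ adjugate M j i
adjugate-sym M M-sym i j = begin
  det (M [ j ≔ δ i ])      ≡⟨ det-cong (λ a b → ≔-elim (λ a r → r b ≡ (M ᵀ [ j ≔ δ i ]) a b) M j (δ i)
                                 (cong (λ r → r b) (sym (≔-at (M ᵀ) j (δ i))))
                                 (λ a a≢j → trans (M-sym a b) (cong (λ r → r b) (sym (≔-off (M ᵀ) (δ i) a≢j)))) a) ⟩
  adjugate (M ᵀ) i j       ≡⟨ adjugate-ᵀ M i j ⟩
  adjugate M j i           ∎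

-- The columns of the adjugate B lie in the kernel of M. The combination `v` of columns i and j is
-- chosen to vanish at j, so it is also killed by `M′`, whose row j is a unit vector. As det `M′` =
-- B j j is non-zero, `v` is zero, and its entry at i is the claim.
det≡0⇒adjugate-rank1 : ∀ {n} (M : Matrix n) → (∀ i j → M i j ≡ M j i) → det M ≡ 0ℤ →
  ∀ i j → adjugate M j j ≢ 0ℤ → adjugate M j j * adjugate M i i ≡ adjugate M i j * adjugate M i j
det≡0⇒adjugate-rank1 {n} M M-sym sing i j nz = -‿≡0 (begin
  B j j * B i i - B i j * B i j ≡⟨ cong (λ z → B j j * B i i - z * B i j) (B-sym i j) ⟩
  v i                           ≡⟨ *-cancelˡ nz (trans (ℤ.*-comm (B j j) (v i)) (trans (cong (v i *_) (sym (det-ᵀ M′)))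
                                     (trans (left-kernel (M′ ᵀ) v kernel i) (sym (ℤ.*-zeroʳ (B j j)))))) ⟩
  0ℤ                            ∎)
  where
  B = adjugate M
  B-sym = adjugate-sym M M-sym
  v : Fin n → ℤ
  v k = B j j * B k i - B j i * B k j
  M′ = M [ j ≔ δ j ]
  MB : ∀ a c → sumℤ (λ k → M a k * B k c) ≡ 0ℤ
  MB a c = trans (M·adj M a c) (trans (cong (δ a c *_) sing) (ℤ.*-zeroʳ (δ a c)))
  distr : ∀ m x p y q → (x * p - y * q) * m ≡ x * (m * p) + - y * (m * q)
  distr = solve-∀
  Mv : ∀ a → sumℤ (λ k → v k * M a k) ≡ 0ℤ
  Mv a = begin
    sumℤ (λ k → v k * M a k) ≡⟨ sumℤ-cong (λ k → distr (M a k) (B j j) (B k i) (B j i) (B k j)) ⟩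
    sumℤ (λ k → B j j * (M a k * B k i) + - B j i * (M a k * B k j))
      ≡⟨ sumℤ-+ (λ k → B j j * (M a k * B k i)) (λ k → - B j i * (M a k * B k j)) ⟩
    sumℤ (λ k → B j j * (M a k * B k i)) + sumℤ (λ k → - B j i * (M a k * B k j))
      ≡⟨ cong₂ _+_ (trans (sumℤ-* (B j j) (λ k → M a k * B k i)) (trans (cong (B j j *_) (MB a i)) (ℤ.*-zeroʳ (B j j))))
                   (trans (sumℤ-* (- B j i) (λ k → M a k * B k j)) (trans (cong (- B j i *_) (MB a j)) (ℤ.*-zeroʳ (- B j i)))) ⟩
    0ℤ ∎
  vanish : ∀ x y → x * y - y * x ≡ 0ℤ
  vanish = solve-∀
  kernel : ∀ b → sumℤ (λ k → v k * M′ b k) ≡ 0ℤ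
  kernel b with b ≟ j
  ... | yes refl = trans (sumℤ-cong (λ k → cong (λ r → v k * r k) (≔-at M b (δ b))))
                   (trans (sumℤ-cong (λ k → ℤ.*-comm (v k) (δ b k))) (trans (sumℤ-δ b v) (vanish (B b b) (B b i))))
  ... | no b≢j   = trans (sumℤ-cong (λ k → cong (λ r → v k * r k) (≔-off M (δ j) b≢j))) (Mv b)

-- Says that a is not ±1, in the form in which it is used: a number congruent to 1 modulo a is not
-- 0.
Non-unit : ℤ → Set
Non-unit a = ∀ k → 1ℤ + a * k ≢ 0ℤ

-- Modulo a the principal minors of L + aI agree with those of L, which are 1 for a tree; so the
-- adjugate has rank one and a non-zero diagonal, all of one sign, and a root a of chi is simple.
tree-root-simple : ∀ {n} (G : Graph (suc n)) → Conn G → sumDeg G ≡ 2 ℕ.* n → ∀ a → Non-unit a →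
                   chi (Lap G) a ≡ 0ℤ → derivative (shifted (Lap G) a) δ ≢ 0ℤ
tree-root-simple {n} G conn e a non-unit root s≡0 = diag-≢0 zero (sum-squares≡0 (λ i → B i zero) squares zero)
  where
  M = shifted (Lap G) a
  B = adjugate M
  M-sym : ∀ i j → M i j ≡ M j i
  M-sym i j = cong₂ (λ x y → x + a * y) (Lap-sym G i j) (δ-sym i j)
  diag-≢0 : ∀ i → B i i ≢ 0ℤ
  diag-≢0 i b≡0 = non-unit k (trans (sym unit) b≡0)
    where
    m = minor i i (Lap G)
    k = derivative m δ + a * proj₁ (det-shift m δ a)
    unit : B i i ≡ 1ℤ + a * k
    unit = begin
      det (M [ i ≔ δ i ])                 ≡⟨ det-≔-δ M i ⟩
      det (minor i i M)                   ≡⟨ det-cong (λ x y → cong (λ d → m x y + a * d) (δ-punchIn i x y)) ⟩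
      det (λ x y → m x y + a * δ x y)     ≡⟨ proj₂ (det-shift m δ a) ⟩
      det m + a * k                       ≡⟨ cong (_+ a * k) (trans (cofactor≡ G i) (cong pos (cofactor-tree G conn e i))) ⟩
      1ℤ + a * k                          ∎
  squares : sumℤ (λ i → B i zero * B i zero) ≡ 0ℤ
  squares = begin
    sumℤ (λ i → B i zero * B i zero) ≡⟨ sumℤ-cong (λ i → sym (det≡0⇒adjugate-rank1 M M-sym root i zero (diag-≢0 zero))) ⟩
    sumℤ (λ i → B zero zero * B i i) ≡⟨ sumℤ-* (B zero zero) (λ i → B i i) ⟩
    B zero zero * derivative M δ     ≡⟨ cong (B zero zero *_) s≡0 ⟩
    B zero zero * 0ℤ                 ≡⟨ ℤ.*-zeroʳ (B zero zero) ⟩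
    0ℤ                               ∎

-2ℤ : ℤ
-2ℤ = ℤ.-[1+ 1 ]

-2-non-unit : Non-unit -2ℤ
-2-non-unit k e = odd ℤ.∣ k ∣ (trans (sym (ℤ.abs-* -2ℤ k)) (cong ℤ.∣_∣ two-k))
  where
  shuffle : ∀ x → x ≡ -1ℤ + (1ℤ + x)
  shuffle = solve-∀
  two-k : -2ℤ * k ≡ -1ℤ
  two-k = trans (shuffle (-2ℤ * k)) (cong (-1ℤ +_) e)
  odd : ∀ m → 2 ℕ.* m ≢ 1
  odd zero ()
  odd (suc m) p with trans (sym (ℕ.+-suc m (m ℕ.+ 0))) (ℕ.suc-injective p)
  ... | ()

*-≡0ˡ : ∀ a b → a ≢ 0ℤ → a * b ≡ 0ℤ → b ≡ 0ℤ
*-≡0ˡ a b a≢0 e with ℤ.i*j≡0⇒i≡0∨j≡0 a e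
... | inj₁ a≡0 = ⊥-elim (a≢0 a≡0)
... | inj₂ b≡0 = b≡0

-- Evaluating f(h) = h (c + h q) at a non-zero root h.
Lead₁-root-divides : ∀ {f c} → Lead f 1 c → ∀ h → h ≢ 0ℤ → f h ≡ 0ℤ → ∃ λ k → ℤ.∣ c ∣ ≡ ℤ.∣ h ∣ ℕ.* k
Lead₁-root-divides {f} {c} F h h≢0 root with expansion F h
... | q , eq = ℤ.∣ q ∣ , trans (cong ℤ.∣_∣ size) (trans (ℤ.∣-i∣≡∣i∣ (h * q)) (ℤ.abs-* h q))
  where
  shuffle : ∀ t x → t ≡ (t + x) + - x
  shuffle = solve-∀
  factor : c + h * q ≡ 0ℤ
  factor = *-≡0ˡ (h ℤ.^ 1) (c + h * q) (^-≢0 1 h≢0) (trans (sym eq) root)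
  size : c ≡ - (h * q)
  size = begin
    c                         ≡⟨ shuffle c (h * q) ⟩
    (c + h * q) + - (h * q)   ≡⟨ cong (_+ - (h * q)) factor ⟩
    0ℤ + - (h * q)            ≡⟨ ℤ.+-identityˡ (- (h * q)) ⟩
    - (h * q)                 ∎

-- The lowest coefficient of `chi` is the order of the tree, and the root -2 divides it.
tree-root-even : ∀ {n} (G : Graph (suc n)) → Conn G → sumDeg G ≡ 2 ℕ.* n →
                 chi (Lap G) -2ℤ ≡ 0ℤ → ∃ λ k → suc n ≡ 2 ℕ.* k
tree-root-even G conn e root = proj₁ half , trans (sym (treeSum-tree G conn e)) (proj₂ half)
  where half = Lead₁-root-divides (Lap-Lead G) -2ℤ (λ ()) root

-- Traces of powers are determined by the characteristic polynomial

mpow : ∀ {n} → Matrix n → ℕ → Matrix n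
mpow M zero    = δ
mpow M (suc k) = λ i j → sumℤ (λ l → mpow M k i l * M l j)

tr : ∀ {n} → Matrix n → ℤ
tr M = sumℤ (λ i → M i i)

+-cancelˡ : ∀ a b c → a + b ≡ a + c → b ≡ c
+-cancelˡ a b c e = trans (peel a b) (trans (cong (_- a) e) (sym (peel a c)))
  where
  peel : ∀ a b → b ≡ (a + b) - a
  peel = solve-∀

derivative-unique : ∀ {n} (M N : Matrix n) → (∀ y → chi M y ≡ chi N y) →
                    ∀ a → derivative (shifted M a) δ ≡ derivative (shifted N a) δ
derivative-unique M N e a = -‿≡0 (divisible-by-all⇒0 (d - d′) div)
  where
  d = derivative (shifted M a) δ
  d′ = derivative (shifted N a) δ
  div : ∀ h → h ≢ 0ℤ → ∃ λ q → d - d′ ≡ h * q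
  div h h≢0 = q′ - q , (begin
    d - d′                                    ≡⟨ widen d d′ h q q′ ⟩
    (d + h * q) - (d′ + h * q′) + h * (q′ - q) ≡⟨ cong (λ z → z - (d′ + h * q′) + h * (q′ - q)) (*-cancelˡ h≢0 (+-cancelˡ (chi M a) (h * (d + h * q)) (h * (d′ + h * q′)) same)) ⟩
    (d′ + h * q′) - (d′ + h * q′) + h * (q′ - q) ≡⟨ collapse (d′ + h * q′) (h * (q′ - q)) ⟩
    h * (q′ - q)                              ∎)
    where
    q = proj₁ (chi-expand M a h)
    q′ = proj₁ (chi-expand N a h)
    same : chi M a + h * (d + h * q) ≡ chi M a + h * (d′ + h * q′)
    same = begin
      chi M a + h * (d + h * q)   ≡⟨ proj₂ (chi-expand M a h) ⟨
      chi M (a + h)               ≡⟨ e (a + h) ⟩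
      chi N (a + h)               ≡⟨ proj₂ (chi-expand N a h) ⟩
      chi N a + h * (d′ + h * q′) ≡⟨ cong (_+ h * (d′ + h * q′)) (e a) ⟨
      chi M a + h * (d′ + h * q′) ∎
    widen : ∀ d d′ h q q′ → d - d′ ≡ (d + h * q) - (d′ + h * q′) + h * (q′ - q)
    widen = solve-∀
    collapse : ∀ x y → x - x + y ≡ y
    collapse = solve-∀

-- The argument is shifted by one, so that powers of it are never 0.
record Growth (m : ℕ) (f : ℕ → ℤ) : Set where
  constructor growth
  field
    factor : ℕ
    bound  : ∀ y → ℤ.∣ f y ∣ ℕ.≤ factor ℕ.* suc y ℕ.^ m
open Growth

growth-const : ∀ c → Growth 0 (λ _ → c)
growth-const c = growth ℤ.∣ c ∣ (λ _ → ℕ.≤-reflexive (sym (ℕ.*-identityʳ ℤ.∣ c ∣)))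

growth-+ : ∀ {m f g} → Growth m f → Growth m g → Growth m (λ y → f y + g y)
growth-+ {m} {f} {g} F G = growth (factor F ℕ.+ factor G) λ y → ℕ.≤-trans (ℤ.∣i+j∣≤∣i∣+∣j∣ (f y) (g y))
  (ℕ.≤-trans (ℕ.+-mono-≤ (bound F y) (bound G y)) (ℕ.≤-reflexive (sym (ℕ.*-distribʳ-+ (suc y ℕ.^ m) (factor F) (factor G)))))

growth-* : ∀ {m k f g} → Growth m f → Growth k g → Growth (m ℕ.+ k) (λ y → f y * g y)
growth-* {m} {k} {f} {g} F G = growth (factor F ℕ.* factor G) λ y → ℕ.≤-trans (ℕ.≤-reflexive (ℤ.abs-* (f y) (g y)))
  (ℕ.≤-trans (ℕ.*-mono-≤ (bound F y) (bound G y)) (ℕ.≤-reflexive (trans (rearrange (factor F) (suc y ℕ.^ m) (factor G) (suc y ℕ.^ k))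
    (cong (factor F ℕ.* factor G ℕ.*_) (sym (ℕ.^-distribˡ-+-* (suc y) m k))))))
  where
  rearrange : ∀ a x b z → (a ℕ.* x) ℕ.* (b ℕ.* z) ≡ (a ℕ.* b) ℕ.* (x ℕ.* z)
  rearrange = ℕ-solve-∀

growth-mono : ∀ {m k f} → m ℕ.≤ k → Growth m f → Growth k f
growth-mono m≤k F = growth (factor F) λ y → ℕ.≤-trans (bound F y) (ℕ.*-monoʳ-≤ (factor F) (ℕ.^-monoʳ-≤ (suc y) m≤k))

growth-cong : ∀ {m f g} → (∀ y → f y ≡ g y) → Growth m f → Growth m g
growth-cong {m} e F = growth (factor F) λ y → subst (λ z → ℤ.∣ z ∣ ℕ.≤ factor F ℕ.* suc y ℕ.^ m) (e y) (bound F y)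

growth-sum : ∀ {n m} {f : ℕ → Fin n → ℤ} → (∀ i → Growth m (λ y → f y i)) → Growth m (λ y → sumℤ (f y))
growth-sum {zero}  h = growth-mono ℕ.z≤n (growth-const 0ℤ)
growth-sum {suc n} h = growth-+ (h zero) (growth-sum (λ i → h (suc i)))

-- Every term of the expansion takes one entry from each row, so the row exponents add up.
growth-det : ∀ {n} (M : ℕ → Matrix n) (r : Fin n → ℕ) →
             (∀ i j → Growth (r i) (λ y → M y i j)) → Growth (sumℕ r) (λ y → det (M y))
growth-det {zero}  M r h = growth-const 1ℤ
growth-det {suc n} M r h = growth-cong (λ y → sym (det-row (M y))) (growth-sum (λ j →
  growth-* (growth-const (sg j)) (growth-* (h zero j)
    (growth-det (λ y → minor zero j (M y)) (r ∘ suc) (λ a b → h (suc a) (punchIn j b))))))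

growth-id : Growth 1 (λ y → pos (suc y))
growth-id = growth 1 (λ y → ℕ.≤-reflexive (expand (suc y)))
  where
  expand : ∀ x → x ≡ 1 ℕ.* (x ℕ.* 1)
  expand = ℕ-solve-∀

-- The replaced row is constant and the others grow linearly, hence an exponent one less than the
-- order.
growth-adjugate : ∀ {m} (M : Matrix (suc m)) i j → Growth m (λ y → adjugate (shifted M (pos (suc y))) i j)
growth-adjugate {m} M i j = subst (λ k → Growth k (λ y → adjugate (shifted M (pos (suc y))) i j)) total
  (growth-det (λ y → shifted M (pos (suc y)) [ j ≔ δ i ]) r entries)
  where
  r : Fin (suc m) → ℕ
  r = updateAt (λ _ → 1) j (λ _ → 0)
  total : sumℕ r ≡ m
  total = trans (sumℕ-punchIn j r) (cong₂ ℕ._+_ (updateAt-updates j (λ _ → 1))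
    (trans (sumℕ-cong (λ a → updateAt-minimal (punchIn j a) j (λ _ → 1) (Fin.punchInᵢ≢i j a))) (sumℕ-ones m)))
  entries : ∀ a b → Growth (r a) (λ y → (shifted M (pos (suc y)) [ j ≔ δ i ]) a b)
  entries a b with a ≟ j
  ... | yes refl = subst (λ k → Growth k (λ y → (shifted M (pos (suc y)) [ a ≔ δ i ]) a b))
        (sym (updateAt-updates a (λ _ → 1)))
        (growth-cong (λ y → cong (λ r → r b) (sym (≔-at (shifted M (pos (suc y))) a (δ i)))) (growth-const (δ i b)))
  ... | no a≢j = subst (λ k → Growth k (λ y → (shifted M (pos (suc y)) [ j ≔ δ i ]) a b))
        (sym (updateAt-minimal a j (λ _ → 1) a≢j))
        (growth-cong (λ y → cong (λ r → r b) (sym (≔-off (shifted M (pos (suc y))) (δ i) a≢j)))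
          (growth-+ (growth-mono ℕ.z≤n (growth-const (M a b))) (growth-* growth-id (growth-const (δ a b)))))

resolvent-tr : ∀ {n} → Matrix n → ℕ → ℤ → ℤ
resolvent-tr M k y = sumℤ (λ i → sumℤ (λ j → mpow M k i j * adjugate (shifted M y) j i))

-- Multiply (M + yI) adj(M + yI) = chi(y) I on the left by M^k and take traces.
resolvent-step : ∀ {n} (M : Matrix n) k y →
                 resolvent-tr M (suc k) y + y * resolvent-tr M k y ≡ chi M y * tr (mpow M k)
resolvent-step {n} M k y = begin
  sumℤ (λ i → sumℤ (λ j → sumℤ (λ l → P i l * M l j) * B j i)) + y * resolvent-tr M k y
    ≡⟨ cong₂ _+_ (sumℤ-cong (λ i → regroup i)) (sym (trans (sumℤ-cong (λ i → sumℤ-* y (λ l → P i l * B l i))) (sumℤ-* y (λ i → sumℤ (λ l → P i l * B l i))))) ⟩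
  sumℤ (λ i → sumℤ (λ l → P i l * sumℤ (λ j → M l j * B j i))) + sumℤ (λ i → sumℤ (λ l → y * (P i l * B l i)))
    ≡⟨ sumℤ-+ (λ i → sumℤ (λ l → P i l * sumℤ (λ j → M l j * B j i))) (λ i → sumℤ (λ l → y * (P i l * B l i))) ⟨
  sumℤ (λ i → sumℤ (λ l → P i l * sumℤ (λ j → M l j * B j i)) + sumℤ (λ l → y * (P i l * B l i)))
    ≡⟨ sumℤ-cong (λ i → trans (sym (sumℤ-+ (λ l → P i l * sumℤ (λ j → M l j * B j i)) (λ l → y * (P i l * B l i))))
         (trans (sumℤ-cong (λ l → trans (merge (P i l) (sumℤ (λ j → M l j * B j i)) y (B l i)) (trans (cong (P i l *_) (row l i)) (sym (ℤ.*-assoc (P i l) (δ l i) p)))))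
           (trans (sumℤ-*ʳ (λ l → P i l * δ l i) p) (cong (_* p) (sumℤ-δʳ i (P i)))))) ⟩
  sumℤ (λ i → P i i * p) ≡⟨ sumℤ-*ʳ (λ i → P i i) p ⟩
  tr P * p ≡⟨ ℤ.*-comm (tr P) p ⟩
  p * tr P ∎
  where
  P = mpow M k
  A = shifted M y
  B = adjugate A
  p = det A
  merge : ∀ a s y b → a * s + y * (a * b) ≡ a * (s + y * b)
  merge = solve-∀
  regroup : ∀ i → sumℤ (λ j → sumℤ (λ l → P i l * M l j) * B j i) ≡ sumℤ (λ l → P i l * sumℤ (λ j → M l j * B j i))
  regroup i = begin
    sumℤ (λ j → sumℤ (λ l → P i l * M l j) * B j i)
      ≡⟨ sumℤ-cong (λ j → trans (sym (sumℤ-*ʳ (λ l → P i l * M l j) (B j i))) (sumℤ-cong (λ l → ℤ.*-assoc (P i l) (M l j) (B j i)))) ⟩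
    sumℤ (λ j → sumℤ (λ l → P i l * (M l j * B j i))) ≡⟨ sumℤ-swap (λ j l → P i l * (M l j * B j i)) ⟩
    sumℤ (λ l → sumℤ (λ j → P i l * (M l j * B j i))) ≡⟨ sumℤ-cong (λ l → sumℤ-* (P i l) (λ j → M l j * B j i)) ⟩
    sumℤ (λ l → P i l * sumℤ (λ j → M l j * B j i)) ∎
  row : ∀ l i → sumℤ (λ j → M l j * B j i) + y * B l i ≡ δ l i * p
  row l i = begin
    sumℤ (λ j → M l j * B j i) + y * B l i ≡⟨ cong (λ z → sumℤ (λ j → M l j * B j i) + y * z) (sumℤ-δ l (λ j → B j i)) ⟨
    sumℤ (λ j → M l j * B j i) + y * sumℤ (λ j → δ l j * B j i) ≡⟨ cong (sumℤ (λ j → M l j * B j i) +_) (sumℤ-* y (λ j → δ l j * B j i)) ⟨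
    sumℤ (λ j → M l j * B j i) + sumℤ (λ j → y * (δ l j * B j i)) ≡⟨ sumℤ-+ (λ j → M l j * B j i) (λ j → y * (δ l j * B j i)) ⟨
    sumℤ (λ j → M l j * B j i + y * (δ l j * B j i)) ≡⟨ sumℤ-cong (λ j → factor-out (M l j) y (δ l j) (B j i)) ⟩
    sumℤ (λ j → A l j * B j i) ≡⟨ M·adj A l i ⟩
    δ l i * p ∎
    where
    factor-out : ∀ m y d b → m * b + y * (d * b) ≡ (m + y * d) * b
    factor-out = solve-∀

growth-resolvent : ∀ {m} (M : Matrix (suc m)) k → Growth m (λ y → resolvent-tr M k (pos (suc y)))
growth-resolvent M k = growth-sum (λ i → growth-sum (λ j →
  growth-* (growth-const (mpow M k i j)) (growth-adjugate M j i)))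

-- From y·tr(LᵏB) + tr(Lᵏ⁺¹B) = p·tr Lᵏ with B = adj(yI + L) and p = chi(y): the entries of B are
-- O(yⁿ⁻¹) while p ≥ yⁿ, so equality of tr(LᵏB) for all y forces that of tr Lᵏ and then of tr(Lᵏ⁺¹B).
module _ {m} (G H : Graph (suc m)) (e : ∀ y → chi (Lap G) y ≡ chi (Lap H) y) where

  private
    T : Graph (suc m) → ℕ → ℕ → ℤ
    T K k y = resolvent-tr (Lap K) k (pos (suc y))

    p : ℕ → ℤ
    p y = chi (Lap G) (pos (suc y))

    difference : ∀ k → (∀ y → T G k y ≡ T H k y) →
                 ∀ y → T G (suc k) y - T H (suc k) y ≡ p y * (tr (mpow (Lap G) k) - tr (mpow (Lap H) k))
    difference k same y = begin
      T G (suc k) y - T H (suc k) y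
        ≡⟨ add-sub (T G (suc k) y) (T H (suc k) y) (pos (suc y) * T H k y) ⟩
      (T G (suc k) y + pos (suc y) * T H k y) - (T H (suc k) y + pos (suc y) * T H k y)
        ≡⟨ cong (λ z → (T G (suc k) y + pos (suc y) * z) - (T H (suc k) y + pos (suc y) * T H k y)) (same y) ⟨
      (T G (suc k) y + pos (suc y) * T G k y) - (T H (suc k) y + pos (suc y) * T H k y)
        ≡⟨ cong₂ _-_ (resolvent-step (Lap G) k (pos (suc y))) (trans (resolvent-step (Lap H) k (pos (suc y)))
             (cong (_* tr (mpow (Lap H) k)) (sym (e (pos (suc y)))))) ⟩
      p y * tr (mpow (Lap G) k) - p y * tr (mpow (Lap H) k)
        ≡⟨ factor-out (p y) (tr (mpow (Lap G) k)) (tr (mpow (Lap H) k)) ⟩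
      p y * (tr (mpow (Lap G) k) - tr (mpow (Lap H) k)) ∎
      where
      add-sub : ∀ a b c → a - b ≡ (a + c) - (b + c)
      add-sub = solve-∀
      factor-out : ∀ p a b → p * a - p * b ≡ p * (a - b)
      factor-out = solve-∀

    tr-step : ∀ k → (∀ y → T G k y ≡ T H k y) → tr (mpow (Lap G) k) ≡ tr (mpow (Lap H) k)
    tr-step k same = -‿≡0 (ℤ.∣i∣≡0⇒i≡0 (Δ≡0 ℤ.∣ Δ ∣ refl))
      where
      Δ = tr (mpow (Lap G) k) - tr (mpow (Lap H) k)
      D : Growth m (λ y → T G (suc k) y + -1ℤ * T H (suc k) y)
      D = growth-+ (growth-resolvent (Lap G) (suc k)) (growth-* (growth-const -1ℤ) (growth-resolvent (Lap H) (suc k)))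
      -- A single evaluation suffices: at K + 1 the value of `chi` is at least (K + 1)^(m + 1), more
      -- than the bound K (K + 1)^m, so Δ cannot be non-zero.
      K = factor D
      v = value (weightedDet G (λ _ → suc K))
      minus : ∀ a b → a + -1ℤ * b ≡ a - b
      minus = solve-∀
      upper : v ℕ.* ℤ.∣ Δ ∣ ℕ.≤ K ℕ.* suc K ℕ.^ m
      upper = subst (ℕ._≤ K ℕ.* suc K ℕ.^ m) (begin
        ℤ.∣ T G (suc k) K + -1ℤ * T H (suc k) K ∣ ≡⟨ cong ℤ.∣_∣ (trans (minus (T G (suc k) K) (T H (suc k) K)) (difference k same K)) ⟩
        ℤ.∣ p K * Δ ∣                            ≡⟨ ℤ.abs-* (p K) Δ ⟩
        ℤ.∣ p K ∣ ℕ.* ℤ.∣ Δ ∣                    ≡⟨ cong (λ z → ℤ.∣ z ∣ ℕ.* ℤ.∣ Δ ∣) (chi-Lap-weighted G (suc K)) ⟩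
        v ℕ.* ℤ.∣ Δ ∣                            ∎) (bound D K)
      Δ≡0 : ∀ d → ℤ.∣ Δ ∣ ≡ d → ℤ.∣ Δ ∣ ≡ 0
      Δ≡0 zero    d≡ = d≡
      Δ≡0 (suc d) d≡ = ⊥-elim (ℕ.<⇒≱ (ℕ.*-monoˡ-< (suc K ℕ.^ m) {{ℕ.m^n≢0 (suc K) m}} (ℕ.n<1+n K))
        (ℕ.≤-trans (weighted-≥ G (λ _ → suc K) (suc K) (λ _ → ℕ.≤-refl))
          (ℕ.≤-trans (ℕ.m≤m*n v ℤ.∣ Δ ∣ {{subst ℕ.NonZero (sym d≡) _}}) upper)))

    T-equal : ∀ k y → T G k y ≡ T H k y
    T-equal zero    y = trans (trace-adjugate G) (trans (derivative-unique (Lap G) (Lap H) e (pos (suc y))) (sym (trace-adjugate H)))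
      where
      trace-adjugate : ∀ K → T K zero y ≡ derivative (shifted (Lap K) (pos (suc y))) δ
      trace-adjugate K = sumℤ-cong (λ i → sumℤ-δ i (λ j → adjugate (shifted (Lap K) (pos (suc y))) j i))
    T-equal (suc k) y = -‿≡0 (trans (difference k (T-equal k) y)
      (trans (cong (λ z → p y * z) (trans (cong (_- tr (mpow (Lap H) k)) (tr-step k (T-equal k))) (ℤ.+-inverseʳ (tr (mpow (Lap H) k)))))
        (ℤ.*-zeroʳ (p y))))

  tr-mpow-unique : ∀ k → tr (mpow (Lap G) k) ≡ tr (mpow (Lap H) k)
  tr-mpow-unique k = tr-step k (T-equal k)

-- Isomorphisms and components

-- Isomorphisms between arbitrary vertex types: the laws of disjoint unions become those of sum
-- types, without arithmetic on indices.
record Iso {V W : Set} (R : V → V → Bool) (S : W → W → Bool) : Set where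
  constructor iso
  field
    bijection : V ↔ W
    preserves : ∀ x y → S (to bijection x) (to bijection y) ≡ R x y
open Iso

Iso-refl : ∀ {V} {R : V → V → Bool} → Iso R R
Iso-refl = iso ↔-refl (λ _ _ → refl)

Iso-sym : ∀ {V W} {R : V → V → Bool} {S : W → W → Bool} → Iso R S → Iso S R
Iso-sym {R = R} {S} (iso f p) = iso (↔-sym f) (λ x y →
  trans (sym (p (from f x) (from f y))) (cong₂ S (strictlyInverseˡ f x) (strictlyInverseˡ f y)))

Iso-trans : ∀ {U V W} {Q : U → U → Bool} {R : V → V → Bool} {S : W → W → Bool} → Iso Q R → Iso R S → Iso Q S
Iso-trans (iso f p) (iso g q) = iso (↔-trans f g) (λ x y → trans (q (to f x) (to f y)) (p x y))

_⊎ᴿ_ : ∀ {V W : Set} → (V → V → Bool) → (W → W → Bool) → V ⊎ W → V ⊎ W → Bool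
(R ⊎ᴿ S) (inj₁ x) (inj₁ y) = R x y
(R ⊎ᴿ S) (inj₂ x) (inj₂ y) = S x y
(R ⊎ᴿ S) (inj₁ x) (inj₂ y) = false
(R ⊎ᴿ S) (inj₂ x) (inj₁ y) = false

⊎ᴿ-cong : ∀ {V V′ W W′} {R : V → V → Bool} {R′ : V′ → V′ → Bool} {S : W → W → Bool} {S′ : W′ → W′ → Bool} →
          Iso R R′ → Iso S S′ → Iso (R ⊎ᴿ S) (R′ ⊎ᴿ S′)
⊎ᴿ-cong (iso f p) (iso g q) = iso (f ⊎-↔ g) λ
  { (inj₁ x) (inj₁ y) → p x y
  ; (inj₂ x) (inj₂ y) → q x y
  ; (inj₁ x) (inj₂ y) → refl
  ; (inj₂ x) (inj₁ y) → refl }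

⊎ᴿ-comm : ∀ {V W} (R : V → V → Bool) (S : W → W → Bool) → Iso (R ⊎ᴿ S) (S ⊎ᴿ R)
⊎ᴿ-comm R S = iso (⊎-comm _ _) λ
  { (inj₁ x) (inj₁ y) → refl
  ; (inj₂ x) (inj₂ y) → refl
  ; (inj₁ x) (inj₂ y) → refl
  ; (inj₂ x) (inj₁ y) → refl }

⊎ᴿ-assoc : ∀ {U V W} (Q : U → U → Bool) (R : V → V → Bool) (S : W → W → Bool) →
           Iso ((Q ⊎ᴿ R) ⊎ᴿ S) (Q ⊎ᴿ (R ⊎ᴿ S))
⊎ᴿ-assoc Q R S = iso (⊎-assoc 0ℓ _ _ _) λ
  { (inj₁ (inj₁ x)) (inj₁ (inj₁ y)) → refl
  ; (inj₁ (inj₁ x)) (inj₁ (inj₂ y)) → refl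
  ; (inj₁ (inj₁ x)) (inj₂ y) → refl
  ; (inj₁ (inj₂ x)) (inj₁ (inj₁ y)) → refl
  ; (inj₁ (inj₂ x)) (inj₁ (inj₂ y)) → refl
  ; (inj₁ (inj₂ x)) (inj₂ y) → refl
  ; (inj₂ x) (inj₁ (inj₁ y)) → refl
  ; (inj₂ x) (inj₁ (inj₂ y)) → refl
  ; (inj₂ x) (inj₂ y) → refl }

⊔-⊎ᴿ : ∀ {n m} (G : Graph n) (H : Graph m) → Iso (adj (G ⊔ H)) (adj G ⊎ᴿ adj H)
⊔-⊎ᴿ {n} G H = iso (Fin.+↔⊎) (λ i j → same (splitAt n i) (splitAt n j))
  where
  same : ∀ x y → (adj G ⊎ᴿ adj H) x y ≡ sumAdj G H x y
  same (inj₁ x) (inj₁ y) = refl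
  same (inj₂ x) (inj₂ y) = refl
  same (inj₁ x) (inj₂ y) = refl
  same (inj₂ x) (inj₁ y) = refl

to-Iso : ∀ {n m} {G : Graph n} {H : Graph m} → G ≅ H → Iso (adj G) (adj H)
to-Iso p = iso (_≅_.bij p) (_≅_.pres p)

from-Iso : ∀ {n m} {G : Graph n} {H : Graph m} → Iso (adj G) (adj H) → G ≅ H
from-Iso (iso f p) = record { bij = f ; pres = p }

≅-refl : ∀ {n} {G : Graph n} → G ≅ G
≅-refl = from-Iso Iso-refl

≅-sym : ∀ {n m} {G : Graph n} {H : Graph m} → G ≅ H → H ≅ G
≅-sym p = from-Iso (Iso-sym (to-Iso p))

≅-trans : ∀ {n m k} {G : Graph n} {H : Graph m} {K : Graph k} → G ≅ H → H ≅ K → G ≅ K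
≅-trans p q = from-Iso (Iso-trans (to-Iso p) (to-Iso q))

⊔-cong : ∀ {n n′ m m′} {G : Graph n} {G′ : Graph n′} {H : Graph m} {H′ : Graph m′} →
         G ≅ G′ → H ≅ H′ → (G ⊔ H) ≅ (G′ ⊔ H′)
⊔-cong {G = G} {G′} {H} {H′} p q = from-Iso (Iso-trans (⊔-⊎ᴿ G H)
  (Iso-trans (⊎ᴿ-cong (to-Iso p) (to-Iso q)) (Iso-sym (⊔-⊎ᴿ G′ H′))))

⊔-congʳ : ∀ {n m m′} (G : Graph n) {H : Graph m} {H′ : Graph m′} → H ≅ H′ → (G ⊔ H) ≅ (G ⊔ H′)
⊔-congʳ G p = ⊔-cong {G = G} {G} ≅-refl p

⊔-congˡ : ∀ {n n′ m} (H : Graph m) {G : Graph n} {G′ : Graph n′} → G ≅ G′ → (G ⊔ H) ≅ (G′ ⊔ H)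
⊔-congˡ H p = ⊔-cong {H = H} {H} p ≅-refl

⊔-comm : ∀ {n m} (G : Graph n) (H : Graph m) → (G ⊔ H) ≅ (H ⊔ G)
⊔-comm G H = from-Iso (Iso-trans (⊔-⊎ᴿ G H) (Iso-trans (⊎ᴿ-comm (adj G) (adj H)) (Iso-sym (⊔-⊎ᴿ H G))))

⊔-assoc : ∀ {n m k} (G : Graph n) (H : Graph m) (K : Graph k) → ((G ⊔ H) ⊔ K) ≅ (G ⊔ (H ⊔ K))
⊔-assoc G H K = from-Iso (Iso-trans (⊔-⊎ᴿ (G ⊔ H) K) (Iso-trans (⊎ᴿ-cong (⊔-⊎ᴿ G H) Iso-refl)
  (Iso-trans (⊎ᴿ-assoc (adj G) (adj H) (adj K))
    (Iso-trans (⊎ᴿ-cong Iso-refl (Iso-sym (⊔-⊎ᴿ H K))) (Iso-sym (⊔-⊎ᴿ G (H ⊔ K)))))))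

⊔-identityˡ : ∀ {n} (G : Graph n) → (emptyGraph ⊔ G) ≅ G
⊔-identityˡ G = record { bij = ↔-refl ; pres = λ _ _ → refl }

⊔-identityʳ : ∀ {n} (G : Graph n) → (G ⊔ emptyGraph) ≅ G
⊔-identityʳ G = ≅-trans (⊔-comm G emptyGraph) (⊔-identityˡ G)

⊔-swap-heads : ∀ {n m k} (G : Graph n) (H : Graph m) (K : Graph k) → (G ⊔ (H ⊔ K)) ≅ (H ⊔ (G ⊔ K))
⊔-swap-heads G H K = ≅-trans (≅-sym (⊔-assoc G H K)) (≅-trans (⊔-congˡ K (⊔-comm G H)) (⊔-assoc H G K))

-- Components are stored with their size minus one, so that they are never empty.
Component : Set
Component = Σ ℕ (λ n → Graph (suc n))

total : List Component → ℕ
total []             = 0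
total ((n , _) ∷ Cs) = suc n ℕ.+ total Cs

union : (Cs : List Component) → Graph (total Cs)
union []             = emptyGraph
union ((_ , C) ∷ Cs) = C ⊔ union Cs

union-++ : ∀ Cs Ds → union (Cs ++ Ds) ≅ (union Cs ⊔ union Ds)
union-++ []             Ds = ≅-sym (⊔-identityˡ (union Ds))
union-++ ((n , C) ∷ Cs) Ds = ≅-trans (⊔-congʳ C (union-++ Cs Ds)) (≅-sym (⊔-assoc C (union Cs) (union Ds)))

union-↭ : ∀ {Cs Ds} → Cs ↭ Ds → union Cs ≅ union Ds
union-↭ ↭.refl         = ≅-refl
union-↭ (↭.prep (_ , C) p) = ⊔-congʳ C (union-↭ p)
union-↭ (↭.swap {Cs} (_ , C) (_ , D) p) = ≅-trans (⊔-swap-heads C D (union Cs)) (⊔-congʳ D (⊔-congʳ C (union-↭ p)))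
union-↭ (↭.trans p q)  = ≅-trans (union-↭ p) (union-↭ q)

size-≡ : ∀ {n m} {G : Graph n} {H : Graph m} → G ≅ H → n ≡ m
size-≡ p = Perm.↔⇒≡ (_≅_.bij p)

record Split {n} (S : Fin n → Bool) : Set where
  field
    left right : ℕ
    parts      : Fin n ↔ (Fin left ⊎ Fin right)
    on-left    : ∀ x → S (from parts (inj₁ x)) ≡ true
    on-right   : ∀ y → S (from parts (inj₂ y)) ≡ false
open Split

split : ∀ {n} (S : Fin n → Bool) → Split S
split {zero}  S = record { left = 0 ; right = 0 ; parts = Fin.+↔⊎ ; on-left = λ () ; on-right = λ () }
split {suc n} S with S zero in S₀ | split (S ∘ suc)
... | true | sp = record
  { left = suc (left sp) ; right = right sp
  ; parts = mk↔ₛ′ f g fg gf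
  ; on-left = λ { zero → S₀ ; (suc x) → on-left sp x } ; on-right = on-right sp }
  where
  lift : Fin (left sp) ⊎ Fin (right sp) → Fin (suc (left sp)) ⊎ Fin (right sp)
  lift (inj₁ x) = inj₁ (suc x)
  lift (inj₂ y) = inj₂ y
  f : Fin (suc n) → Fin (suc (left sp)) ⊎ Fin (right sp)
  f zero    = inj₁ zero
  f (suc i) = lift (to (parts sp) i)
  g : Fin (suc (left sp)) ⊎ Fin (right sp) → Fin (suc n)
  g (inj₁ zero)    = zero
  g (inj₁ (suc x)) = suc (from (parts sp) (inj₁ x))
  g (inj₂ y)       = suc (from (parts sp) (inj₂ y))
  fg : ∀ z → f (g z) ≡ z
  fg (inj₁ zero)    = refl
  fg (inj₁ (suc x)) = cong lift (strictlyInverseˡ (parts sp) (inj₁ x))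
  fg (inj₂ y)       = cong lift (strictlyInverseˡ (parts sp) (inj₂ y))
  g-lift : ∀ z → g (lift z) ≡ suc (from (parts sp) z)
  g-lift (inj₁ x) = refl
  g-lift (inj₂ y) = refl
  gf : ∀ i → g (f i) ≡ i
  gf zero    = refl
  gf (suc i) = trans (g-lift (to (parts sp) i)) (cong suc (strictlyInverseʳ (parts sp) i))
... | false | sp = record
  { left = left sp ; right = suc (right sp)
  ; parts = mk↔ₛ′ f g fg gf
  ; on-left = on-left sp ; on-right = λ { zero → S₀ ; (suc y) → on-right sp y } }
  where
  lift : Fin (left sp) ⊎ Fin (right sp) → Fin (left sp) ⊎ Fin (suc (right sp))
  lift (inj₁ x) = inj₁ x
  lift (inj₂ y) = inj₂ (suc y)
  f : Fin (suc n) → Fin (left sp) ⊎ Fin (suc (right sp))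
  f zero    = inj₂ zero
  f (suc i) = lift (to (parts sp) i)
  g : Fin (left sp) ⊎ Fin (suc (right sp)) → Fin (suc n)
  g (inj₂ zero)    = zero
  g (inj₂ (suc y)) = suc (from (parts sp) (inj₂ y))
  g (inj₁ x)       = suc (from (parts sp) (inj₁ x))
  fg : ∀ z → f (g z) ≡ z
  fg (inj₂ zero)    = refl
  fg (inj₂ (suc y)) = cong lift (strictlyInverseˡ (parts sp) (inj₂ y))
  fg (inj₁ x)       = cong lift (strictlyInverseˡ (parts sp) (inj₁ x))
  g-lift : ∀ z → g (lift z) ≡ suc (from (parts sp) z)
  g-lift (inj₁ x) = refl
  g-lift (inj₂ y) = refl
  gf : ∀ i → g (f i) ≡ i
  gf zero    = refl
  gf (suc i) = trans (g-lift (to (parts sp) i)) (cong suc (strictlyInverseʳ (parts sp) i))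

pullback : ∀ {n m} → Graph n → (Fin m → Fin n) → Graph m
pullback G f = record
  { adj    = λ x y → adj G (f x) (f y)
  ; sym    = λ x y → adj-sym G (f x) (f y)
  ; irrefl = λ x → adj-irrefl G (f x) }

module _ {n} (G : Graph n) (S : Fin n → Bool) (closed : Closed G S) where

  private
    sp = split S
    π = parts sp

  left-part : Graph (left sp)
  left-part = pullback G (from π ∘ inj₁)

  right-part : Graph (right sp)
  right-part = pullback G (from π ∘ inj₂)

  split-≅ : G ≅ (left-part ⊔ right-part)
  split-≅ = from-Iso (Iso-trans (iso π preserved) (Iso-sym (⊔-⊎ᴿ left-part right-part)))
    where
    across : ∀ i j → S i ≡ true → S j ≡ false → adj G i j ≡ false
    across i j p q with adj G i j in e
    ... | false = refl
    ... | true with trans (sym p) (trans (closed i j e) q)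
    ...   | ()
    pulled : ∀ x y → (adj left-part ⊎ᴿ adj right-part) x y ≡ adj G (from π x) (from π y)
    pulled (inj₁ x) (inj₁ y) = refl
    pulled (inj₂ x) (inj₂ y) = refl
    pulled (inj₁ x) (inj₂ y) = sym (across _ _ (on-left sp x) (on-right sp y))
    pulled (inj₂ x) (inj₁ y) = sym (trans (adj-sym G _ _) (across _ _ (on-left sp y) (on-right sp x)))
    preserved : ∀ i j → (adj left-part ⊎ᴿ adj right-part) (to π i) (to π j) ≡ adj G i j
    preserved i j = trans (pulled (to π i) (to π j)) (cong₂ (adj G) (strictlyInverseʳ π i) (strictlyInverseʳ π j))

  left-inhabited : ∀ i → S i ≡ true → Fin (left sp)
  left-inhabited i p with to π i in e
  ... | inj₁ x = x
  ... | inj₂ y with trans (sym p) (trans (cong S (trans (sym (strictlyInverseʳ π i)) (cong (from π) e))) (on-right sp y))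
  ...   | ()

  right-inhabited : ∀ i → S i ≡ false → Fin (right sp)
  right-inhabited i p with to π i in e
  ... | inj₂ y = y
  ... | inj₁ x with trans (sym p) (trans (cong S (trans (sym (strictlyInverseʳ π i)) (cong (from π) e))) (on-left sp x))
  ...   | ()

Cut : ∀ {n} → Graph n → (Fin n → Bool) → Set
Cut G S = Closed G S × ∃ λ i → ∃ λ j → S i ≡ true × S j ≡ false

closed? : ∀ {n} (G : Graph n) S → Dec (Closed G S)
closed? G S = Fin.all? (λ i → Fin.all? (λ j → (adj G i j Bool.≟ true) →-dec (S i Bool.≟ S j)))

cut? : ∀ {n} (G : Graph n) S → Dec (Cut G S)
cut? G S = closed? G S ×-dec Fin.any? (λ i → Fin.any? (λ j → (S i Bool.≟ true) ×-dec (S j Bool.≟ false)))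

-- All vertex subsets are searched. The search runs over vectors, so a given S is tabulated before
-- it is compared with the outcome.
conn-or-cut : ∀ {n} (G : Graph n) → Conn G ⊎ ∃ (Cut G)
conn-or-cut {n} G with anySubset? {n} (λ p → cut? G (lookup p))
... | yes (p , cut) = inj₂ (lookup p , cut)
... | no ¬cut       = inj₁ conn
  where
  conn : Conn G
  conn S closed i j with S i in eᵢ | S j in eⱼ
  ... | true  | true  = refl
  ... | false | false = refl
  ... | true  | false = ⊥-elim (¬cut (tabulate S , closed′ , i , j , trans (lookup∘tabulate S i) eᵢ , trans (lookup∘tabulate S j) eⱼ))
    where
    closed′ : Closed G (lookup (tabulate S))
    closed′ a b e = trans (lookup∘tabulate S a) (trans (closed a b e) (sym (lookup∘tabulate S b)))
  ... | false | true  = ⊥-elim (¬cut (tabulate S , closed′ , j , i , trans (lookup∘tabulate S j) eⱼ , trans (lookup∘tabulate S i) eᵢ))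
    where
    closed′ : Closed G (lookup (tabulate S))
    closed′ a b e = trans (lookup∘tabulate S a) (trans (closed a b e) (sym (lookup∘tabulate S b)))

Connected : Component → Set
Connected (_ , C) = Conn C

Fin⇒pos : ∀ {n} → Fin n → 1 ℕ.≤ n
Fin⇒pos zero    = ℕ.s≤s ℕ.z≤n
Fin⇒pos (suc i) = ℕ.s≤s ℕ.z≤n

-- Cutting along a non-trivial closed set makes both parts smaller, because each contains one of the
-- two witnesses of the cut.
components : ∀ {n} (G : Graph n) → ∃ λ Cs → All Connected Cs × G ≅ union Cs
components {n} G = go n (<-wellFounded n) G
  where
  go : ∀ n → Acc ℕ._<_ n → (G : Graph n) → ∃ λ Cs → All Connected Cs × G ≅ union Cs
  go zero    _ G = [] , [] , record { bij = ↔-refl ; pres = λ () }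
  go (suc n) (acc rec) G with conn-or-cut G
  ... | inj₁ conn = (n , G) ∷ [] , conn ∷ [] , ≅-sym (⊔-identityʳ G)
  ... | inj₂ (S , closed , i , j , Sᵢ , Sⱼ)
    with go _ (rec left<) (left-part G S closed) | go _ (rec right<) (right-part G S closed)
    where
    sizes : suc n ≡ left (split S) ℕ.+ right (split S)
    sizes = size-≡ (split-≅ G S closed)
    left< : left (split S) ℕ.< suc n
    left< = subst (left (split S) ℕ.<_) (sym sizes) (ℕ.m<m+n (left (split S)) (Fin⇒pos (right-inhabited G S closed j Sⱼ)))
    right< : right (split S) ℕ.< suc n
    right< = subst (right (split S) ℕ.<_) (sym sizes) (ℕ.m<n+m (right (split S)) (Fin⇒pos (left-inhabited G S closed i Sᵢ)))
  ...   | Cs , conn-Cs , iso-Cs | Ds , conn-Ds , iso-Ds =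
    Cs ++ Ds , All.++⁺ conn-Cs conn-Ds ,
    ≅-trans (split-≅ G S closed) (≅-trans (⊔-cong iso-Cs iso-Ds) (≅-sym (union-++ Cs Ds)))

-- Isomorphism invariance, and matrices of disjoint unions

sumℕ-Sum : ∀ {n} (f : Fin n → ℕ) → sumℕ f ≡ ℕSum.sum f
sumℕ-Sum {zero}  f = refl
sumℕ-Sum {suc n} f = cong (f zero ℕ.+_) (sumℕ-Sum (f ∘ suc))

sumℕ-permute : ∀ {n m} (π : Fin n ↔ Fin m) (f : Fin m → ℕ) → sumℕ (f ∘ to π) ≡ sumℕ f
sumℕ-permute π f = trans (sumℕ-Sum (f ∘ to π)) (trans (sym (ℕSum.sum-permute f π)) (sym (sumℕ-Sum f)))

degree-≅ : ∀ {n m} {G : Graph n} {H : Graph m} (p : G ≅ H) i → degree H (to (_≅_.bij p) i) ≡ degree G i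
degree-≅ {G = G} {H} p i =
  trans (sym (sumℕ-permute (_≅_.bij p) (λ j → b2ℕ (adj H (to (_≅_.bij p) i) j)))) (sumℕ-cong (λ j → cong b2ℕ (_≅_.pres p i j)))

δ-injective : ∀ {n m} (f : Fin n → Fin m) → (∀ {i j} → f i ≡ f j → i ≡ j) → ∀ i j → δ (f i) (f j) ≡ δ i j
δ-injective f inj i j with i ≟ j
... | yes refl = δ-refl (f i)
... | no i≢j   = δ-off (i≢j ∘ inj)

chi-permute : ∀ {n m} (π : Fin n ↔ Fin m) (M : Matrix n) (N : Matrix m) →
              (∀ i j → N (to π i) (to π j) ≡ M i j) → ∀ y → chi M y ≡ chi N y
chi-permute {n} {m} π M N e y with Perm.↔⇒≡ π
... | refl = trans (det-cong (λ i j → cong₂ (λ a d → a + y * d) (sym (e i j)) (sym (δ-injective (to π) injective i j))))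
                   (det-perm π (shifted N y))
  where
  injective : ∀ {i j} → to π i ≡ to π j → i ≡ j
  injective {i} {j} p = trans (sym (strictlyInverseʳ π i)) (trans (cong (from π) p) (strictlyInverseʳ π j))

-- D + sA: the Laplacian for s = −1 and the signless Laplacian for s = 1.
SLap : ℤ → ∀ {n} → Graph n → Matrix n
SLap s G i j = δ i j * pos (degree G i) + s * adjMatrix G i j

Lap-SLap : ∀ {n} (G : Graph n) i j → SLap -1ℤ G i j ≡ Lap G i j
Lap-SLap G i j = minus (δ i j * pos (degree G i)) (adjMatrix G i j)
  where
  minus : ∀ a b → a + -1ℤ * b ≡ a - b
  minus = solve-∀

signless-SLap : ∀ {n} (G : Graph n) i j → signlessLaplacian G i j ≡ SLap 1ℤ G i j
signless-SLap G i j = cong₂ _+_ (trans (if-δ i j (pos (degree G i))) (ℤ.*-comm (pos (degree G i)) (δ i j)))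
                               (sym (ℤ.*-identityˡ (adjMatrix G i j)))

chi-SLap-≅ : ∀ s {n m} {G : Graph n} {H : Graph m} → G ≅ H → ∀ y → chi (SLap s G) y ≡ chi (SLap s H) y
chi-SLap-≅ s {G = G} {H} p = chi-permute (_≅_.bij p) (SLap s G) (SLap s H) entries
  where
  π = _≅_.bij p
  injective : ∀ {i j} → to π i ≡ to π j → i ≡ j
  injective {i} {j} e = trans (sym (strictlyInverseʳ π i)) (trans (cong (from π) e) (strictlyInverseʳ π j))
  entries : ∀ i j → SLap s H (to π i) (to π j) ≡ SLap s G i j
  entries i j = cong₂ (λ a b → a + s * b)
    (cong₂ (λ d k → d * pos k) (δ-injective (to π) injective i j) (degree-≅ p i))
    (cong (λ x → if x then 1ℤ else 0ℤ) (_≅_.pres p i j))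

sumℕ-++ : ∀ m {n} (f : Fin (m ℕ.+ n) → ℕ) → sumℕ f ≡ sumℕ (λ i → f (i ↑ˡ n)) ℕ.+ sumℕ (λ j → f (m ↑ʳ j))
sumℕ-++ zero        f = refl
sumℕ-++ (suc m) {n} f = trans (cong (f zero ℕ.+_) (sumℕ-++ m (f ∘ suc)))
                              (sym (ℕ.+-assoc (f zero) (sumℕ (λ i → f (suc i ↑ˡ n))) (sumℕ (λ j → f (suc m ↑ʳ j)))))

module _ {n m} (G : Graph n) (H : Graph m) where

  adj-ˡˡ : ∀ i j → adj (G ⊔ H) (i ↑ˡ m) (j ↑ˡ m) ≡ adj G i j
  adj-ˡˡ i j = cong₂ (sumAdj G H) (Fin.splitAt-↑ˡ n i m) (Fin.splitAt-↑ˡ n j m)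

  adj-ˡʳ : ∀ i j → adj (G ⊔ H) (i ↑ˡ m) (n ↑ʳ j) ≡ false
  adj-ˡʳ i j = cong₂ (sumAdj G H) (Fin.splitAt-↑ˡ n i m) (Fin.splitAt-↑ʳ n m j)

  adj-ʳˡ : ∀ i j → adj (G ⊔ H) (n ↑ʳ i) (j ↑ˡ m) ≡ false
  adj-ʳˡ i j = cong₂ (sumAdj G H) (Fin.splitAt-↑ʳ n m i) (Fin.splitAt-↑ˡ n j m)

  adj-ʳʳ : ∀ i j → adj (G ⊔ H) (n ↑ʳ i) (n ↑ʳ j) ≡ adj H i j
  adj-ʳʳ i j = cong₂ (sumAdj G H) (Fin.splitAt-↑ʳ n m i) (Fin.splitAt-↑ʳ n m j)

  degree-ˡ : ∀ i → degree (G ⊔ H) (i ↑ˡ m) ≡ degree G i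
  degree-ˡ i = trans (sumℕ-++ n (λ k → b2ℕ (adj (G ⊔ H) (i ↑ˡ m) k)))
    (trans (cong₂ ℕ._+_ (sumℕ-cong (λ j → cong b2ℕ (adj-ˡˡ i j))) (sumℕ-zero (λ j → cong b2ℕ (adj-ˡʳ i j)))) (ℕ.+-identityʳ (degree G i)))

  degree-ʳ : ∀ i → degree (G ⊔ H) (n ↑ʳ i) ≡ degree H i
  degree-ʳ i = trans (sumℕ-++ n (λ k → b2ℕ (adj (G ⊔ H) (n ↑ʳ i) k)))
    (cong₂ ℕ._+_ (sumℕ-zero (λ j → cong b2ℕ (adj-ʳˡ i j))) (sumℕ-cong (λ j → cong b2ℕ (adj-ʳʳ i j))))

  δ-ˡʳ : ∀ (i : Fin n) (j : Fin m) → δ (i ↑ˡ m) (n ↑ʳ j) ≡ 0ℤ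
  δ-ˡʳ i j = δ-off λ e → case trans (sym (Fin.splitAt-↑ˡ n i m)) (trans (cong (splitAt n) e) (Fin.splitAt-↑ʳ n m j)) of λ ()

  chi-SLap-⊔ : ∀ s y → chi (SLap s (G ⊔ H)) y ≡ chi (SLap s G) y * chi (SLap s H) y
  chi-SLap-⊔ s y = det-block (shifted (SLap s (G ⊔ H)) y) (shifted (SLap s G) y) (shifted (SLap s H) y) ll lr rr
    where
    entry : ℤ → ℕ → Bool → ℤ
    entry d k b = (d * pos k + s * (if b then 1ℤ else 0ℤ)) + y * d
    vanish : ∀ k s y → (0ℤ * k + s * 0ℤ) + y * 0ℤ ≡ 0ℤ
    vanish = solve-∀
    ll : ∀ i j → entry (δ (i ↑ˡ m) (j ↑ˡ m)) (degree (G ⊔ H) (i ↑ˡ m)) (adj (G ⊔ H) (i ↑ˡ m) (j ↑ˡ m)) ≡ entry (δ i j) (degree G i) (adj G i j)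
    ll i j = trans (cong₂ (λ d k → entry d k (adj (G ⊔ H) (i ↑ˡ m) (j ↑ˡ m))) (δ-injective (_↑ˡ m) (λ {a} {b} → Fin.↑ˡ-injective m a b) i j) (degree-ˡ i))
                   (cong (entry (δ i j) (degree G i)) (adj-ˡˡ i j))
    lr : ∀ i j → entry (δ (i ↑ˡ m) (n ↑ʳ j)) (degree (G ⊔ H) (i ↑ˡ m)) (adj (G ⊔ H) (i ↑ˡ m) (n ↑ʳ j)) ≡ 0ℤ
    lr i j = trans (cong₂ (λ d b → entry d (degree (G ⊔ H) (i ↑ˡ m)) b) (δ-ˡʳ i j) (adj-ˡʳ i j))
                   (vanish (pos (degree (G ⊔ H) (i ↑ˡ m))) s y)
    rr : ∀ i j → entry (δ (n ↑ʳ i) (n ↑ʳ j)) (degree (G ⊔ H) (n ↑ʳ i)) (adj (G ⊔ H) (n ↑ʳ i) (n ↑ʳ j)) ≡ entry (δ i j) (degree H i) (adj H i j)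
    rr i j = trans (cong₂ (λ d k → entry d k (adj (G ⊔ H) (n ↑ʳ i) (n ↑ʳ j))) (δ-injective (n ↑ʳ_) (λ {a} {b} → Fin.↑ʳ-injective n a b) i j) (degree-ʳ i))
                   (cong (entry (δ i j) (degree H i)) (adj-ʳʳ i j))

  sum-degree-⊔ : ∀ (f : ℕ → ℕ) → sumℕ (λ i → f (degree (G ⊔ H) i)) ≡ sumℕ (λ i → f (degree G i)) ℕ.+ sumℕ (λ i → f (degree H i))
  sum-degree-⊔ f = trans (sumℕ-++ n (λ i → f (degree (G ⊔ H) i)))
    (cong₂ ℕ._+_ (sumℕ-cong (λ i → cong f (degree-ˡ i))) (sumℕ-cong (λ i → cong f (degree-ʳ i))))

-- Forests and the root −2

sumℕ-swap : ∀ {m n} (f : Fin m → Fin n → ℕ) → sumℕ (λ i → sumℕ (λ j → f i j)) ≡ sumℕ (λ j → sumℕ (λ i → f i j))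
sumℕ-swap {zero}  {n} f = sym (sumℕ-zero {n} (λ _ → refl))
sumℕ-swap {suc m} {n} f = trans (cong (sumℕ (f zero) ℕ.+_) (sumℕ-swap (λ i → f (suc i))))
                                (sym (sumℕ-+ (f zero) (λ j → sumℕ (λ i → f (suc i) j))))

handshake : ∀ {n} (G : Graph n) → sumDeg G ≡ 2 ℕ.* edgeCount G
handshake {n} G = begin
  sumℕ (λ i → sumℕ (λ j → b2ℕ (adj G i j)))              ≡⟨ sumℕ-cong (λ i → sumℕ-cong (λ j → orient i j)) ⟩
  sumℕ (λ i → sumℕ (λ j → up i j ℕ.+ up j i))            ≡⟨ sumℕ-cong (λ i → sumℕ-+ (up i) (λ j → up j i)) ⟩
  sumℕ (λ i → sumℕ (up i) ℕ.+ sumℕ (λ j → up j i))       ≡⟨ sumℕ-+ (λ i → sumℕ (up i)) (λ i → sumℕ (λ j → up j i)) ⟩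
  edgeCount G ℕ.+ sumℕ (λ i → sumℕ (λ j → up j i))       ≡⟨ cong (edgeCount G ℕ.+_) (sumℕ-swap (λ i j → up j i)) ⟩
  edgeCount G ℕ.+ edgeCount G                            ≡⟨ cong (edgeCount G ℕ.+_) (sym (ℕ.+-identityʳ (edgeCount G))) ⟩
  2 ℕ.* edgeCount G                                      ∎
  where
  up : Fin n → Fin n → ℕ
  up i j = b2ℕ (does (i <? j) ∧ adj G i j)
  up-yes : ∀ {i j} → i Fin.< j → up i j ≡ b2ℕ (adj G i j)
  up-yes {i} {j} p = cong (λ x → b2ℕ (x ∧ adj G i j)) (dec-true (i <? j) p)
  up-no : ∀ {i j} → ¬ (i Fin.< j) → up i j ≡ 0
  up-no {i} {j} p = cong (λ x → b2ℕ (x ∧ adj G i j)) (dec-false (i <? j) p)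
  orient : ∀ i j → b2ℕ (adj G i j) ≡ up i j ℕ.+ up j i
  orient i j with Fin.<-cmp i j
  ... | tri< p _ q = sym (trans (cong₂ ℕ._+_ (up-yes p) (up-no q)) (ℕ.+-identityʳ (b2ℕ (adj G i j))))
  ... | tri> p _ q = sym (trans (cong₂ ℕ._+_ (up-no p) (up-yes q)) (cong b2ℕ (adj-sym G j i)))
  ... | tri≈ p refl _ = trans (cong b2ℕ (adj-irrefl G i)) (sym (cong₂ ℕ._+_ (up-no {i} {i} p) (up-no {i} {i} p)))

Reach⇒≡ : ∀ {n} {G : Graph n} {S : Fin n → Bool} → Closed G S → ∀ {i j} → Reach G i j → S i ≡ S j
Reach⇒≡ closed here       = refl
Reach⇒≡ closed (step e r) = trans (closed _ _ e) (Reach⇒≡ closed r)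

-- The edge count alone, n edges on n + 1 vertices; a tree is a component that is `Connected` and
-- `Tree`.
Tree : Component → Set
Tree (n , C) = sumDeg C ≡ 2 ℕ.* n

size : Component → ℕ
size (n , _) = suc n

isTree-Conn : ∀ {n} {G : Graph n} → IsTree G → Conn G
isTree-Conn t S closed i j = Reach⇒≡ closed (IsTree.connected t i j)

isTree-Tree : ∀ {n} {G : Graph (suc n)} → IsTree G → Tree (n , G)
isTree-Tree {G = G} t = trans (handshake G) (cong (2 ℕ.*_) (IsTree.edges t))

-- The Laplacian characteristic polynomial of a graph, up to sign and the substitution x ↦ −x.
-- Opaque, since comparing unfolded determinants is infeasible.
opaque
  chiL : ∀ {n} → Graph n → ℤ → ℤ
  chiL G = chi (SLap -1ℤ G)

  chiL-def : ∀ {n} (G : Graph n) y → chiL G y ≡ chi (SLap -1ℤ G) y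
  chiL-def G y = refl

chiL-Lap : ∀ {n} (G : Graph n) y → chiL G y ≡ chi (Lap G) y
chiL-Lap G y = trans (chiL-def G y) (chi-cong (Lap-SLap G) y)

chiL-≅ : ∀ {n m} {G : Graph n} {H : Graph m} → G ≅ H → ∀ y → chiL G y ≡ chiL H y
chiL-≅ {G = G} {H} p y = trans (chiL-def G y) (trans (chi-SLap-≅ -1ℤ p y) (sym (chiL-def H y)))

chiL-⊔ : ∀ {n m} (G : Graph n) (H : Graph m) y → chiL (G ⊔ H) y ≡ chiL G y * chiL H y
chiL-⊔ G H y = trans (chiL-def (G ⊔ H) y) (trans (chi-SLap-⊔ G H -1ℤ y) (sym (cong₂ _*_ (chiL-def G y) (chiL-def H y))))

chiL-Lead₀ : ∀ {n} (G : Graph n) a → Lead (λ h → chiL G (a + h)) 0 (chiL G a)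
chiL-Lead₀ G a = Lead-cong (λ h → sym (chiL-def G (a + h)))
  (subst (Lead (λ h → chi (SLap -1ℤ G) (a + h)) 0) (sym (chiL-def G a)) (chi-Lead₀ (SLap -1ℤ G) a))

chiL-Lead : ∀ {n} (G : Graph (suc n)) → Lead (chiL G) 1 (pos (treeSum G))
chiL-Lead G = Lead-cong (λ y → sym (chiL-Lap G y)) (Lap-Lead G)

treeSums : List Component → ℕ
treeSums []             = 1
treeSums ((_ , C) ∷ Cs) = treeSum C ℕ.* treeSums Cs

sizes : List Component → ℕ
sizes []       = 1
sizes (C ∷ Cs) = size C ℕ.* sizes Cs

union-Lead : ∀ Cs → Lead (chiL (union Cs)) (length Cs) (pos (treeSums Cs))
union-Lead []             = lead λ h → 0ℤ , trans (chiL-def emptyGraph h) (unit h)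
  where
  unit : ∀ h → 1ℤ ≡ 1ℤ * (1ℤ + h * 0ℤ)
  unit = solve-∀
union-Lead ((n , C) ∷ Cs) = Lead-cong (λ y → sym (chiL-⊔ C (union Cs) y))
  (subst (Lead (λ y → chiL C y * chiL (union Cs) y) (suc (length Cs))) (sym (ℤ.pos-* (treeSum C) (treeSums Cs)))
    (Lead-* (chiL-Lead C) (union-Lead Cs)))

treeSums-≥ : ∀ {Cs} → All Connected Cs → sizes Cs ℕ.≤ treeSums Cs
treeSums-≥ []                       = ℕ.≤-refl
treeSums-≥ {(_ , C) ∷ _} (p ∷ ps) = ℕ.*-mono-≤ (treeSum-≥ C p) (treeSums-≥ ps)

treeSums-trees : ∀ {Cs} → All Connected Cs → All Tree Cs → treeSums Cs ≡ sizes Cs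
treeSums-trees []       []       = refl
treeSums-trees {(_ , C) ∷ _} (p ∷ ps) (t ∷ ts) = cong₂ ℕ._*_ (treeSum-tree C p t) (treeSums-trees ps ts)

sizes-≥1 : ∀ Cs → 1 ℕ.≤ sizes Cs
sizes-≥1 []             = ℕ.≤-refl
sizes-≥1 ((n , _) ∷ Cs) = ℕ.≤-trans (sizes-≥1 Cs) (ℕ.m≤m+n (sizes Cs) (n ℕ.* sizes Cs))

pos-≢0 : ∀ {m} → 1 ℕ.≤ m → pos m ≢ 0ℤ
pos-≢0 (ℕ.s≤s _) ()

components-count : ∀ {Cs Ds} → All Connected Cs → All Connected Ds →
  (∀ y → chiL (union Cs) y ≡ chiL (union Ds) y) → length Cs ≡ length Ds × treeSums Cs ≡ treeSums Ds
components-count {Cs} {Ds} cs ds e = proj₁ both , ℤ.+-injective (proj₂ both)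
  where
  both : length Cs ≡ length Ds × pos (treeSums Cs) ≡ pos (treeSums Ds)
  both = Lead-unique (pos-≢0 (ℕ.≤-trans (sizes-≥1 Cs) (treeSums-≥ cs))) (pos-≢0 (ℕ.≤-trans (sizes-≥1 Ds) (treeSums-≥ ds)))
    (union-Lead Cs) (Lead-cong (λ y → sym (e y)) (union-Lead Ds))

sumDeg-⊔ : ∀ {n m} (G : Graph n) (H : Graph m) → sumDeg (G ⊔ H) ≡ sumDeg G ℕ.+ sumDeg H
sumDeg-⊔ G H = sum-degree-⊔ G H id

sumDeg-≥ : ∀ {Cs} → All Connected Cs → 2 ℕ.* total Cs ℕ.≤ sumDeg (union Cs) ℕ.+ 2 ℕ.* length Cs
sumDeg-≥ [] = ℕ.z≤n
sumDeg-≥ {(n , C) ∷ Cs} (p ∷ ps) = begin′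
  where
  rearrange₁ : ∀ n t → 2 ℕ.* (suc n ℕ.+ t) ≡ (2 ℕ.* n ℕ.+ 2) ℕ.+ 2 ℕ.* t
  rearrange₁ = ℕ-solve-∀
  rearrange₂ : ∀ a b l → (a ℕ.+ 2) ℕ.+ (b ℕ.+ 2 ℕ.* l) ≡ (a ℕ.+ b) ℕ.+ 2 ℕ.* suc l
  rearrange₂ = ℕ-solve-∀
  begin′ : 2 ℕ.* (suc n ℕ.+ total Cs) ℕ.≤ sumDeg (C ⊔ union Cs) ℕ.+ 2 ℕ.* suc (length Cs)
  begin′ = ℕ.≤-trans (ℕ.≤-reflexive (rearrange₁ n (total Cs)))
    (ℕ.≤-trans (ℕ.+-mono-≤ (ℕ.+-monoˡ-≤ 2 (conn-sumDeg C p)) (sumDeg-≥ ps))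
      (ℕ.≤-reflexive (trans (rearrange₂ (sumDeg C) (sumDeg (union Cs)) (length Cs))
        (cong (ℕ._+ 2 ℕ.* suc (length Cs)) (sym (sumDeg-⊔ C (union Cs)))))))

sumDeg-trees : ∀ {Cs} → All Tree Cs → sumDeg (union Cs) ℕ.+ 2 ℕ.* length Cs ≡ 2 ℕ.* total Cs
sumDeg-trees [] = refl
sumDeg-trees {(n , C) ∷ Cs} (t ∷ ts) = begin
  sumDeg (C ⊔ union Cs) ℕ.+ 2 ℕ.* suc (length Cs) ≡⟨ cong (ℕ._+ 2 ℕ.* suc (length Cs)) (trans (sumDeg-⊔ C (union Cs)) (cong (ℕ._+ sumDeg (union Cs)) t)) ⟩
  (2 ℕ.* n ℕ.+ sumDeg (union Cs)) ℕ.+ 2 ℕ.* suc (length Cs) ≡⟨ rearrange n (sumDeg (union Cs)) (length Cs) ⟩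
  2 ℕ.* suc n ℕ.+ (sumDeg (union Cs) ℕ.+ 2 ℕ.* length Cs) ≡⟨ cong (2 ℕ.* suc n ℕ.+_) (sumDeg-trees ts) ⟩
  2 ℕ.* suc n ℕ.+ 2 ℕ.* total Cs ≡⟨ ℕ.*-distribˡ-+ 2 (suc n) (total Cs) ⟨
  2 ℕ.* (suc n ℕ.+ total Cs) ∎
  where
  rearrange : ∀ n s l → (2 ℕ.* n ℕ.+ s) ℕ.+ 2 ℕ.* suc l ≡ 2 ℕ.* suc n ℕ.+ (s ℕ.+ 2 ℕ.* l)
  rearrange = ℕ-solve-∀

-- Both bounds 2n ≤ sumDeg C and the bound for the remaining components must be equalities.
all-trees : ∀ {Cs} → All Connected Cs → sumDeg (union Cs) ℕ.+ 2 ℕ.* length Cs ≡ 2 ℕ.* total Cs → All Tree Cs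
all-trees [] e = []
all-trees {(n , C) ∷ Cs} (p ∷ ps) e = tree ∷ all-trees ps rest
  where
  s = sumDeg (union Cs) ℕ.+ 2 ℕ.* length Cs
  rearrange : ∀ a b l → (a ℕ.+ b) ℕ.+ 2 ℕ.* suc l ≡ 2 ℕ.+ (a ℕ.+ (b ℕ.+ 2 ℕ.* l))
  rearrange = ℕ-solve-∀
  double : ∀ n t → 2 ℕ.* (suc n ℕ.+ t) ≡ 2 ℕ.+ (2 ℕ.* n ℕ.+ 2 ℕ.* t)
  double = ℕ-solve-∀
  combined : sumDeg C ℕ.+ s ≡ 2 ℕ.* n ℕ.+ 2 ℕ.* total Cs
  combined = ℕ.+-cancelˡ-≡ 2 _ _ (trans (sym (rearrange (sumDeg C) (sumDeg (union Cs)) (length Cs)))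
    (trans (cong (ℕ._+ 2 ℕ.* suc (length Cs)) (sym (sumDeg-⊔ C (union Cs)))) (trans e (double n (total Cs)))))
  tree : sumDeg C ≡ 2 ℕ.* n
  tree = ℕ.≤-antisym (ℕ.+-cancelʳ-≤ (2 ℕ.* total Cs) (sumDeg C) (2 ℕ.* n)
    (ℕ.≤-trans (ℕ.+-monoʳ-≤ (sumDeg C) (sumDeg-≥ ps)) (ℕ.≤-reflexive combined))) (conn-sumDeg C p)
  rest : s ≡ 2 ℕ.* total Cs
  rest = ℕ.+-cancelˡ-≡ (2 ℕ.* n) _ _ (trans (cong (ℕ._+ s) (sym tree)) combined)

-- The Laplacian has the eigenvalue 2, which corresponds to y = -2.
Root : Component → Set
Root (_ , C) = chiL C -2ℤ ≡ 0ℤ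

root? : ∀ C → Dec (Root C)
root? (_ , C) = chiL C -2ℤ ℤ.≟ 0ℤ

rootCount : List Component → ℕ
rootCount []       = 0
rootCount (C ∷ Cs) = (if does (root? C) then 1 else 0) ℕ.+ rootCount Cs

-- As a root of a tree at -2 is simple, its multiplicity is exactly 0 or 1, and in a forest these
-- add up to `rootCount`.
tree-Lead-2 : ∀ C → Connected C → Tree C →
              ∃ λ c → c ≢ 0ℤ × Lead (λ h → chiL (proj₂ C) (-2ℤ + h)) (if does (root? C) then 1 else 0) c
tree-Lead-2 (n , C) p t with root? (n , C)
... | no ¬root = chiL C -2ℤ , ¬root , chiL-Lead₀ C -2ℤ
... | yes root = derivative (shifted (Lap C) -2ℤ) δ ,
      tree-root-simple C p t -2ℤ -2-non-unit root′ ,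
      Lead-cong (λ h → sym (chiL-Lap C (-2ℤ + h))) (chi-Lead₁ (Lap C) -2ℤ root′)
  where
  root′ : chi (Lap C) -2ℤ ≡ 0ℤ
  root′ = trans (sym (chiL-Lap C -2ℤ)) root

union-Lead-2 : ∀ {Cs} → All Connected Cs → All Tree Cs →
               ∃ λ c → c ≢ 0ℤ × Lead (λ h → chiL (union Cs) (-2ℤ + h)) (rootCount Cs) c
union-Lead-2 [] [] = 1ℤ , (λ ()) , lead λ h → 0ℤ , trans (chiL-def emptyGraph (-2ℤ + h)) (unit h)
  where
  unit : ∀ h → 1ℤ ≡ 1ℤ * (1ℤ + h * 0ℤ)
  unit = solve-∀
union-Lead-2 {C ∷ Cs} (p ∷ ps) (t ∷ ts) = c * d , cd≢0 ,
  Lead-cong (λ h → sym (chiL-⊔ (proj₂ C) (union Cs) (-2ℤ + h))) (Lead-* (proj₂ (proj₂ first)) (proj₂ (proj₂ rest)))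
  where
  first = tree-Lead-2 C p t
  rest = union-Lead-2 ps ts
  c = proj₁ first
  d = proj₁ rest
  cd≢0 : c * d ≢ 0ℤ
  cd≢0 e = proj₁ (proj₂ rest) (*-≡0ˡ c d (proj₁ (proj₂ first)) e)

K2ᶜ : Component
K2ᶜ = 1 , K2

K2-Conn : Conn K2
K2-Conn S closed zero       zero       = refl
K2-Conn S closed zero       (suc zero) = closed zero (suc zero) refl
K2-Conn S closed (suc zero) zero       = closed (suc zero) zero refl
K2-Conn S closed (suc zero) (suc zero) = refl

rK2-union : ∀ r → rK2 r ≅ union (replicate r K2ᶜ)
rK2-union zero    = ≅-refl
rK2-union (suc r) = ⊔-congʳ K2 (rK2-union r)

replicate-all : ∀ {P : Component → Set} → P K2ᶜ → ∀ r → All P (replicate r K2ᶜ)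
replicate-all p zero    = []
replicate-all p (suc r) = p ∷ replicate-all p r

rootCount-K2 : ∀ r → rootCount (replicate r K2ᶜ) ≡ r
rootCount-K2 zero    = refl
rootCount-K2 (suc r) = cong₂ (λ b k → (if b then 1 else 0) ℕ.+ k) (dec-true (root? K2ᶜ) (chiL-def K2 -2ℤ)) (rootCount-K2 r)

sizes-K2 : ∀ r → sizes (replicate r K2ᶜ) ≡ 2 ℕ.^ r
sizes-K2 zero    = refl
sizes-K2 (suc r) = cong (2 ℕ.*_) (sizes-K2 r)

rootCount-≤ : ∀ Cs → rootCount Cs ℕ.≤ length Cs
rootCount-≤ []       = ℕ.z≤n
rootCount-≤ (C ∷ Cs) with root? C
... | yes _ = ℕ.s≤s (rootCount-≤ Cs)
... | no _  = ℕ.m≤n⇒m≤1+n (rootCount-≤ Cs)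

all-roots : ∀ Cs → length Cs ℕ.≤ rootCount Cs → All Root Cs
all-roots []       _ = []
all-roots (C ∷ Cs) le with root? C
... | yes root = root ∷ all-roots Cs (ℕ.s≤s⁻¹ le)
... | no _     = ⊥-elim (ℕ.<⇒≱ (ℕ.s≤s (rootCount-≤ Cs)) le)

-- At most one component lacks the root. It becomes `C₀`; if none lacks it, the last component is
-- taken.
all-roots-but-one : ∀ C Cs → length Cs ℕ.≤ rootCount (C ∷ Cs) → ∃ λ C₀ → ∃ λ Ds → (C ∷ Cs) ↭ (C₀ ∷ Ds) × All Root Ds
all-roots-but-one C [] le = C , [] , ↭.refl , []
all-roots-but-one C (D ∷ Cs) le with root? C
... | no _ = C , D ∷ Cs , ↭.refl , all-roots (D ∷ Cs) le
... | yes root with all-roots-but-one D Cs (ℕ.s≤s⁻¹ le)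
...   | C₀ , Ds , p , roots = C₀ , C ∷ Ds , ↭.trans (↭.prep C p) (↭.swap C C₀ ↭.refl) , root ∷ roots

-- The double cover

-- The condition says that a row added to another one is itself left as it is. The simultaneous
-- change can therefore be made one row at a time: in `N k` the first k rows have been treated.
det-add-rows : ∀ {n} (M : Matrix n) (c : Fin n → ℤ) (σ : Fin n → Fin n) → (∀ a → c a ≡ 0ℤ ⊎ c (σ a) ≡ 0ℤ) →
               det (λ a b → M a b + c a * M (σ a) b) ≡ det M
det-add-rows {n} M c σ ok = begin
  det (λ a b → M a b + c a * M (σ a) b) ≡⟨ det-cong (λ a b → cong (λ x → M a b + x * M (σ a) b) (sym (upto-yes n (Fin.toℕ<n a)))) ⟩
  det (N n)                             ≡⟨ go n ℕ.≤-refl ⟩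
  det M                                 ∎
  where
  upto : ℕ → Fin n → ℤ
  upto k a = if does (toℕ a ℕ.<? k) then c a else 0ℤ
  upto-yes : ∀ k {a} → toℕ a ℕ.< k → upto k a ≡ c a
  upto-yes k {a} p = cong (λ x → if x then c a else 0ℤ) (dec-true (toℕ a ℕ.<? k) p)
  upto-no : ∀ k {a} → ¬ (toℕ a ℕ.< k) → upto k a ≡ 0ℤ
  upto-no k {a} p = cong (λ x → if x then c a else 0ℤ) (dec-false (toℕ a ℕ.<? k) p)
  upto-0 : ∀ k {a} → c a ≡ 0ℤ → upto k a ≡ 0ℤ
  upto-0 k {a} p with does (toℕ a ℕ.<? k)
  ... | true  = p
  ... | false = refl
  N : ℕ → Matrix n
  N k a b = M a b + upto k a * M (σ a) b
  no-change : ∀ m x {u} → u ≡ 0ℤ → m + u * x ≡ m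
  no-change m x refl = ℤ.+-identityʳ m
  go : ∀ k → k ℕ.≤ n → det (N k) ≡ det M
  go zero    _   = det-cong (λ a b → no-change (M a b) (M (σ a) b) (upto-no 0 {a} λ ()))
  go (suc k) k<n = trans drop-row (go k (ℕ.<⇒≤ k<n))
    where
    i = fromℕ< k<n
    toℕ-i : toℕ i ≡ k
    toℕ-i = Fin.toℕ-fromℕ< k<n
    N-i : ∀ b → N k i b ≡ M i b
    N-i b = no-change (M i b) (M (σ i) b) (upto-no k {i} λ lt → ℕ.<-irrefl toℕ-i lt)
    same : ∀ a → a ≢ i → upto (suc k) a ≡ upto k a
    same a a≢i with ℕ.<-cmp (toℕ a) k
    ... | tri< lt _ _ = trans (upto-yes (suc k) (ℕ.m<n⇒m<1+n lt)) (sym (upto-yes k lt))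
    ... | tri≈ _ eq _ = ⊥-elim (a≢i (Fin.toℕ-injective (trans eq (sym toℕ-i))))
    ... | tri> ¬lt ¬eq gt = trans (upto-no (suc k) (λ le → ℕ.<⇒≱ gt (ℕ.s≤s⁻¹ le))) (sym (upto-no k ¬lt))
    commuted : ∀ m u x → m + u * x ≡ u * x + m
    commuted = solve-∀
    entries : ∀ a b → N (suc k) a b ≡ (N k [ i ≔ (λ b → c i * M (σ i) b + M i b) ]) a b
    entries a b = ≔-elim (λ a r → N (suc k) a b ≡ r b) (N k) i (λ b → c i * M (σ i) b + M i b)
      (trans (cong (λ u → M i b + u * M (σ i) b) (upto-yes (suc k) (ℕ.s≤s (ℕ.≤-reflexive toℕ-i)))) (commuted (M i b) (c i) (M (σ i) b)))
      (λ a a≢i → cong (λ u → M a b + u * M (σ a) b) (same a a≢i)) a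
    extra : c i * det (N k [ i ≔ M (σ i) ]) ≡ 0ℤ
    extra with c i ℤ.≟ 0ℤ
    ... | yes cᵢ≡0 = trans (cong (_* det (N k [ i ≔ M (σ i) ])) cᵢ≡0) (ℤ.*-zeroˡ (det (N k [ i ≔ M (σ i) ])))
    ... | no  cᵢ≢0 = trans (cong (c i *_) (det-alt (N k [ i ≔ M (σ i) ]) i (σ i) i≢σi equal)) (ℤ.*-zeroʳ (c i))
      where
      c-σi : c (σ i) ≡ 0ℤ
      c-σi with ok i
      ... | inj₁ e = ⊥-elim (cᵢ≢0 e)
      ... | inj₂ e = e
      i≢σi : i ≢ σ i
      i≢σi e = cᵢ≢0 (trans (cong c e) c-σi)
      equal : ∀ b → (N k [ i ≔ M (σ i) ]) i b ≡ (N k [ i ≔ M (σ i) ]) (σ i) b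
      equal b = trans (cong (λ r → r b) (≔-at (N k) i (M (σ i))))
        (sym (trans (cong (λ r → r b) (≔-off (N k) (M (σ i)) (i≢σi ∘ sym))) (no-change (M (σ i) b) (M (σ (σ i)) b) (upto-0 k c-σi))))
    drop-row : det (N (suc k)) ≡ det (N k)
    drop-row = begin
      det (N (suc k)) ≡⟨ det-cong entries ⟩
      det (N k [ i ≔ (λ b → c i * M (σ i) b + M i b) ]) ≡⟨ det-≔-lin (N k) i (c i) (M (σ i)) (M i) ⟩
      c i * det (N k [ i ≔ M (σ i) ]) + det (N k [ i ≔ M i ]) ≡⟨ cong₂ _+_ extra (det-≔-cong (N k) i (λ b → sym (N-i b))) ⟩
      0ℤ + det (N k [ i ≔ N k i ]) ≡⟨ ℤ.+-identityˡ (det (N k [ i ≔ N k i ])) ⟩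
      det (N k [ i ≔ N k i ]) ≡⟨ det-cong (≔-id (N k) i) ⟩
      det (N k) ∎

data Half n : Fin (n ℕ.+ n) → Set where
  lower : ∀ i → Half n (i ↑ˡ n)
  upper : ∀ i → Half n (n ↑ʳ i)

half : ∀ n i → Half n i
half n i with splitAt n i in e
... | inj₁ a = subst (Half n) (Fin.splitAt⁻¹-↑ˡ e) (lower a)
... | inj₂ b = subst (Half n) (Fin.splitAt⁻¹-↑ʳ e) (upper b)

-- [[X, Y], [Y, X]] is carried to [[X + Y, 0], [Y, X − Y]] by row and column operations.
det-circulant : ∀ {n} (M : Matrix (n ℕ.+ n)) (X Y : Matrix n) →
                (∀ i j → M (i ↑ˡ n) (j ↑ˡ n) ≡ X i j) → (∀ i j → M (i ↑ˡ n) (n ↑ʳ j) ≡ Y i j) →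
                (∀ i j → M (n ↑ʳ i) (j ↑ˡ n) ≡ Y i j) → (∀ i j → M (n ↑ʳ i) (n ↑ʳ j) ≡ X i j) →
                det M ≡ det (λ i j → X i j + Y i j) * det (λ i j → X i j - Y i j)
det-circulant {n} M X Y hll hlr hrl hrr = begin
  det M                                                      ≡⟨ det-add-rows M c₁ swap-half ok₁ ⟨
  det M₁                                                     ≡⟨ det-ᵀ M₁ ⟨
  det (M₁ ᵀ)                                                 ≡⟨ det-add-rows (M₁ ᵀ) c₂ swap-half ok₂ ⟨
  det M₂                                                     ≡⟨ det-ᵀ M₂ ⟨
  det (M₂ ᵀ)                                                 ≡⟨ det-block (M₂ ᵀ) (λ i j → X i j + Y i j) (λ i j → X i j - Y i j) ll lr rr ⟩
  det (λ i j → X i j + Y i j) * det (λ i j → X i j - Y i j)  ∎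
  where
  by-half : ∀ {A : Set} → A → A → Fin n ⊎ Fin n → A
  by-half x y (inj₁ _) = x
  by-half x y (inj₂ _) = y
  flip-half : Fin n ⊎ Fin n → Fin (n ℕ.+ n)
  flip-half (inj₁ a) = n ↑ʳ a
  flip-half (inj₂ b) = b ↑ˡ n
  swap-half : Fin (n ℕ.+ n) → Fin (n ℕ.+ n)
  swap-half i = flip-half (splitAt n i)
  c₁ c₂ : Fin (n ℕ.+ n) → ℤ
  c₁ i = by-half 1ℤ 0ℤ (splitAt n i)
  c₂ i = by-half 0ℤ -1ℤ (splitAt n i)
  swap-l : ∀ i → swap-half (i ↑ˡ n) ≡ n ↑ʳ i
  swap-l i = cong flip-half (Fin.splitAt-↑ˡ n i n)
  swap-r : ∀ i → swap-half (n ↑ʳ i) ≡ i ↑ˡ n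
  swap-r i = cong flip-half (Fin.splitAt-↑ʳ n n i)
  c₁-l : ∀ i → c₁ (i ↑ˡ n) ≡ 1ℤ
  c₁-l i = cong (by-half 1ℤ 0ℤ) (Fin.splitAt-↑ˡ n i n)
  c₁-r : ∀ i → c₁ (n ↑ʳ i) ≡ 0ℤ
  c₁-r i = cong (by-half 1ℤ 0ℤ) (Fin.splitAt-↑ʳ n n i)
  c₂-l : ∀ i → c₂ (i ↑ˡ n) ≡ 0ℤ
  c₂-l i = cong (by-half 0ℤ -1ℤ) (Fin.splitAt-↑ˡ n i n)
  c₂-r : ∀ i → c₂ (n ↑ʳ i) ≡ -1ℤ
  c₂-r i = cong (by-half 0ℤ -1ℤ) (Fin.splitAt-↑ʳ n n i)
  ok₁ : ∀ i → c₁ i ≡ 0ℤ ⊎ c₁ (swap-half i) ≡ 0ℤ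
  ok₁ i with half n i
  ... | lower a = inj₂ (trans (cong c₁ (swap-l a)) (c₁-r a))
  ... | upper b = inj₁ (c₁-r b)
  ok₂ : ∀ i → c₂ i ≡ 0ℤ ⊎ c₂ (swap-half i) ≡ 0ℤ
  ok₂ i with half n i
  ... | lower a = inj₁ (c₂-l a)
  ... | upper b = inj₂ (trans (cong c₂ (swap-r b)) (c₂-l b))
  M₁ M₂ : Matrix (n ℕ.+ n)
  M₁ a b = M a b + c₁ a * M (swap-half a) b
  M₂ a b = (M₁ ᵀ) a b + c₂ a * (M₁ ᵀ) (swap-half a) b
  M₁-l : ∀ i b → M₁ (i ↑ˡ n) b ≡ M (i ↑ˡ n) b + M (n ↑ʳ i) b
  M₁-l i b = trans (cong₂ (λ c k → M (i ↑ˡ n) b + c * M k b) (c₁-l i) (swap-l i)) (cong (M (i ↑ˡ n) b +_) (ℤ.*-identityˡ (M (n ↑ʳ i) b)))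
  M₁-r : ∀ i b → M₁ (n ↑ʳ i) b ≡ M (n ↑ʳ i) b
  M₁-r i b = trans (cong (λ c → M (n ↑ʳ i) b + c * M (swap-half (n ↑ʳ i)) b) (c₁-r i)) (ℤ.+-identityʳ (M (n ↑ʳ i) b))
  M₂-l : ∀ j a → M₂ (j ↑ˡ n) a ≡ M₁ a (j ↑ˡ n)
  M₂-l j a = trans (cong (λ c → M₁ a (j ↑ˡ n) + c * M₁ a (swap-half (j ↑ˡ n))) (c₂-l j)) (ℤ.+-identityʳ (M₁ a (j ↑ˡ n)))
  minus : ∀ x y → x + -1ℤ * y ≡ x - y
  minus = solve-∀
  M₂-r : ∀ j a → M₂ (n ↑ʳ j) a ≡ M₁ a (n ↑ʳ j) - M₁ a (j ↑ˡ n)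
  M₂-r j a = trans (cong₂ (λ c k → M₁ a (n ↑ʳ j) + c * M₁ a k) (c₂-r j) (swap-r j)) (minus (M₁ a (n ↑ʳ j)) (M₁ a (j ↑ˡ n)))
  ll : ∀ i j → (M₂ ᵀ) (i ↑ˡ n) (j ↑ˡ n) ≡ X i j + Y i j
  ll i j = trans (M₂-l j (i ↑ˡ n)) (trans (M₁-l i (j ↑ˡ n)) (cong₂ _+_ (hll i j) (hrl i j)))
  lr : ∀ i j → (M₂ ᵀ) (i ↑ˡ n) (n ↑ʳ j) ≡ 0ℤ
  lr i j = trans (M₂-r j (i ↑ˡ n)) (trans (cong₂ _-_
    (trans (M₁-l i (n ↑ʳ j)) (cong₂ _+_ (hlr i j) (hrr i j))) (trans (M₁-l i (j ↑ˡ n)) (cong₂ _+_ (hll i j) (hrl i j)))) (cancel (X i j) (Y i j)))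
    where
    cancel : ∀ x y → (y + x) - (x + y) ≡ 0ℤ
    cancel = solve-∀
  rr : ∀ i j → (M₂ ᵀ) (n ↑ʳ i) (n ↑ʳ j) ≡ X i j - Y i j
  rr i j = trans (M₂-r j (n ↑ʳ i)) (cong₂ _-_ (trans (M₁-r i (n ↑ʳ j)) (hrr i j)) (trans (M₁-r i (j ↑ˡ n)) (hrl i j)))

module _ {n} (G : Graph n) where

  dcAdj : Fin n ⊎ Fin n → Fin n ⊎ Fin n → Bool
  dcAdj (inj₁ i) (inj₂ j) = adj G i j
  dcAdj (inj₂ i) (inj₁ j) = adj G i j
  dcAdj (inj₁ _) (inj₁ _) = false
  dcAdj (inj₂ _) (inj₂ _) = false

  dcAdj-sym : ∀ x y → dcAdj x y ≡ dcAdj y x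
  dcAdj-sym (inj₁ i) (inj₁ j) = refl
  dcAdj-sym (inj₁ i) (inj₂ j) = adj-sym G i j
  dcAdj-sym (inj₂ i) (inj₁ j) = adj-sym G i j
  dcAdj-sym (inj₂ i) (inj₂ j) = refl

  dcAdj-irrefl : ∀ x → dcAdj x x ≡ false
  dcAdj-irrefl (inj₁ _) = refl
  dcAdj-irrefl (inj₂ _) = refl

  doubleCover : Graph (n ℕ.+ n)
  doubleCover = record
    { adj    = λ i j → dcAdj (splitAt n i) (splitAt n j)
    ; sym    = λ i j → dcAdj-sym (splitAt n i) (splitAt n j)
    ; irrefl = λ i → dcAdj-irrefl (splitAt n i) }

  private
    DC = doubleCover

  dc-ll : ∀ i j → adj DC (i ↑ˡ n) (j ↑ˡ n) ≡ false
  dc-ll i j = cong₂ dcAdj (Fin.splitAt-↑ˡ n i n) (Fin.splitAt-↑ˡ n j n)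

  dc-lr : ∀ i j → adj DC (i ↑ˡ n) (n ↑ʳ j) ≡ adj G i j
  dc-lr i j = cong₂ dcAdj (Fin.splitAt-↑ˡ n i n) (Fin.splitAt-↑ʳ n n j)

  dc-rl : ∀ i j → adj DC (n ↑ʳ i) (j ↑ˡ n) ≡ adj G i j
  dc-rl i j = cong₂ dcAdj (Fin.splitAt-↑ʳ n n i) (Fin.splitAt-↑ˡ n j n)

  dc-rr : ∀ i j → adj DC (n ↑ʳ i) (n ↑ʳ j) ≡ false
  dc-rr i j = cong₂ dcAdj (Fin.splitAt-↑ʳ n n i) (Fin.splitAt-↑ʳ n n j)

  dc-degree-l : ∀ i → degree DC (i ↑ˡ n) ≡ degree G i
  dc-degree-l i = trans (sumℕ-++ n (λ k → b2ℕ (adj DC (i ↑ˡ n) k)))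
    (cong₂ ℕ._+_ (sumℕ-zero (λ j → cong b2ℕ (dc-ll i j))) (sumℕ-cong (λ j → cong b2ℕ (dc-lr i j))))

  dc-degree-r : ∀ i → degree DC (n ↑ʳ i) ≡ degree G i
  dc-degree-r i = trans (sumℕ-++ n (λ k → b2ℕ (adj DC (n ↑ʳ i) k)))
    (trans (cong₂ ℕ._+_ (sumℕ-cong (λ j → cong b2ℕ (dc-rl i j))) (sumℕ-zero (λ j → cong b2ℕ (dc-rr i j)))) (ℕ.+-identityʳ (degree G i)))

  dc-sumDeg : sumDeg DC ≡ sumDeg G ℕ.+ sumDeg G
  dc-sumDeg = trans (sumℕ-++ n (degree DC)) (cong₂ ℕ._+_ (sumℕ-cong dc-degree-l) (sumℕ-cong dc-degree-r))

  -- In blocks, the matrix of the cover has D + yI on the diagonal and -A off it; the sum of the two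
  -- blocks is yI + L, their difference yI + Q.
  dc-chi : ∀ y → chiL DC y ≡ chiL G y * chi (SLap 1ℤ G) y
  dc-chi y = trans (trans (chiL-def DC y) (det-circulant (shifted (SLap -1ℤ DC) y) X Y ll lr rl rr))
      (cong₂ _*_ (trans (det-cong (λ i j → join-L (δ i j) (pos (degree G i)) (adjMatrix G i j) y)) (sym (chiL-def G y)))
                 (det-cong (λ i j → join-Q (δ i j) (pos (degree G i)) (adjMatrix G i j) y)))
    where
    entry : ℤ → ℕ → Bool → ℤ
    entry d k b = (d * pos k + -1ℤ * (if b then 1ℤ else 0ℤ)) + y * d
    X Y : Matrix n
    X i j = δ i j * pos (degree G i) + y * δ i j
    Y i j = -1ℤ * adjMatrix G i j
    join-L : ∀ d k a y → (d * k + y * d) + -1ℤ * a ≡ (d * k + -1ℤ * a) + y * d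
    join-L = solve-∀
    join-Q : ∀ d k a y → (d * k + y * d) - -1ℤ * a ≡ (d * k + 1ℤ * a) + y * d
    join-Q = solve-∀
    diagonal : ∀ d k y → (d * k + -1ℤ * 0ℤ) + y * d ≡ d * k + y * d
    diagonal = solve-∀
    off : ∀ k a y → (0ℤ * k + -1ℤ * a) + y * 0ℤ ≡ -1ℤ * a
    off = solve-∀
    ll : ∀ i j → entry (δ (i ↑ˡ n) (j ↑ˡ n)) (degree DC (i ↑ˡ n)) (adj DC (i ↑ˡ n) (j ↑ˡ n)) ≡ X i j
    ll i j = trans (cong₂ (λ d k → entry d k (adj DC (i ↑ˡ n) (j ↑ˡ n))) (δ-injective (_↑ˡ n) (λ {a} {b} → Fin.↑ˡ-injective n a b) i j) (dc-degree-l i))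
      (trans (cong (entry (δ i j) (degree G i)) (dc-ll i j)) (diagonal (δ i j) (pos (degree G i)) y))
    rr : ∀ i j → entry (δ (n ↑ʳ i) (n ↑ʳ j)) (degree DC (n ↑ʳ i)) (adj DC (n ↑ʳ i) (n ↑ʳ j)) ≡ X i j
    rr i j = trans (cong₂ (λ d k → entry d k (adj DC (n ↑ʳ i) (n ↑ʳ j))) (δ-injective (n ↑ʳ_) (λ {a} {b} → Fin.↑ʳ-injective n a b) i j) (dc-degree-r i))
      (trans (cong (entry (δ i j) (degree G i)) (dc-rr i j)) (diagonal (δ i j) (pos (degree G i)) y))
    lr : ∀ i j → entry (δ (i ↑ˡ n) (n ↑ʳ j)) (degree DC (i ↑ˡ n)) (adj DC (i ↑ˡ n) (n ↑ʳ j)) ≡ Y i j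
    lr i j = trans (cong₂ (λ d b → entry d (degree DC (i ↑ˡ n)) b) (δ-ˡʳ G G i j) (dc-lr i j))
      (off (pos (degree DC (i ↑ˡ n))) (adjMatrix G i j) y)
    rl : ∀ i j → entry (δ (n ↑ʳ i) (j ↑ˡ n)) (degree DC (n ↑ʳ i)) (adj DC (n ↑ʳ i) (j ↑ˡ n)) ≡ Y i j
    rl i j = trans (cong₂ (λ d b → entry d (degree DC (n ↑ʳ i)) b) (trans (δ-sym (n ↑ʳ i) (j ↑ˡ n)) (δ-ˡʳ G G j i)) (dc-rl i j))
      (off (pos (degree DC (n ↑ʳ i))) (adjMatrix G i j) y)

Coloring : ∀ {n} → Graph n → (Fin n → Bool) → Set
Coloring G s = ∀ i j → adj G i j ≡ true → s i ≡ not (s j)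

Bipartite : ∀ {n} → Graph n → Set
Bipartite G = ∃ (Coloring G)

bipartite? : ∀ {n} (G : Graph n) → Dec (Bipartite G)
bipartite? {n} G with anySubset? {n} (λ p → Fin.all? (λ i → Fin.all? (λ j →
  (adj G i j Bool.≟ true) →-dec (lookup p i Bool.≟ not (lookup p j)))))
... | yes (p , h) = yes (lookup p , h)
... | no ¬h = no λ { (s , h) → ¬h (tabulate s , λ i j e →
  trans (lookup∘tabulate s i) (trans (h i j e) (cong not (sym (lookup∘tabulate s j))))) }

-- For a closed set S of the double cover, "exactly one of the two lifts of v is in S" is a closed
-- property of v. If it fails everywhere, S is a lift of a closed set of G; if it holds everywhere,
-- S is a proper 2-colouring of G.
doubleCover-Conn : ∀ {n} (G : Graph n) → Conn G → ¬ Bipartite G → Conn (doubleCover G)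
doubleCover-Conn {n} G conn ¬bip S closed = all-equal
  where
  s₁ s₂ e : Fin n → Bool
  s₁ v = S (v ↑ˡ n)
  s₂ v = S (n ↑ʳ v)
  e v = s₁ v xor s₂ v
  s₁₂ : ∀ u v → adj G u v ≡ true → s₁ u ≡ s₂ v
  s₁₂ u v p = closed (u ↑ˡ n) (n ↑ʳ v) (trans (dc-lr G u v) p)
  s₂₁ : ∀ u v → adj G u v ≡ true → s₂ u ≡ s₁ v
  s₂₁ u v p = closed (n ↑ʳ u) (v ↑ˡ n) (trans (dc-rl G u v) p)
  e-closed : Closed G e
  e-closed u v p = trans (cong₂ _xor_ (s₁₂ u v p) (s₂₁ u v p)) (Bool.xor-comm (s₂ v) (s₁ v))
  xor-false : ∀ x y → x xor y ≡ false → x ≡ y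
  xor-false true  true  _ = refl
  xor-false false false _ = refl
  xor-true : ∀ x y → x xor y ≡ true → y ≡ not x
  xor-true true  false _ = refl
  xor-true false true  _ = refl
  e-false : ∀ v → e v ≡ false
  e-false v with e v in eq
  ... | false = refl
  ... | true  = ⊥-elim (¬bip (s₁ , λ i j p → trans (s₁₂ i j p) (xor-true (s₁ j) (s₂ j) (trans (conn e e-closed j v) eq))))
  same : ∀ v → s₁ v ≡ s₂ v
  same v = xor-false (s₁ v) (s₂ v) (e-false v)
  s₁-const : ∀ u v → s₁ u ≡ s₁ v
  s₁-const = conn s₁ (λ u v p → trans (s₁₂ u v p) (sym (same v)))
  all-equal : ∀ i j → S i ≡ S j
  all-equal i j with half n i | half n j
  ... | lower a | lower b = s₁-const a b
  ... | lower a | upper b = trans (s₁-const a b) (same b)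
  ... | upper a | lower b = trans (sym (same a)) (s₁-const a b)
  ... | upper a | upper b = trans (sym (same a)) (trans (s₁-const a b) (same b))

-- Otherwise the double cover is connected on 2n + 2 vertices and has degree sum at least 4n + 2,
-- but twice the degree sum of a tree is only 4n.
tree-bipartite : ∀ {n} (G : Graph (suc n)) → Conn G → sumDeg G ≡ 2 ℕ.* n → Bipartite G
tree-bipartite {n} G conn tree with bipartite? G
... | yes b = b
... | no ¬b = ⊥-elim (ℕ.<⇒≱ (ℕ.≤-trans (ℕ.n≤1+n _) (ℕ.≤-reflexive (rearrange n)))
    (ℕ.≤-trans (conn-sumDeg (doubleCover G) (doubleCover-Conn G conn ¬b))
      (ℕ.≤-reflexive (trans (dc-sumDeg G) (cong₂ ℕ._+_ tree tree)))))
  where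
  rearrange : ∀ n → 2 ℕ.+ (2 ℕ.* n ℕ.+ 2 ℕ.* n) ≡ 2 ℕ.* (n ℕ.+ suc n)
  rearrange = ℕ-solve-∀

-- If Q were singular, `chiL` of the double cover would vanish at 0 to order at least 2, once
-- through L and once through Q; for a connected graph the order is 1.
signless-nonsingular : ∀ {n} (G : Graph (suc n)) → Conn G → ¬ Bipartite G → chi (SLap 1ℤ G) 0ℤ ≢ 0ℤ
signless-nonsingular {n} G conn ¬b root = ℕ.<⇒≱ (ℕ.n<1+n 1) (Lead-order nonzero (chiL-Lead (doubleCover G)) product-Lead)
  where
  nonzero : pos (treeSum (doubleCover G)) ≢ 0ℤ
  nonzero = pos-≢0 (ℕ.≤-trans (ℕ.s≤s ℕ.z≤n) (treeSum-≥ (doubleCover G) (doubleCover-Conn G conn ¬b)))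
  product-Lead : Lead (chiL (doubleCover G)) 2 (pos (treeSum G) * derivative (shifted (SLap 1ℤ G) 0ℤ) δ)
  product-Lead = Lead-cong (λ y → sym (dc-chi G y)) (Lead-* (chiL-Lead G)
    (Lead-cong (λ y → cong (chi (SLap 1ℤ G)) (ℤ.+-identityˡ y)) (chi-Lead₁ (SLap 1ℤ G) 0ℤ root)))

sum-symmetric-even : ∀ {n} (f : Fin n → Fin n → ℤ) → (∀ i j → f i j ≡ f j i) → (∀ i → f i i ≡ 0ℤ) →
                     ∃ λ q → sumℤ (λ i → sumℤ (f i)) ≡ q + q
sum-symmetric-even {zero}  f f-sym f-diag = 0ℤ , refl
sum-symmetric-even {suc n} f f-sym f-diag with sum-symmetric-even (λ i j → f (suc i) (suc j)) (λ i j → f-sym (suc i) (suc j)) (f-diag ∘ suc)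
... | q , e = r + q , (begin
  (f zero zero + r) + sumℤ (λ i → f (suc i) zero + sumℤ (λ j → f (suc i) (suc j)))
    ≡⟨ cong₂ (λ x y → (x + r) + y) (f-diag zero) (sumℤ-+ (λ i → f (suc i) zero) (λ i → sumℤ (λ j → f (suc i) (suc j)))) ⟩
  (0ℤ + r) + (sumℤ (λ i → f (suc i) zero) + sumℤ (λ i → sumℤ (λ j → f (suc i) (suc j))))
    ≡⟨ cong₂ (λ x y → (0ℤ + r) + (x + y)) (sumℤ-cong (λ i → f-sym (suc i) zero)) e ⟩
  (0ℤ + r) + (r + (q + q)) ≡⟨ rearrange r q ⟩
  (r + q) + (r + q) ∎)
  where
  r = sumℤ (λ j → f zero (suc j))
  rearrange : ∀ r q → (0ℤ + r) + (r + (q + q)) ≡ (r + q) + (r + q)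
  rearrange = solve-∀

-- Q = L + 2A with L singular; the first-order term tr(adj(L) A) is even by symmetry.
signless-divisible-by-4 : ∀ {n} (G : Graph (suc n)) → ∃ λ q → chi (SLap 1ℤ G) 0ℤ ≡ pos 4 * q
signless-divisible-by-4 {n} G = p + k , (begin
  chi (SLap 1ℤ G) 0ℤ ≡⟨ det-cong (λ i j → split-Q (δ i j) (pos (degree G i)) (adjMatrix G i j)) ⟩
  det (λ i j → L i j + two * A i j) ≡⟨ proj₂ (det-shift L A two) ⟩
  det L + two * (derivative L A + two * k) ≡⟨ cong₂ (λ x y → x + two * (y + two * k)) (laplacian-singular G) (trans derivative-sum even) ⟩
  0ℤ + two * ((p + p) + two * k) ≡⟨ collect p k ⟩
  pos 4 * (p + k) ∎)
  where
  L = Lap G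
  A = adjMatrix G
  two = pos 2
  k = proj₁ (det-shift L A two)
  f : Fin (suc n) → Fin (suc n) → ℤ
  f i j = A i j * adjugate L j i
  split-Q : ∀ d e a → (d * e + 1ℤ * a) + 0ℤ * d ≡ (d * e - a) + pos 2 * a
  split-Q = solve-∀
  collect : ∀ p k → 0ℤ + pos 2 * ((p + p) + pos 2 * k) ≡ pos 4 * (p + k)
  collect = solve-∀
  derivative-sum : derivative L A ≡ sumℤ (λ i → sumℤ (f i))
  derivative-sum = sumℤ-cong (λ i → trans (det-≔-cong L i (λ b → sym (sumℤ-δʳ b (A i)))) (det-≔-sum L i (A i) δ))
  f-sym : ∀ i j → f i j ≡ f j i
  f-sym i j = cong₂ _*_ (adjMatrix-sym G i j) (adjugate-sym L (Lap-sym G) j i)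
  f-diag : ∀ i → f i i ≡ 0ℤ
  f-diag i = trans (cong (λ x → (if x then 1ℤ else 0ℤ) * adjugate L i i) (adj-irrefl G i)) (ℤ.*-zeroˡ (adjugate L i i))
  p = proj₁ (sum-symmetric-even f f-sym f-diag)
  even : sumℤ (λ i → sumℤ (f i)) ≡ p + p
  even = proj₂ (sum-symmetric-even f f-sym f-diag)

-- The degree invariant

sumℤ-- : ∀ {n} (f g : Fin n → ℤ) → sumℤ (λ i → f i - g i) ≡ sumℤ f - sumℤ g
sumℤ-- f g = trans (sumℤ-+ f (λ i → - g i)) (cong (sumℤ f +_) (sumℤ-neg g))

-- Chosen so that ψ 0 > 0, ψ 1 = 0, ψ x ≥ 0 for x ≤ 4, and (x − 1) − ψ x = (x − 1)(x − 3)².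
ψ : ℤ → ℤ
ψ x = (x - 1ℤ) * (x - pos 2) * (pos 4 - x)

module _ {n} (G : Graph n) where

  private
    A L : Matrix n
    A = adjMatrix G
    L = Lap G
    d : Fin n → ℤ
    d i = pos (degree G i)

    if-square : ∀ b → (if b then 1ℤ else 0ℤ) * (if b then 1ℤ else 0ℤ) ≡ (if b then 1ℤ else 0ℤ)
    if-square true  = refl
    if-square false = refl

    A-diag : ∀ i → A i i ≡ 0ℤ
    A-diag i = cong (λ x → if x then 1ℤ else 0ℤ) (adj-irrefl G i)

    A-loop : ∀ i l → A i l * A l i ≡ A i l
    A-loop i l = trans (cong (A i l *_) (adjMatrix-sym G l i)) (if-square (adj G i l))

    L·-step : ∀ (c : Fin n → ℤ) i → sumℤ (λ l → L i l * c l) ≡ d i * c i - sumℤ (λ l → A i l * c l)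
    L·-step c i = begin
      sumℤ (λ l → L i l * c l) ≡⟨ sumℤ-cong (λ l → distribute (δ i l) (d i) (A i l) (c l)) ⟩
      sumℤ (λ l → δ i l * (d i * c l) - A i l * c l) ≡⟨ sumℤ-- (λ l → δ i l * (d i * c l)) (λ l → A i l * c l) ⟩
      sumℤ (λ l → δ i l * (d i * c l)) - sumℤ (λ l → A i l * c l) ≡⟨ cong (_- sumℤ (λ l → A i l * c l)) (sumℤ-δ i (λ l → d i * c l)) ⟩
      d i * c i - sumℤ (λ l → A i l * c l) ∎
      where
      distribute : ∀ x d a c → (x * d - a) * c ≡ x * (d * c) - a * c
      distribute = solve-∀

    A² A³ : Matrix n
    A² i j = sumℤ (λ l → A i l * A l j)
    A³ i j = sumℤ (λ l → A² i l * A l j)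

    mpow₁ : ∀ i j → mpow L 1 i j ≡ L i j
    mpow₁ i j = sumℤ-δ i (λ l → L l j)

    L-diag : ∀ i → L i i ≡ d i
    L-diag i = trans (cong₂ (λ x a → x * d i - a) (δ-refl i) (A-diag i)) (tidy (d i))
      where
      tidy : ∀ x → 1ℤ * x - 0ℤ ≡ x
      tidy = solve-∀

    mpow₂ : ∀ i j → mpow L 2 i j ≡ d i * L i j - (A i j * d j - A² i j)
    mpow₂ i j = begin
      sumℤ (λ l → mpow L 1 i l * L l j) ≡⟨ sumℤ-cong (λ l → cong (_* L l j) (mpow₁ i l)) ⟩
      sumℤ (λ l → L i l * L l j) ≡⟨ L·-step (λ l → L l j) i ⟩
      d i * L i j - sumℤ (λ l → A i l * L l j) ≡⟨ cong (λ z → d i * L i j - z) (begin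
        sumℤ (λ l → A i l * L l j) ≡⟨ sumℤ-cong (λ l → distribute (A i l) (δ l j) (d l) (A l j)) ⟩
        sumℤ (λ l → (A i l * d l) * δ l j - A i l * A l j) ≡⟨ sumℤ-- (λ l → (A i l * d l) * δ l j) (λ l → A i l * A l j) ⟩
        sumℤ (λ l → (A i l * d l) * δ l j) - A² i j ≡⟨ cong (_- A² i j) (sumℤ-δʳ j (λ l → A i l * d l)) ⟩
        A i j * d j - A² i j ∎) ⟩
      d i * L i j - (A i j * d j - A² i j) ∎
      where
      distribute : ∀ a x d b → a * (x * d - b) ≡ (a * d) * x - a * b
      distribute = solve-∀

    A²-diag : ∀ i → A² i i ≡ d i
    A²-diag i = trans (sumℤ-cong (A-loop i)) (sum-adjMatrix G i)

    mpow₂-diag : ∀ i → mpow L 2 i i ≡ d i * d i + d i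
    mpow₂-diag i = trans (mpow₂ i i) (trans (cong₂ (λ x y → d i * x - y) (L-diag i) (cong₂ (λ a b → a * d i - b) (A-diag i) (A²-diag i)))
      (tidy (d i)))
      where
      tidy : ∀ x → x * x - (0ℤ * x - x) ≡ x * x + x
      tidy = solve-∀

    mpow₃-diag : ∀ i → mpow L 3 i i ≡ d i * (d i * d i + d i) + d i * d i + sumℤ (λ l → A i l * d l) - A³ i i
    mpow₃-diag i = begin
      -- By symmetry of L the last factor can be moved to the front, so only row i of L² enters.
      sumℤ (λ l → mpow L 2 i l * L l i) ≡⟨ sumℤ-cong (λ l → trans (cong (mpow L 2 i l *_) (Lap-sym G l i)) (ℤ.*-comm (mpow L 2 i l) (L i l))) ⟩
      sumℤ (λ l → L i l * mpow L 2 i l) ≡⟨ L·-step (mpow L 2 i) i ⟩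
      d i * mpow L 2 i i - sumℤ (λ l → A i l * mpow L 2 i l) ≡⟨ cong₂ (λ x y → d i * x - y) (mpow₂-diag i) (begin
        sumℤ (λ l → A i l * mpow L 2 i l)
          ≡⟨ sumℤ-cong (λ l → trans (cong (A i l *_) (mpow₂ i l)) (expand (A i l) (d i) (d l) (L i l) (A² i l))) ⟩
        sumℤ (λ l → d i * (A i l * L i l) - ((A i l * A i l) * d l - A² i l * A i l))
          ≡⟨ sumℤ-cong (λ l → cong₂ (λ x y → d i * x - y) (A·L l) (cong₂ (λ x y → x * d l - A² i l * y) (if-square (adj G i l)) (adjMatrix-sym G i l))) ⟩
        sumℤ (λ l → d i * - A i l - (A i l * d l - A² i l * A l i))
          ≡⟨ sumℤ-- (λ l → d i * - A i l) (λ l → A i l * d l - A² i l * A l i) ⟩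
        sumℤ (λ l → d i * - A i l) - sumℤ (λ l → A i l * d l - A² i l * A l i)
          ≡⟨ cong₂ _-_ (trans (sumℤ-* (d i) (λ l → - A i l)) (cong (d i *_) (trans (sumℤ-neg (A i)) (cong -_ (sum-adjMatrix G i)))))
                       (sumℤ-- (λ l → A i l * d l) (λ l → A² i l * A l i)) ⟩
        d i * - d i - (sumℤ (λ l → A i l * d l) - A³ i i) ∎) ⟩
      d i * (d i * d i + d i) - (d i * - d i - (sumℤ (λ l → A i l * d l) - A³ i i))
        ≡⟨ tidy (d i) (sumℤ (λ l → A i l * d l)) (A³ i i) ⟩
      d i * (d i * d i + d i) + d i * d i + sumℤ (λ l → A i l * d l) - A³ i i ∎
      where
      expand : ∀ a d e l s → a * (d * l - (a * e - s)) ≡ d * (a * l) - ((a * a) * e - s * a)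
      expand = solve-∀
      tidy : ∀ d x y → d * (d * d + d) - (d * - d - (x - y)) ≡ d * (d * d + d) + d * d + x - y
      tidy = solve-∀
      A·L : ∀ l → A i l * L i l ≡ - A i l
      A·L l with i ≟ l
      ... | yes refl = trans (cong (_* (1ℤ * d i - A i i)) (A-diag i)) (trans (ℤ.*-zeroˡ (1ℤ * d i - A i i)) (cong -_ (sym (A-diag i))))
      ... | no _     = trans (off (A i l) (d i)) (cong -_ (if-square (adj G i l)))
        where
        off : ∀ a d → a * (0ℤ * d - a) ≡ - (a * a)
        off = solve-∀

  -- tr A³, which is six times the number of triangles.
  closedWalks₃ : ℤ
  closedWalks₃ = sumℤ (λ i → sumℤ (λ l → sumℤ (λ k → A i k * A k l) * A l i))

  degreeInvariant : ℤ
  degreeInvariant = sumℤ (λ i → ψ (d i))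

  -- With S₁, S₂, S₃ the power sums of the degrees, tr L = S₁, tr L² = S₂ + S₁ and tr L³ = S₃ + 3 S₂
  -- - tr A³. Since ψ x = -x³ + 7x² - 14x + 8, the coefficients 10 = 7 + 3 and 24 = 14 + 10 are
  -- forced.
  degreeInvariant-traces : degreeInvariant + closedWalks₃ ≡
    - tr (mpow L 3) + pos 10 * tr (mpow L 2) - pos 24 * tr (mpow L 1) + sumℤ {n} (λ _ → pos 8)
  degreeInvariant-traces = begin
    degreeInvariant + closedWalks₃
      ≡⟨ cong (_+ closedWalks₃) (trans (sumℤ-cong (λ i → polynomial (d i))) (trans (sumℤ-+ (λ i → - cube i + pos 7 * square i - pos 14 * d i) (λ _ → pos 8))
           (cong (_+ c₈) (trans (sumℤ-- (λ i → - cube i + pos 7 * square i) (λ i → pos 14 * d i))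
             (cong₂ _-_ (trans (sumℤ-+ (λ i → - cube i) (λ i → pos 7 * square i)) (cong₂ _+_ (sumℤ-neg cube) (sumℤ-* (pos 7) square)))
                        (sumℤ-* (pos 14) d)))))) ⟩
    - S₃ + pos 7 * S₂ - pos 14 * S₁ + c₈ + closedWalks₃ ≡⟨ combine S₁ S₂ S₃ closedWalks₃ c₈ ⟩
    - (S₃ + S₂ + S₂ + S₂ - closedWalks₃) + pos 10 * (S₂ + S₁) - pos 24 * S₁ + c₈
      ≡⟨ cong₂ (λ x y → - x + pos 10 * y - pos 24 * S₁ + c₈) (sym tr₃) (sym tr₂) ⟩
    - tr (mpow L 3) + pos 10 * tr (mpow L 2) - pos 24 * S₁ + c₈
      ≡⟨ cong (λ x → - tr (mpow L 3) + pos 10 * tr (mpow L 2) - pos 24 * x + c₈) (sym tr₁) ⟩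
    - tr (mpow L 3) + pos 10 * tr (mpow L 2) - pos 24 * tr (mpow L 1) + c₈ ∎
    where
    square cube : Fin n → ℤ
    square i = d i * d i
    cube i = d i * (d i * d i)
    S₁ = sumℤ d
    S₂ = sumℤ square
    S₃ = sumℤ cube
    c₈ = sumℤ {n} (λ _ → pos 8)
    polynomial : ∀ x → (x - 1ℤ) * (x - pos 2) * (pos 4 - x) ≡ - (x * (x * x)) + pos 7 * (x * x) - pos 14 * x + pos 8
    polynomial = solve-∀
    combine : ∀ s₁ s₂ s₃ a c → - s₃ + pos 7 * s₂ - pos 14 * s₁ + c + a ≡
              - (s₃ + s₂ + s₂ + s₂ - a) + pos 10 * (s₂ + s₁) - pos 24 * s₁ + c
    combine = solve-∀
    tr₁ : tr (mpow L 1) ≡ S₁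
    tr₁ = sumℤ-cong (λ i → trans (mpow₁ i i) (L-diag i))
    tr₂ : tr (mpow L 2) ≡ S₂ + S₁
    tr₂ = trans (sumℤ-cong mpow₂-diag) (sumℤ-+ square d)
    neighbour-degrees : sumℤ (λ i → sumℤ (λ l → A i l * d l)) ≡ S₂
    neighbour-degrees = trans (sumℤ-swap (λ i l → A i l * d l)) (sumℤ-cong (λ l → trans (sumℤ-*ʳ (λ i → A i l) (d l))
      (cong (_* d l) (trans (sumℤ-cong (λ i → adjMatrix-sym G i l)) (sum-adjMatrix G l)))))
    tr₃ : tr (mpow L 3) ≡ S₃ + S₂ + S₂ + S₂ - closedWalks₃
    tr₃ = begin
      tr (mpow L 3) ≡⟨ sumℤ-cong (λ i → trans (mpow₃-diag i) (regroup (d i) (sumℤ (λ l → A i l * d l)) (A³ i i))) ⟩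
      sumℤ (λ i → cube i + square i + square i + sumℤ (λ l → A i l * d l) - A³ i i)
        ≡⟨ trans (sumℤ-- (λ i → cube i + square i + square i + sumℤ (λ l → A i l * d l)) (λ i → A³ i i))
             (cong (_- closedWalks₃) (trans (sumℤ-+ (λ i → cube i + square i + square i) (λ i → sumℤ (λ l → A i l * d l)))
               (cong₂ _+_ (trans (sumℤ-+ (λ i → cube i + square i) square) (cong (_+ S₂) (sumℤ-+ cube square))) neighbour-degrees))) ⟩
      S₃ + S₂ + S₂ + S₂ - closedWalks₃ ∎
      where
      regroup : ∀ d x y → d * (d * d + d) + d * d + x - y ≡ d * (d * d) + d * d + d * d + x - y
      regroup = solve-∀

  closedWalks₃-bipartite : Bipartite G → closedWalks₃ ≡ 0ℤ
  closedWalks₃-bipartite (s , h) = sumℤ-all-zero (λ i → sumℤ-all-zero (λ l →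
    trans (sym (sumℤ-*ʳ (λ k → A i k * A k l) (A l i))) (sumℤ-all-zero (λ k → no-triangle i k l))))
    where
    odd-cycle : ∀ a b c → a ≡ not b → b ≡ not c → c ≡ not a → ⊥
    odd-cycle true  false true  _ _ ()
    odd-cycle false true  false _ _ ()
    no-triangle : ∀ i k l → A i k * A k l * A l i ≡ 0ℤ
    no-triangle i k l with adj G i k in e₁ | adj G k l in e₂ | adj G l i in e₃
    ... | false | _     | _     = refl
    ... | true  | false | _     = refl
    ... | true  | true  | false = refl
    ... | true  | true  | true  = ⊥-elim (odd-cycle (s i) (s k) (s l) (h i k e₁) (h k l e₂) (h l i e₃))

  closedWalks₃-≥0 : 0ℤ ℤ.≤ closedWalks₃
  closedWalks₃-≥0 = sumℤ-≥0 (λ i → sumℤ-≥0 (λ l → *-≥0 (sumℤ-≥0 (λ k → *-≥0 (A-≥0 i k) (A-≥0 k l))) (A-≥0 l i)))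
    where
    A-≥0 : ∀ i j → 0ℤ ℤ.≤ A i j
    A-≥0 i j with adj G i j
    ... | true  = ℤ.+≤+ ℕ.z≤n
    ... | false = ℤ.+≤+ ℕ.z≤n
    *-≥0 : ∀ {a b} → 0ℤ ℤ.≤ a → 0ℤ ℤ.≤ b → 0ℤ ℤ.≤ a * b
    *-≥0 {pos a} {pos b} (ℤ.+≤+ _) (ℤ.+≤+ _) = subst (0ℤ ℤ.≤_) (ℤ.pos-* a b) (ℤ.+≤+ ℕ.z≤n)
    sumℤ-≥0 : ∀ {m} {f : Fin m → ℤ} → (∀ i → 0ℤ ℤ.≤ f i) → 0ℤ ℤ.≤ sumℤ f
    sumℤ-≥0 {zero}  h = ℤ.≤-refl
    sumℤ-≥0 {suc m} h = ℤ.+-mono-≤ (h zero) (sumℤ-≥0 (h ∘ suc))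

sumDeg-unique : ∀ {n} (G H : Graph (suc n)) → (∀ y → chiL G y ≡ chiL H y) → sumDeg G ≡ sumDeg H
sumDeg-unique G H e = ℤ.+-injective (trans (sym (trace G)) (trans
  (tr-mpow-unique G H (λ y → trans (sym (chiL-Lap G y)) (trans (e y) (chiL-Lap H y))) 1) (trace H)))
  where
  tidy : ∀ a → 1ℤ * a - 0ℤ ≡ a
  tidy = solve-∀
  trace : ∀ {n} (G : Graph n) → tr (mpow (Lap G) 1) ≡ pos (sumDeg G)
  trace G = trans (sumℤ-cong (λ i → trans (sumℤ-δ i (λ l → Lap G l i))
    (trans (cong₂ (λ x b → x * pos (degree G i) - (if b then 1ℤ else 0ℤ)) (δ-refl i) (adj-irrefl G i)) (tidy (pos (degree G i))))))
    (sumℤ-pos (degree G))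

-- The spectrum determines the sum of the invariant and tr A³, which is 0 for the bipartite G and
-- non-negative for H.
degreeInvariant-mono : ∀ {n} (G H : Graph (suc n)) → Bipartite G → (∀ y → chiL G y ≡ chiL H y) →
                       degreeInvariant H ℤ.≤ degreeInvariant G
degreeInvariant-mono {n} G H bip e = ℤ.≤-trans (subst (ℤ._≤ degreeInvariant H + closedWalks₃ H) (ℤ.+-identityʳ (degreeInvariant H))
  (ℤ.+-monoʳ-≤ (degreeInvariant H) (closedWalks₃-≥0 H)))
  (ℤ.≤-reflexive (begin
    degreeInvariant H + closedWalks₃ H ≡⟨ degreeInvariant-traces H ⟩
    F (tr (mpow (Lap H) 3)) (tr (mpow (Lap H) 2)) (tr (mpow (Lap H) 1))
      ≡⟨ cong₂ (λ x y → F x y (tr (mpow (Lap H) 1))) (same 3) (same 2) ⟨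
    F (tr (mpow (Lap G) 3)) (tr (mpow (Lap G) 2)) (tr (mpow (Lap H) 1))
      ≡⟨ cong (F (tr (mpow (Lap G) 3)) (tr (mpow (Lap G) 2))) (same 1) ⟨
    F (tr (mpow (Lap G) 3)) (tr (mpow (Lap G) 2)) (tr (mpow (Lap G) 1)) ≡⟨ degreeInvariant-traces G ⟨
    degreeInvariant G + closedWalks₃ G ≡⟨ cong (degreeInvariant G +_) (closedWalks₃-bipartite G bip) ⟩
    degreeInvariant G + 0ℤ ≡⟨ ℤ.+-identityʳ (degreeInvariant G) ⟩
    degreeInvariant G ∎))
  where
  F : ℤ → ℤ → ℤ → ℤ
  F x y z = - x + pos 10 * y - pos 24 * z + sumℤ {suc n} (λ _ → pos 8)
  same : ∀ k → tr (mpow (Lap G) k) ≡ tr (mpow (Lap H) k)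
  same = tr-mpow-unique G H (λ y → trans (sym (chiL-Lap G y)) (trans (e y) (chiL-Lap H y)))

degreeInvariant-⊔ : ∀ {n m} (G : Graph n) (H : Graph m) → degreeInvariant (G ⊔ H) ≡ degreeInvariant G + degreeInvariant H
degreeInvariant-⊔ {n} G H = trans (sumℤ-++ n (λ i → ψ (pos (degree (G ⊔ H) i))))
  (cong₂ _+_ (sumℤ-cong (λ i → cong (λ k → ψ (pos k)) (degree-ˡ G H i))) (sumℤ-cong (λ i → cong (λ k → ψ (pos k)) (degree-ʳ G H i))))

degreeInvariant-K2 : ∀ r → degreeInvariant (union (replicate r K2ᶜ)) ≡ 0ℤ
degreeInvariant-K2 zero    = refl
degreeInvariant-K2 (suc r) = trans (degreeInvariant-⊔ K2 (union (replicate r K2ᶜ))) (trans (ℤ.+-identityˡ (degreeInvariant (union (replicate r K2ᶜ)))) (degreeInvariant-K2 r))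

-- Bounds for the degree invariant of trees

b2ℕ≡0 : ∀ {b} → b2ℕ b ≡ 0 → b ≡ false
b2ℕ≡0 {false} _ = refl

b2ℕ≡1 : ∀ {b} → b2ℕ b ≡ 1 → b ≡ true
b2ℕ≡1 {true} _ = refl

b2ℕ≤1 : ∀ b → b2ℕ b ℕ.≤ 1
b2ℕ≤1 true  = ℕ.≤-refl
b2ℕ≤1 false = ℕ.z≤n

conn-degree-≥1 : ∀ {m} (G : Graph (suc (suc m))) → Conn G → ∀ i → 1 ℕ.≤ degree G i
conn-degree-≥1 {m} G conn i with degree G i in d≡
... | suc _ = ℕ.s≤s ℕ.z≤n
... | zero  = ⊥-elim (isolated-cut (conn S closed i (punchIn i zero)))
  where
  S : Fin (suc (suc m)) → Bool
  S v = does (i ≟ v)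
  isolated : ∀ v → adj G i v ≡ false
  isolated v = b2ℕ≡0 (sumℕ≡0⇒all≡0 (λ j → b2ℕ (adj G i j)) d≡ v)
  closed : Closed G S
  closed u v e with i ≟ u | i ≟ v
  ... | yes refl | _        = case trans (sym e) (isolated v) of λ ()
  ... | no _     | yes refl = case trans (sym e) (trans (adj-sym G u v) (isolated u)) of λ ()
  ... | no _     | no _     = refl
  isolated-cut : S i ≡ S (punchIn i zero) → ⊥
  isolated-cut e = case trans (sym (dec-true (i ≟ i) refl)) (trans e (dec-false (i ≟ punchIn i zero) (Fin.punchInᵢ≢i i zero ∘ sym))) of λ ()

sumℤ-mono : ∀ {n} {f g : Fin n → ℤ} → (∀ i → f i ℤ.≤ g i) → sumℤ f ℤ.≤ sumℤ g
sumℤ-mono {zero}  h = ℤ.≤-refl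
sumℤ-mono {suc n} h = ℤ.+-mono-≤ (h zero) (sumℤ-mono (h ∘ suc))

square-pos : ∀ x → ∃ λ k → x * x ≡ pos k
square-pos (pos a)    = a ℕ.* a , sym (ℤ.pos-* a a)
square-pos ℤ.-[1+ a ] = suc a ℕ.* suc a , refl

-- The difference of the two sides is e (e - 2)². The 7 of the name is what this bound yields for a
-- tree on nine vertices.
ψ-at-most-7 : ∀ e → ψ (pos (suc e)) ℤ.≤ pos e
ψ-at-most-7 e with square-pos (pos e - pos 2)
... | k , sq = subst (ψ (pos (suc e)) ℤ.≤_) total≡ (ℤ.i≤i+j (ψ (pos (suc e))) (pos (e ℕ.* k)))
  where
  identity : ∀ x → ((1ℤ + x) - 1ℤ) * ((1ℤ + x) - pos 2) * (pos 4 - (1ℤ + x)) + x * ((x - pos 2) * (x - pos 2)) ≡ x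
  identity = solve-∀
  total≡ : ψ (pos (suc e)) + pos (e ℕ.* k) ≡ pos e
  total≡ = trans (cong (ψ (pos (suc e)) +_) (trans (ℤ.pos-* e k) (cong (pos e *_) (sym sq)))) (identity (pos e))

-- The bound by degree - 1, summed over all vertices, leaves 2(m + 1) - (m + 2) = m.
tree-degreeInvariant : ∀ {m} (G : Graph (suc (suc m))) → Conn G → sumDeg G ≡ 2 ℕ.* suc m → degreeInvariant G ℤ.≤ pos m
tree-degreeInvariant {m} G conn tree = ℤ.≤-trans (sumℤ-mono (λ i → subst (λ k → ψ (pos k) ℤ.≤ pos (ℕ.pred (degree G i))) (pred-suc i) (ψ-at-most-7 (ℕ.pred (degree G i)))))
  (ℤ.≤-reflexive (trans (sumℤ-pos (λ i → ℕ.pred (degree G i))) (cong pos excess)))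
  where
  pred-suc : ∀ i → suc (ℕ.pred (degree G i)) ≡ degree G i
  pred-suc i = ℕ.suc-pred (degree G i) {{ℕ.>-nonZero (conn-degree-≥1 G conn i)}}
  excess : sumℕ (λ i → ℕ.pred (degree G i)) ≡ m
  excess = ℕ.+-cancelˡ-≡ (suc (suc m)) _ _ (begin
    suc (suc m) ℕ.+ sumℕ (λ i → ℕ.pred (degree G i)) ≡⟨ cong (ℕ._+ sumℕ (λ i → ℕ.pred (degree G i))) (sumℕ-ones (suc (suc m))) ⟨
    sumℕ {suc (suc m)} (λ _ → 1) ℕ.+ sumℕ (λ i → ℕ.pred (degree G i)) ≡⟨ sumℕ-+ (λ _ → 1) (λ i → ℕ.pred (degree G i)) ⟨
    sumℕ (λ i → suc (ℕ.pred (degree G i))) ≡⟨ sumℕ-cong pred-suc ⟩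
    sumDeg G ≡⟨ tree ⟩
    2 ℕ.* suc m ≡⟨ rearrange m ⟩
    suc (suc m) ℕ.+ m ∎)
    where
    rearrange : ∀ m → 2 ℕ.* suc m ≡ suc (suc m) ℕ.+ m
    rearrange = ℕ-solve-∀

sumℕ-tight : ∀ {n} (f g : Fin n → ℕ) → (∀ i → f i ℕ.≤ g i) → sumℕ g ℕ.≤ sumℕ f → ∀ i → f i ≡ g i
sumℕ-tight {suc n} f g h e zero = ℕ.≤-antisym (h zero)
  (ℕ.+-cancelʳ-≤ (sumℕ (f ∘ suc)) (g zero) (f zero) (ℕ.≤-trans (ℕ.+-monoʳ-≤ (g zero) (sumℕ-mono (h ∘ suc))) e))
sumℕ-tight {suc n} f g h e (suc i) = sumℕ-tight (f ∘ suc) (g ∘ suc) (h ∘ suc)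
  (ℕ.+-cancelˡ-≤ (f zero) (sumℕ (g ∘ suc)) (sumℕ (f ∘ suc)) (ℕ.≤-trans (ℕ.+-monoˡ-≤ (sumℕ (g ∘ suc)) (h zero)) e)) i

-- The only tree on six vertices with a vertex of degree 5, where ψ is negative.
star₆ : Graph 6
star₆ = record { adj = a ; sym = s ; irrefl = λ { zero → refl ; (suc _) → refl } }
  where
  a : Fin 6 → Fin 6 → Bool
  a zero    zero    = false
  a zero    (suc _) = true
  a (suc _) zero    = true
  a (suc _) (suc _) = false
  s : ∀ i j → a i j ≡ a j i
  s zero    zero    = refl
  s zero    (suc _) = refl
  s (suc _) zero    = refl
  s (suc _) (suc _) = refl

-- The Laplacian eigenvalues of this star are 0, 1 and 6; the determinant at -2 evaluates to -8.
star₆-not-root : ¬ Root (5 , star₆)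
star₆-not-root root = case trans (sym (chiL-def star₆ -2ℤ)) root of λ ()

degree-≤ : ∀ {n} (G : Graph (suc n)) i → degree G i ℕ.≤ n
degree-≤ {n} G i = ℕ.≤-trans (ℕ.≤-reflexive (trans (sumℕ-punchIn i (λ j → b2ℕ (adj G i j))) (cong (ℕ._+ rest) (cong b2ℕ (adj-irrefl G i)))))
  (ℕ.≤-trans (sumℕ-mono (λ a → b2ℕ≤1 (adj G i (punchIn i a)))) (ℕ.≤-reflexive (sumℕ-ones n)))
  where rest = sumℕ (λ a → b2ℕ (adj G i (punchIn i a)))

star-centre-zero : (G : Graph 6) → sumDeg G ≡ 10 → degree G zero ≡ 5 → G ≅ star₆
star-centre-zero G edges centre = record { bij = ↔-refl ; pres = same }
  where
  row₀ : ∀ j → adj G zero (suc j) ≡ true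
  row₀ j = b2ℕ≡1 (sumℕ-tight (λ j → b2ℕ (adj G zero (suc j))) (λ _ → 1) (λ j → b2ℕ≤1 (adj G zero (suc j)))
    (ℕ.≤-reflexive (trans (sym centre) (cong (λ x → b2ℕ x ℕ.+ sumℕ (λ j → b2ℕ (adj G zero (suc j)))) (adj-irrefl G zero)))) j)
  col₀ : ∀ i → adj G (suc i) zero ≡ true
  col₀ i = trans (adj-sym G (suc i) zero) (row₀ i)
  others : Fin 5 → ℕ
  others i = sumℕ (λ j → b2ℕ (adj G (suc i) (suc j)))
  degree-suc : ∀ i → degree G (suc i) ≡ suc (others i)
  degree-suc i = cong (λ x → b2ℕ x ℕ.+ others i) (col₀ i)
  -- The other five vertices share the remaining degree sum 5 and each is adjacent to the centre, so
  -- all of them are leaves.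
  leaf : ∀ i → 1 ≡ suc (others i)
  leaf = sumℕ-tight (λ _ → 1) (λ i → suc (others i)) (λ _ → ℕ.s≤s ℕ.z≤n) (ℕ.≤-reflexive
    (ℕ.+-cancelˡ-≡ 5 _ _ (trans (cong₂ ℕ._+_ (sym centre) (sumℕ-cong (λ i → sym (degree-suc i)))) edges)))
  same : ∀ i j → adj star₆ i j ≡ adj G i j
  same zero    zero    = sym (adj-irrefl G zero)
  same zero    (suc j) = sym (row₀ j)
  same (suc i) zero    = sym (col₀ i)
  same (suc i) (suc j) = sym (b2ℕ≡0 (sumℕ≡0⇒all≡0 (λ j → b2ℕ (adj G (suc i) (suc j))) (sym (ℕ.suc-injective (leaf i))) j))

pullback-≅ : ∀ {n} (G : Graph n) (π : Perm.Permutation′ n) → pullback G (π Perm.⟨$⟩ʳ_) ≅ G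
pullback-≅ G π = record { bij = π ; pres = λ _ _ → refl }

star-≅ : (G : Graph 6) → sumDeg G ≡ 10 → ∀ z → degree G z ≡ 5 → G ≅ star₆
star-≅ G edges z centre = ≅-trans (≅-sym G′≅G) (star-centre-zero G′
    (trans (sumℕ-cong (λ i → sym (degree-≅ G′≅G i))) (trans (sumℕ-permute π (degree G)) edges))
    (trans (sym (degree-≅ G′≅G zero)) centre))
  where
  π = Perm.transpose zero z
  G′ = pullback G (π Perm.⟨$⟩ʳ_)
  G′≅G : G′ ≅ G
  G′≅G = pullback-≅ G π

-- On six vertices ψ can be negative only at degree 5, which forces the star, and the star has no
-- root at -2.
root-degreeInvariant : (G : Graph 6) → sumDeg G ≡ 10 → Root (5 , G) → 0ℤ ℤ.≤ degreeInvariant G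
root-degreeInvariant G edges root =
  ℤ.≤-trans (ℤ.≤-reflexive (sym (sumℤ-zero 6))) (sumℤ-mono (λ i → ψ-≥0 (degree G i) (degree-≤ G i) (not-star i)))
  where
  not-star : ∀ i → degree G i ≢ 5
  not-star i centre = star₆-not-root (trans (sym (chiL-≅ (star-≅ G edges i centre) -2ℤ)) root)
  ψ-≥0 : ∀ k → k ℕ.≤ 5 → k ≢ 5 → 0ℤ ℤ.≤ ψ (pos k)
  ψ-≥0 0 _ _ = ℤ.+≤+ ℕ.z≤n
  ψ-≥0 1 _ _ = ℤ.+≤+ ℕ.z≤n
  ψ-≥0 2 _ _ = ℤ.+≤+ ℕ.z≤n
  ψ-≥0 3 _ _ = ℤ.+≤+ ℕ.z≤n
  ψ-≥0 4 _ _ = ℤ.+≤+ ℕ.z≤n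
  ψ-≥0 5 _ k≢5 = ⊥-elim (k≢5 refl)
  ψ-≥0 (suc (suc (suc (suc (suc (suc k)))))) (ℕ.s≤s (ℕ.s≤s (ℕ.s≤s (ℕ.s≤s (ℕ.s≤s ()))))) _

bipartite-⊔ : ∀ {n m} {G : Graph n} {H : Graph m} → Bipartite G → Bipartite H → Bipartite (G ⊔ H)
bipartite-⊔ {n} {m} {G} {H} (s , p) (t , q) = (λ i → colour (splitAt n i)) , λ i j → proper (splitAt n i) (splitAt n j)
  where
  colour : Fin n ⊎ Fin m → Bool
  colour (inj₁ x) = s x
  colour (inj₂ y) = t y
  proper : ∀ x y → sumAdj G H x y ≡ true → colour x ≡ not (colour y)
  proper (inj₁ x) (inj₁ y) = p x y
  proper (inj₂ x) (inj₂ y) = q x y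
  proper (inj₁ x) (inj₂ y) ()
  proper (inj₂ x) (inj₁ y) ()

bipartite-union : ∀ {Cs} → All (Bipartite ∘ proj₂) Cs → Bipartite (union Cs)
bipartite-union [] = (λ ()) , λ ()
bipartite-union {(_ , C) ∷ Cs} (p ∷ ps) = bipartite-⊔ {G = C} {H = union Cs} p (bipartite-union ps)

trees-bipartite : ∀ {Cs} → All Connected Cs → All Tree Cs → All (Bipartite ∘ proj₂) Cs
trees-bipartite [] [] = []
trees-bipartite {(_ , C) ∷ _} (p ∷ ps) (t ∷ ts) = tree-bipartite C p t ∷ trees-bipartite ps ts

degreeInvariant-antitone : ∀ {n m} (G : Graph n) (H : Graph m) → n ≡ m → 1 ℕ.≤ n → Bipartite G →
                           (∀ y → chiL G y ≡ chiL H y) → degreeInvariant H ℤ.≤ degreeInvariant G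
degreeInvariant-antitone {suc n} G H refl _ = degreeInvariant-mono G H

-- Sizes 1, 6, 6 instead of 9, 2, 2: the only other solution of the equations for the sizes.
no-sizes-1-6-6 : (T : Graph 9) (C : Graph 1) (E E′ : Graph 6) (Ks Ls : List Component) →
  Conn T → Tree (8 , T) → Tree (5 , E) → Tree (5 , E′) → Root (5 , E) → Root (5 , E′) →
  Bipartite (union Ks) → degreeInvariant (union Ks) ≡ 0ℤ → degreeInvariant (union Ls) ≡ 0ℤ → total Ks ≡ 4 ℕ.+ total Ls →
  ¬ (∀ y → chiL (T ⊔ union Ks) y ≡ chiL (C ⊔ (E ⊔ (E′ ⊔ union Ls))) y)
no-sizes-1-6-6 T C E E′ Ks Ls conn tree e e′ root root′ bip dK dL sizes≡ same =
  ℤ.<⇒≱ (ℤ.+<+ (ℕ.n<1+n 7)) (ℤ.≤-trans at-least-8 (ℤ.≤-trans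
    (degreeInvariant-antitone (T ⊔ union Ks) (C ⊔ (E ⊔ (E′ ⊔ union Ls))) (cong (9 ℕ.+_) sizes≡) (ℕ.s≤s ℕ.z≤n)
      (bipartite-⊔ {G = T} {H = union Ks} (tree-bipartite T conn tree) bip) same) at-most-7))
  where
  at-most-7 : degreeInvariant (T ⊔ union Ks) ℤ.≤ pos 7
  at-most-7 = subst (ℤ._≤ pos 7) (sym (trans (degreeInvariant-⊔ T (union Ks))
    (trans (cong (degreeInvariant T +_) dK) (ℤ.+-identityʳ (degreeInvariant T))))) (tree-degreeInvariant T conn tree)
  point : degreeInvariant C ≡ pos 8
  point = cong (λ x → ψ (pos (b2ℕ x ℕ.+ 0)) + 0ℤ) (adj-irrefl C zero)
  split-sum : degreeInvariant (C ⊔ (E ⊔ (E′ ⊔ union Ls))) ≡ pos 8 + (degreeInvariant E + (degreeInvariant E′ + 0ℤ))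
  split-sum = trans (degreeInvariant-⊔ C (E ⊔ (E′ ⊔ union Ls))) (cong₂ _+_ point
    (trans (degreeInvariant-⊔ E (E′ ⊔ union Ls)) (cong (degreeInvariant E +_)
      (trans (degreeInvariant-⊔ E′ (union Ls)) (cong (degreeInvariant E′ +_) dL)))))
  at-least-8 : pos 8 ℤ.≤ degreeInvariant (C ⊔ (E ⊔ (E′ ⊔ union Ls)))
  at-least-8 = subst (pos 8 ℤ.≤_) (sym split-sum) (ℤ.+-monoʳ-≤ (pos 8) (ℤ.+-mono-≤ (root-degreeInvariant E e root)
    (ℤ.+-mono-≤ (root-degreeInvariant E′ e′ root′) ℤ.≤-refl)))

-- Component sizes

sizes-↭ : ∀ {Cs Ds} → Cs ↭ Ds → sizes Cs ≡ sizes Ds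
sizes-↭ ↭.refl = refl
sizes-↭ (↭.prep C p) = cong (size C ℕ.*_) (sizes-↭ p)
sizes-↭ (↭.swap {Cs} {Ds} C D p) = trans (swap-heads (size C) (size D) (sizes Cs)) (cong (λ s → size D ℕ.* (size C ℕ.* s)) (sizes-↭ p))
  where
  swap-heads : ∀ a b c → a ℕ.* (b ℕ.* c) ≡ b ℕ.* (a ℕ.* c)
  swap-heads = ℕ-solve-∀
sizes-↭ (↭.trans p q) = trans (sizes-↭ p) (sizes-↭ q)

K2-unique : (C : Graph 2) → Conn C → C ≅ K2
K2-unique C conn = record { bij = ↔-refl ; pres = same }
  where
  edge : adj C zero (suc zero) ≡ true
  edge with adj C zero (suc zero) in e
  ... | true  = refl
  ... | false = case conn S closed zero (suc zero) of λ ()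
    where
    S : Fin 2 → Bool
    S zero    = true
    S (suc _) = false
    closed : Closed C S
    closed zero       zero       _ = refl
    closed zero       (suc zero) p = case trans (sym e) p of λ ()
    closed (suc zero) zero       p = case trans (sym e) (trans (adj-sym C zero (suc zero)) p) of λ ()
    closed (suc zero) (suc zero) _ = refl
  same : ∀ i j → adj K2 i j ≡ adj C i j
  same zero       zero       = sym (adj-irrefl C zero)
  same zero       (suc zero) = sym edge
  same (suc zero) zero       = sym (trans (adj-sym C (suc zero) zero) edge)
  same (suc zero) (suc zero) = sym (adj-irrefl C (suc zero))

RootTree : Component → Set
RootTree C = Connected C × Tree C × Root C

-- Even and at least 4; `s` is the excess of half the size over 2.
Big : Component → Set
Big C = ∃ λ s → size C ≡ 2 ℕ.* (2 ℕ.+ s)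

even-size : ∀ C → Connected C → (∃ λ k → size C ≡ 2 ℕ.* k) → (proj₂ C ≅ K2 × size C ≡ 2) ⊎ Big C
even-size (_ , C) conn (suc zero    , refl) = inj₁ (K2-unique C conn , refl)
even-size (_ , C) conn (suc (suc s) , e)    = inj₂ (s , e)

K2-or-Big : ∀ C → RootTree C → (proj₂ C ≅ K2 × size C ≡ 2) ⊎ Big C
K2-or-Big (n , C) (conn , tree , root) =
  even-size (n , C) conn (tree-root-even C conn tree (trans (sym (chiL-Lap C -2ℤ)) root))

-- Components isomorphic to K₂ are set apart, because they cancel from the equations for the sizes
-- against the copies of K₂ beside T.
record Reduced (Ds : List Component) : Set where
  field
    big      : List Component
    copies   : ℕ
    all-big  : All (λ C → RootTree C × Big C) big
    union≅   : union Ds ≅ union (big ++ replicate copies K2ᶜ)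
    length≡  : length Ds ≡ length big ℕ.+ copies
    sizes≡   : sizes Ds ≡ sizes big ℕ.* 2 ℕ.^ copies
    total≡   : total Ds ≡ total big ℕ.+ 2 ℕ.* copies
open Reduced

reduce-∷ : ∀ C {Ds} → RootTree C → (proj₂ C ≅ K2 × size C ≡ 2) ⊎ Big C → Reduced Ds → Reduced (C ∷ Ds)
reduce-∷ (n , C) p (inj₂ b) R = record
  { big = (n , C) ∷ big R ; copies = copies R ; all-big = (p , b) ∷ all-big R
  ; union≅ = ⊔-congʳ C (union≅ R)
  ; length≡ = cong suc (length≡ R)
  ; sizes≡ = trans (cong (suc n ℕ.*_) (sizes≡ R)) (sym (ℕ.*-assoc (suc n) (sizes (big R)) (2 ℕ.^ copies R)))
  ; total≡ = trans (cong (suc n ℕ.+_) (total≡ R)) (sym (ℕ.+-assoc (suc n) (total (big R)) (2 ℕ.* copies R))) }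
reduce-∷ (_ , C) p (inj₁ (C≅K2 , refl)) R = record
  { big = big R ; copies = suc (copies R) ; all-big = all-big R
  ; union≅ = ≅-trans (⊔-cong C≅K2 (union≅ R)) (union-↭ (↭.↭-sym (shift K2ᶜ (big R) (replicate (copies R) K2ᶜ))))
  ; length≡ = trans (cong suc (length≡ R)) (sym (ℕ.+-suc (length (big R)) (copies R)))
  ; sizes≡ = trans (cong (2 ℕ.*_) (sizes≡ R)) (pull (sizes (big R)) (2 ℕ.^ copies R))
  ; total≡ = trans (cong (2 ℕ.+_) (total≡ R)) (push (total (big R)) (copies R)) }
  where
  pull : ∀ a b → 2 ℕ.* (a ℕ.* b) ≡ a ℕ.* (2 ℕ.* b)
  pull = ℕ-solve-∀
  push : ∀ a c → 2 ℕ.+ (a ℕ.+ 2 ℕ.* c) ≡ a ℕ.+ 2 ℕ.* suc c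
  push = ℕ-solve-∀

reduce : ∀ {Ds} → All RootTree Ds → Reduced Ds
reduce [] = record { big = [] ; copies = 0 ; all-big = [] ; union≅ = ≅-refl ; length≡ = refl ; sizes≡ = refl ; total≡ = refl }
reduce {C ∷ _} (p ∷ ps) = reduce-∷ C p (K2-or-Big C p) (reduce ps)

-- For half sizes h = 2 + s, `Π₂` is the product of the h and `Σ₁` the sum of the h - 1. The - 1
-- accounts for the copy of K₂, of half size 1, whose place a big component takes.
Π₂ : List ℕ → ℕ
Π₂ []       = 1
Π₂ (s ∷ ss) = (2 ℕ.+ s) ℕ.* Π₂ ss

Σ₁ : List ℕ → ℕ
Σ₁ []       = 0
Σ₁ (s ∷ ss) = suc s ℕ.+ Σ₁ ss

-- From three factors on the product dominates. In the base case the difference is written out with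
-- non-negative terms; equality holds for s = t = u = 0.
Π₂-bound : ∀ s t u ss → 2 ℕ.+ 2 ℕ.* Σ₁ (s ∷ t ∷ u ∷ ss) ≤ Π₂ (s ∷ t ∷ u ∷ ss)
Π₂-bound s t u [] = ℕ.≤-trans (ℕ.m≤m+n _ _) (ℕ.≤-reflexive (identity s t u))
  where
  identity : ∀ s t u → (2 ℕ.+ 2 ℕ.* (suc s ℕ.+ (suc t ℕ.+ (suc u ℕ.+ 0)))) ℕ.+
    (2 ℕ.* (s ℕ.+ t ℕ.+ u) ℕ.+ 2 ℕ.* (s ℕ.* t ℕ.+ t ℕ.* u ℕ.+ s ℕ.* u) ℕ.+ s ℕ.* t ℕ.* u) ≡
    (2 ℕ.+ s) ℕ.* ((2 ℕ.+ t) ℕ.* ((2 ℕ.+ u) ℕ.* 1))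
  identity = ℕ-solve-∀
Π₂-bound s t u (v ∷ ss) = ℕ.≤-trans (ℕ.≤-trans (ℕ.≤-reflexive (identity s S)) (ℕ.m≤m+n _ _))
  (ℕ.≤-trans (ℕ.≤-reflexive (expand s S)) (ℕ.*-monoʳ-≤ (2 ℕ.+ s) (Π₂-bound t u v ss)))
  where
  S = Σ₁ (t ∷ u ∷ v ∷ ss)
  identity : ∀ s S → 2 ℕ.+ 2 ℕ.* (suc s ℕ.+ S) ≡ 4 ℕ.+ 2 ℕ.* s ℕ.+ 2 ℕ.* S
  identity = ℕ-solve-∀
  expand : ∀ s S → (4 ℕ.+ 2 ℕ.* s ℕ.+ 2 ℕ.* S) ℕ.+ (2 ℕ.* S ℕ.+ 2 ℕ.* s ℕ.* S) ≡ (2 ℕ.+ s) ℕ.* (2 ℕ.+ 2 ℕ.* S)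
  expand = ℕ-solve-∀

data SizeSolution (m : ℕ) : List ℕ → Set where
  none : SizeSolution m []
  one  : ∀ s → m ≡ 2 → SizeSolution m (s ∷ [])
  two  : m ≡ 1 → SizeSolution m (1 ∷ 1 ∷ [])

-- One big component: cancelling m leaves m (1 + s) = 2 (1 + s). Two of them: for m = 1 the equation
-- becomes s t = 1, that is, half sizes 3 and 3, and for m ≥ 2 the left side is too large. From
-- three on `Π₂-bound` excludes equality.
solve-sizes : ∀ m ss → 1 ≤ m → m ℕ.* Π₂ ss ≡ m ℕ.+ 2 ℕ.* Σ₁ ss → SizeSolution m ss
solve-sizes m [] 1≤m e = none
solve-sizes m (s ∷ []) 1≤m e = one s (ℕ.*-cancelʳ-≡ m 2 (suc s) (ℕ.+-cancelˡ-≡ m _ _ (trans (lhs m s) (trans e (rhs m s)))))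
  where
  lhs : ∀ m s → m ℕ.+ m ℕ.* suc s ≡ m ℕ.* ((2 ℕ.+ s) ℕ.* 1)
  lhs = ℕ-solve-∀
  rhs : ∀ m s → m ℕ.+ 2 ℕ.* (suc s ℕ.+ 0) ≡ m ℕ.+ 2 ℕ.* suc s
  rhs = ℕ-solve-∀
solve-sizes (suc zero) (s ∷ t ∷ []) 1≤m e with ℕ.m*n≡1⇒m≡1 s t product≡1 | ℕ.m*n≡1⇒n≡1 s t product≡1
  where
  lhs : ∀ s t → (4 ℕ.+ 2 ℕ.* s ℕ.+ 2 ℕ.* t) ℕ.+ s ℕ.* t ≡ 1 ℕ.* ((2 ℕ.+ s) ℕ.* ((2 ℕ.+ t) ℕ.* 1))
  lhs = ℕ-solve-∀
  rhs : ∀ s t → 1 ℕ.+ 2 ℕ.* (suc s ℕ.+ (suc t ℕ.+ 0)) ≡ (4 ℕ.+ 2 ℕ.* s ℕ.+ 2 ℕ.* t) ℕ.+ 1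
  rhs = ℕ-solve-∀
  product≡1 : s ℕ.* t ≡ 1
  product≡1 = ℕ.+-cancelˡ-≡ (4 ℕ.+ 2 ℕ.* s ℕ.+ 2 ℕ.* t) _ _ (trans (lhs s t) (trans e (rhs s t)))
... | refl | refl = two refl
solve-sizes (suc (suc m)) (s ∷ t ∷ []) 1≤m e = ⊥-elim (ℕ.m+1+n≢m _ (trans (lhs m s t) e))
  where
  lhs : ∀ m s t → (suc (suc m) ℕ.+ 2 ℕ.* (suc s ℕ.+ (suc t ℕ.+ 0))) ℕ.+
    suc (1 ℕ.+ 2 ℕ.* s ℕ.+ 2 ℕ.* t ℕ.+ 2 ℕ.* (s ℕ.* t) ℕ.+ m ℕ.* (3 ℕ.+ 2 ℕ.* s ℕ.+ 2 ℕ.* t ℕ.+ s ℕ.* t)) ≡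
    suc (suc m) ℕ.* ((2 ℕ.+ s) ℕ.* ((2 ℕ.+ t) ℕ.* 1))
  lhs = ℕ-solve-∀
solve-sizes (suc m) (s ∷ t ∷ u ∷ ss) 1≤m e = ⊥-elim (ℕ.m+1+n≰m _ (ℕ.≤-trans (ℕ.≤-reflexive (lhs m S))
    (ℕ.≤-trans (ℕ.*-monoʳ-≤ (suc m) (Π₂-bound s t u ss)) (ℕ.≤-reflexive e))))
  where
  S = Σ₁ (s ∷ t ∷ u ∷ ss)
  lhs : ∀ m S → (suc m ℕ.+ 2 ℕ.* S) ℕ.+ suc (m ℕ.+ 2 ℕ.* m ℕ.* S) ≡ suc m ℕ.* (2 ℕ.+ 2 ℕ.* S)
  lhs = ℕ-solve-∀

halves : ∀ {Es} → All (λ C → RootTree C × Big C) Es → List ℕ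
halves []                  = []
halves ((_ , (s , _)) ∷ bs) = s ∷ halves bs

sizes-halves : ∀ {Es} (bs : All (λ C → RootTree C × Big C) Es) → sizes Es ≡ Π₂ (halves bs) ℕ.* 2 ℕ.^ length Es
sizes-halves [] = refl
sizes-halves {E ∷ Es} ((_ , (s , e)) ∷ bs) = trans (cong₂ ℕ._*_ e (sizes-halves bs)) (rearrange (2 ℕ.+ s) (Π₂ (halves bs)) (2 ℕ.^ length Es))
  where
  rearrange : ∀ a b c → (2 ℕ.* a) ℕ.* (b ℕ.* c) ≡ (a ℕ.* b) ℕ.* (2 ℕ.* c)
  rearrange = ℕ-solve-∀

total-halves : ∀ {Es} (bs : All (λ C → RootTree C × Big C) Es) → total Es ≡ 2 ℕ.* Σ₁ (halves bs) ℕ.+ 2 ℕ.* length Es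
total-halves [] = refl
total-halves {E ∷ Es} ((_ , (s , e)) ∷ bs) = trans (cong₂ ℕ._+_ e (total-halves bs)) (rearrange s (Σ₁ (halves bs)) (length Es))
  where
  rearrange : ∀ s S l → 2 ℕ.* (2 ℕ.+ s) ℕ.+ (2 ℕ.* S ℕ.+ 2 ℕ.* l) ≡ 2 ℕ.* (suc s ℕ.+ S) ℕ.+ 2 ℕ.* suc l
  rearrange = ℕ-solve-∀

-- Cancelling common factors, and translation to cospectrality

chi-eventually : ∀ {n} (M N : Matrix n) → (∀ y → chi M (pos (suc y)) ≡ chi N (pos (suc y))) → ∀ a → chi M a ≡ chi N a
chi-eventually M N e a = -‿≡0 (difference (D ℤ.≟ 0ℤ))
  where
  D = chi M a - chi N a
  -- The values at a and a + h are congruent modulo h, so `D` is a multiple of h. This h makes a + h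
  -- positive, where the values agree, and exceeds |D|.
  h = pos (suc (ℤ.∣ a ∣ ℕ.+ ℤ.∣ D ∣))
  qM = proj₁ (expansion (chi-Lead₀ M a) h)
  qN = proj₁ (expansion (chi-Lead₀ N a) h)
  far : ∀ a d → ∃ λ y → a + pos (suc (ℤ.∣ a ∣ ℕ.+ d)) ≡ pos (suc y)
  far (pos x)    d = x ℕ.+ (x ℕ.+ d) , cong pos (ℕ.+-suc x (x ℕ.+ d))
  far ℤ.-[1+ x ] d = d , trans (cong (λ k → ℤ.-[1+ x ] + pos k) (sym (ℕ.+-suc (suc x) d))) (cancel (pos (suc x)) (pos (suc d)))
    where
    cancel : ∀ p q → - p + (p + q) ≡ q
    cancel = solve-∀
  same : 1ℤ * (chi M a + h * qM) ≡ 1ℤ * (chi N a + h * qN)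
  same = begin
    1ℤ * (chi M a + h * qM) ≡⟨ proj₂ (expansion (chi-Lead₀ M a) h) ⟨
    chi M (a + h)           ≡⟨ cong (chi M) (proj₂ (far a ℤ.∣ D ∣)) ⟩
    chi M (pos (suc (proj₁ (far a ℤ.∣ D ∣)))) ≡⟨ e (proj₁ (far a ℤ.∣ D ∣)) ⟩
    chi N (pos (suc (proj₁ (far a ℤ.∣ D ∣)))) ≡⟨ cong (chi N) (proj₂ (far a ℤ.∣ D ∣)) ⟨
    chi N (a + h)           ≡⟨ proj₂ (expansion (chi-Lead₀ N a) h) ⟩
    1ℤ * (chi N a + h * qN) ∎
  D≡ : D ≡ h * (qN - qM)
  D≡ = begin
    chi M a - chi N a ≡⟨ widen (chi M a) (chi N a) h qM qN ⟩
    1ℤ * (chi M a + h * qM) - 1ℤ * (chi N a + h * qN) + h * (qN - qM) ≡⟨ cong (λ z → z - 1ℤ * (chi N a + h * qN) + h * (qN - qM)) same ⟩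
    1ℤ * (chi N a + h * qN) - 1ℤ * (chi N a + h * qN) + h * (qN - qM) ≡⟨ collapse (1ℤ * (chi N a + h * qN)) (h * (qN - qM)) ⟩
    h * (qN - qM) ∎
    where
    widen : ∀ x y h q r → x - y ≡ 1ℤ * (x + h * q) - 1ℤ * (y + h * r) + h * (r - q)
    widen = solve-∀
    collapse : ∀ x y → x - x + y ≡ y
    collapse = solve-∀
  difference : Dec (D ≡ 0ℤ) → D ≡ 0ℤ
  difference (yes D≡0) = D≡0
  difference (no D≢0) = ⊥-elim (ℕ.<⇒≱ (ℕ.s≤s (ℕ.m≤n+m ℤ.∣ D ∣ ℤ.∣ a ∣)) (ℕ.≤-trans
      (ℕ.m≤m*n (suc (ℤ.∣ a ∣ ℕ.+ ℤ.∣ D ∣)) ℤ.∣ qN - qM ∣ {{ℕ.≢-nonZero q≢0}})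
      (ℕ.≤-reflexive (sym (trans (cong ℤ.∣_∣ D≡) (ℤ.abs-* h (qN - qM)))))))
    where
    q≢0 : ℤ.∣ qN - qM ∣ ≢ 0
    q≢0 q≡0 = D≢0 (trans D≡ (trans (cong (h *_) (ℤ.∣i∣≡0⇒i≡0 q≡0)) (ℤ.*-zeroʳ h)))

chiL-nonzero : ∀ {n} (G : Graph n) y → chiL G (pos (suc y)) ≢ 0ℤ
chiL-nonzero {n} G y e = ℕ.<⇒≢ (ℕ.≤-trans (ℕ.m^n>0 (suc y) n) (weighted-≥ G (λ _ → suc y) (suc y) (λ _ → ℕ.≤-refl)))
  (sym (ℤ.+-injective (trans (sym (chi-Lap-weighted G (suc y))) (trans (sym (chiL-Lap G (pos (suc y)))) e))))

chiL-eventually : ∀ {n} (G H : Graph n) → (∀ y → chiL G (pos (suc y)) ≡ chiL H (pos (suc y))) → ∀ y → chiL G y ≡ chiL H y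
chiL-eventually G H e y = trans (chiL-def G y) (trans (chi-eventually (SLap -1ℤ G) (SLap -1ℤ H)
  (λ y → trans (sym (chiL-def G (pos (suc y)))) (trans (e y) (chiL-def H (pos (suc y))))) y) (sym (chiL-def H y)))

-- At positive arguments the factor of K is non-zero and can be divided out; equality there extends
-- to all integers.
chiL-cancel : ∀ {n m} (G H : Graph n) (K : Graph m) → (∀ y → chiL (G ⊔ K) y ≡ chiL (H ⊔ K) y) → ∀ y → chiL G y ≡ chiL H y
chiL-cancel G H K e = chiL-eventually G H (λ y → *-cancelˡ (chiL-nonzero K y) (begin
  chiL K (pos (suc y)) * chiL G (pos (suc y)) ≡⟨ ℤ.*-comm (chiL K (pos (suc y))) (chiL G (pos (suc y))) ⟩
  chiL G (pos (suc y)) * chiL K (pos (suc y)) ≡⟨ chiL-⊔ G K (pos (suc y)) ⟨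
  chiL (G ⊔ K) (pos (suc y))                  ≡⟨ e (pos (suc y)) ⟩
  chiL (H ⊔ K) (pos (suc y))                  ≡⟨ chiL-⊔ H K (pos (suc y)) ⟩
  chiL H (pos (suc y)) * chiL K (pos (suc y)) ≡⟨ ℤ.*-comm (chiL H (pos (suc y))) (chiL K (pos (suc y))) ⟩
  chiL K (pos (suc y)) * chiL H (pos (suc y)) ∎))

chiL-laplacian : ∀ {n} (G : Graph n) y → chiL G y ≡ chi (laplacian G) y
chiL-laplacian G y = trans (chiL-Lap G y) (sym (chi-cong (laplacian-Lap G) y))

chiL⇒LCospectral : ∀ {n} (G H : Graph n) → (∀ y → chiL G y ≡ chiL H y) → LCospectral G H
chiL⇒LCospectral G H e = refl , chi⇒charPoly (laplacian G) (laplacian H) (λ y →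
  trans (sym (chiL-laplacian G y)) (trans (e y) (chiL-laplacian H y)))

LCospectral⇒chiL : ∀ {n} (G H : Graph n) → LCospectral G H → ∀ y → chiL G y ≡ chiL H y
LCospectral⇒chiL G H (_ , e) y =
  trans (chiL-laplacian G y) (trans (charPoly⇒chi (laplacian G) (laplacian H) e y) (sym (chiL-laplacian H y)))

no-sizes-1-6-6′ : ∀ {n c} (T : Graph (suc n)) (C : Graph (suc c)) (E E′ : Component) (Ks Ls : List Component) →
  suc n ≡ 9 → suc c ≡ 1 → size E ≡ 6 → size E′ ≡ 6 → Conn T → Tree (n , T) → RootTree E → RootTree E′ →
  Bipartite (union Ks) → degreeInvariant (union Ks) ≡ 0ℤ → degreeInvariant (union Ls) ≡ 0ℤ → total Ks ≡ 4 ℕ.+ total Ls →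
  ¬ (∀ y → chiL (T ⊔ union Ks) y ≡ chiL (C ⊔ (proj₂ E ⊔ (proj₂ E′ ⊔ union Ls))) y)
no-sizes-1-6-6′ T C (_ , E) (_ , E′) Ks Ls refl refl refl refl conn tree (_ , t , r) (_ , t′ , r′) =
  no-sizes-1-6-6 T C E E′ Ks Ls conn tree t t′ r r′

K2s-bipartite : ∀ r → Bipartite (union (replicate r K2ᶜ))
K2s-bipartite r = bipartite-union (trees-bipartite (replicate-all K2-Conn r) (replicate-all refl r))

size-2-K2 : ∀ C → Connected C → size C ≡ 2 → proj₂ C ≅ K2
size-2-K2 (_ , C) conn refl = K2-unique C conn

-- Uniqueness for the Laplacian spectrum

module _ {n} (T : Graph (suc n)) (isTree : IsTree T) (dls : DLS T) where

  private
    conn = isTree-Conn isTree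
    tree = isTree-Tree isTree

    Ts : ℕ → List Component
    Ts r = (n , T) ∷ replicate r K2ᶜ

    Ts-≅ : ∀ r → (T ⊔ rK2 r) ≅ union (Ts r)
    Ts-≅ r = ⊔-congʳ T (rK2-union r)

    Ts-Conn : ∀ r → All Connected (Ts r)
    Ts-Conn r = conn ∷ replicate-all K2-Conn r

    Ts-Tree : ∀ r → All Tree (Ts r)
    Ts-Tree r = tree ∷ replicate-all refl r

    same-size : ∀ r {c} (C : Graph (suc c)) → suc c ≡ suc n →
                (∀ y → chiL (union (Ts r)) y ≡ chiL (C ⊔ union (replicate r K2ᶜ)) y) → (T ⊔ rK2 r) ≅ (C ⊔ union (replicate r K2ᶜ))
    same-size r C refl e = ⊔-cong (dls C (chiL⇒LCospectral T C (chiL-cancel T C (union (replicate r K2ᶜ)) e))) (rK2-union r)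

    -- Without big components, C has the order of T. With one, the equations make C a copy of K₂ and
    -- give E the order of T, so the two exchange roles. In either case `dls` applies after the
    -- copies of K₂ are cancelled.
    rearrange-components : ∀ r k C {Es} (bs : All (λ C → RootTree C × Big C) Es) → Connected C → r ≡ length Es ℕ.+ k →
      SizeSolution (size C) (halves bs) → size C ℕ.* Π₂ (halves bs) ≡ suc n →
      (∀ y → chiL (union (Ts r)) y ≡ chiL (proj₂ C ⊔ union (Es ++ replicate k K2ᶜ)) y) →
      (T ⊔ rK2 r) ≅ (proj₂ C ⊔ union (Es ++ replicate k K2ᶜ))
    rearrange-components r k (c , C) [] conn-C refl none siz e = same-size r C (trans (sym (ℕ.*-identityʳ (suc c))) siz) e
    rearrange-components r k (c , C) {(d , E) ∷ []} ((_ , (s , sizeE)) ∷ []) conn-C refl (one _ m≡2) siz e =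
      ≅-trans (same-size r E (trans sizeE (trans double siz)) (λ y → trans (e y) (chiL-≅ swapped y))) (≅-sym swapped)
      where
      swapped : (C ⊔ (E ⊔ union (replicate k K2ᶜ))) ≅ (E ⊔ (K2 ⊔ union (replicate k K2ᶜ)))
      swapped = ≅-trans (⊔-swap-heads C E (union (replicate k K2ᶜ))) (⊔-congʳ E (⊔-congˡ (union (replicate k K2ᶜ)) (size-2-K2 (c , C) conn-C m≡2)))
      double : 2 ℕ.* (2 ℕ.+ s) ≡ suc c ℕ.* ((2 ℕ.+ s) ℕ.* 1)
      double = cong₂ ℕ._*_ (sym m≡2) (sym (ℕ.*-identityʳ (2 ℕ.+ s)))
    rearrange-components r k (c , C) ((rt , (_ , sizeE)) ∷ (rt′ , (_ , sizeE′)) ∷ []) conn-C refl (two m≡1) siz e =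
      ⊥-elim (no-sizes-1-6-6′ T C _ _ (replicate r K2ᶜ) (replicate k K2ᶜ) (trans (sym siz) (cong (ℕ._* 9) m≡1)) m≡1 sizeE sizeE′ conn tree rt rt′
        (K2s-bipartite r) (degreeInvariant-K2 r) (degreeInvariant-K2 k) refl e)
    rearrange-components r k C (_ ∷ _ ∷ _ ∷ _) conn-C r≡ () siz e

    -- The copies of K₂ supply multiplicity r. T enters with exponent 0 and its value at -2, which
    -- may be zero, so only the lower bound r results.
    root-bound : ∀ r {Cs} → All Connected Cs → All Tree Cs → (∀ y → chiL (union (Ts r)) y ≡ chiL (union Cs) y) → r ≤ rootCount Cs
    root-bound r {Cs} cs ts e = subst (_≤ rootCount Cs) (rootCount-K2 r)
      (Lead-order (proj₁ (proj₂ (union-Lead-2 cs ts))) (proj₂ (proj₂ (union-Lead-2 cs ts)))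
        (Lead-cong (λ h → trans (sym (chiL-⊔ T (union Ks) (-2ℤ + h))) (e (-2ℤ + h)))
          (Lead-* (chiL-Lead₀ T -2ℤ) (proj₂ (proj₂ (union-Lead-2 (replicate-all K2-Conn r) (replicate-all refl r)))))))
      where Ks = replicate r K2ᶜ

    ordered-unique : ∀ r C {Ds} → Connected C → All RootTree Ds → suc (length Ds) ≡ suc r → size C ℕ.* sizes Ds ≡ suc n ℕ.* 2 ℕ.^ r →
                     size C ℕ.+ total Ds ≡ suc n ℕ.+ 2 ℕ.* r → (∀ y → chiL (union (Ts r)) y ≡ chiL (proj₂ C ⊔ union Ds) y) →
                     (T ⊔ rK2 r) ≅ (proj₂ C ⊔ union Ds)
    ordered-unique r C {Ds} conn-C ds len siz tot e =
      ≅-trans (rearrange-components r k C bs conn-C r≡ (solve-sizes (size C) (halves bs) (ℕ.s≤s ℕ.z≤n) (trans product≡ (sym sum≡))) product≡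
                (λ y → trans (e y) (chiL-≅ reduced y)))
              (≅-sym reduced)
      where
      R = reduce ds
      Es = big R
      k = copies R
      bs = all-big R
      m = size C
      l = length Es
      P = Π₂ (halves bs)
      S = Σ₁ (halves bs)
      reduced : (proj₂ C ⊔ union Ds) ≅ (proj₂ C ⊔ union (Es ++ replicate k K2ᶜ))
      reduced = ⊔-congʳ (proj₂ C) (union≅ R)
      r≡ : r ≡ l ℕ.+ k
      r≡ = trans (sym (ℕ.suc-injective len)) (length≡ R)
      product≡ : m ℕ.* P ≡ suc n
      product≡ = ℕ.*-cancelʳ-≡ (m ℕ.* P) (suc n) (2 ℕ.^ r) {{ℕ.m^n≢0 2 r}} (begin
        m ℕ.* P ℕ.* 2 ℕ.^ r                        ≡⟨ cong (λ x → m ℕ.* P ℕ.* 2 ℕ.^ x) r≡ ⟩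
        m ℕ.* P ℕ.* 2 ℕ.^ (l ℕ.+ k)                ≡⟨ cong (m ℕ.* P ℕ.*_) (ℕ.^-distribˡ-+-* 2 l k) ⟩
        m ℕ.* P ℕ.* (2 ℕ.^ l ℕ.* 2 ℕ.^ k)          ≡⟨ rearrange m P (2 ℕ.^ l) (2 ℕ.^ k) ⟩
        m ℕ.* (P ℕ.* 2 ℕ.^ l ℕ.* 2 ℕ.^ k)          ≡⟨ cong (λ x → m ℕ.* (x ℕ.* 2 ℕ.^ k)) (sizes-halves bs) ⟨
        m ℕ.* (sizes Es ℕ.* 2 ℕ.^ k)               ≡⟨ cong (m ℕ.*_) (sizes≡ R) ⟨
        m ℕ.* sizes Ds                             ≡⟨ siz ⟩
        suc n ℕ.* 2 ℕ.^ r                          ∎)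
        where
        rearrange : ∀ m p a b → m ℕ.* p ℕ.* (a ℕ.* b) ≡ m ℕ.* (p ℕ.* a ℕ.* b)
        rearrange = ℕ-solve-∀
      sum≡ : m ℕ.+ 2 ℕ.* S ≡ suc n
      sum≡ = ℕ.+-cancelʳ-≡ (2 ℕ.* r) (m ℕ.+ 2 ℕ.* S) (suc n) (begin
        (m ℕ.+ 2 ℕ.* S) ℕ.+ 2 ℕ.* r                 ≡⟨ cong (λ x → (m ℕ.+ 2 ℕ.* S) ℕ.+ 2 ℕ.* x) r≡ ⟩
        (m ℕ.+ 2 ℕ.* S) ℕ.+ 2 ℕ.* (l ℕ.+ k)         ≡⟨ rearrange m S l k ⟩
        m ℕ.+ ((2 ℕ.* S ℕ.+ 2 ℕ.* l) ℕ.+ 2 ℕ.* k)   ≡⟨ cong (λ x → m ℕ.+ (x ℕ.+ 2 ℕ.* k)) (total-halves bs) ⟨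
        m ℕ.+ (total Es ℕ.+ 2 ℕ.* k)                ≡⟨ cong (m ℕ.+_) (total≡ R) ⟨
        m ℕ.+ total Ds                              ≡⟨ tot ⟩
        suc n ℕ.+ 2 ℕ.* r                           ∎)
        where
        rearrange : ∀ m s l k → (m ℕ.+ 2 ℕ.* s) ℕ.+ 2 ℕ.* (l ℕ.+ k) ≡ m ℕ.+ ((2 ℕ.* s ℕ.+ 2 ℕ.* l) ℕ.+ 2 ℕ.* k)
        rearrange = ℕ-solve-∀

    total-↭ : ∀ {Cs Ds} → Cs ↭ Ds → total Cs ≡ total Ds
    total-↭ p = size-≡ (union-↭ p)

    zip-roots : ∀ {Ds} → All Connected Ds → All Tree Ds → All Root Ds → All RootTree Ds
    zip-roots [] [] [] = []
    zip-roots (a ∷ as) (b ∷ bs) (c ∷ cs) = (a , b , c) ∷ zip-roots as bs cs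

    reordered-unique : ∀ r Cs C₀ Ds → Cs ↭ (C₀ ∷ Ds) → All Connected (C₀ ∷ Ds) → All Tree (C₀ ∷ Ds) → All Root Ds →
                       length Cs ≡ suc r → sizes Cs ≡ suc n ℕ.* 2 ℕ.^ r → total Cs ≡ suc n ℕ.+ 2 ℕ.* r →
                       (∀ y → chiL (union (Ts r)) y ≡ chiL (union Cs) y) → (T ⊔ rK2 r) ≅ union Cs
    reordered-unique r Cs C₀ Ds p (c₀ ∷ ds) (_ ∷ us) roots len siz tot e = ≅-trans
      (ordered-unique r C₀ c₀ (zip-roots ds us roots) (trans (sym (↭-length p)) len) (trans (sym (sizes-↭ p)) siz) (trans (sym (total-↭ p)) tot)
        (λ y → trans (e y) (chiL-≅ (union-↭ p) y)))
      (≅-sym (union-↭ p))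

    union-unique : ∀ r Cs → All Connected Cs → All Tree Cs → length Cs ≡ suc r → sizes Cs ≡ suc n ℕ.* 2 ℕ.^ r →
                   total Cs ≡ suc n ℕ.+ 2 ℕ.* r → (∀ y → chiL (union (Ts r)) y ≡ chiL (union Cs) y) → (T ⊔ rK2 r) ≅ union Cs
    union-unique r (C ∷ Cs) cs ts len siz tot e =
      reordered-unique r (C ∷ Cs) (proj₁ order) (proj₁ (proj₂ order)) p (All-resp-↭ p cs) (All-resp-↭ p ts) (proj₂ (proj₂ (proj₂ order))) len siz tot e
      where
      order = all-roots-but-one C Cs (ℕ.≤-trans (ℕ.≤-reflexive (ℕ.suc-injective len)) (root-bound r cs ts e))
      p = proj₁ (proj₂ (proj₂ order))

  chiL-unique : ∀ r (H : Graph (suc n ℕ.+ r ℕ.* 2)) → (∀ y → chiL (T ⊔ rK2 r) y ≡ chiL H y) → (T ⊔ rK2 r) ≅ H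
  chiL-unique r H e = ≅-trans (union-unique r Cs cs trees length≡′ sizes≡′ total≡′ e′) (≅-sym H≅)
    where
    Cs = proj₁ (components H)
    cs = proj₁ (proj₂ (components H))
    H≅ = proj₂ (proj₂ (components H))
    e′ : ∀ y → chiL (union (Ts r)) y ≡ chiL (union Cs) y
    e′ y = trans (sym (chiL-≅ (Ts-≅ r) y)) (trans (e y) (chiL-≅ H≅ y))
    counts = components-count (Ts-Conn r) cs e′
    length-K2 : ∀ r → length (replicate r K2ᶜ) ≡ r
    length-K2 r = List.length-replicate r
    length≡′ : length Cs ≡ suc r
    length≡′ = trans (sym (proj₁ counts)) (cong suc (length-K2 r))
    total≡′ : total Cs ≡ suc n ℕ.+ 2 ℕ.* r
    total≡′ = trans (sym (size-≡ H≅)) (cong (suc n ℕ.+_) (ℕ.*-comm r 2))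
    sumDeg-≅ : ∀ {a b} {G : Graph a} {K : Graph b} → G ≅ K → sumDeg G ≡ sumDeg K
    sumDeg-≅ {K = K} p = trans (sumℕ-cong (λ i → sym (degree-≅ p i))) (sumℕ-permute (_≅_.bij p) (degree K))
    edges : sumDeg (union Cs) ≡ sumDeg (union (Ts r))
    edges = trans (sym (sumDeg-≅ H≅)) (trans (sym (sumDeg-unique (T ⊔ rK2 r) H e)) (sumDeg-≅ (Ts-≅ r)))
    -- H shares order, degree sum and number of components with T ⊔ rK₂, and for a forest these
    -- satisfy the identity of `sumDeg-trees`.
    trees : All Tree Cs
    trees = all-trees cs (begin
      sumDeg (union Cs) ℕ.+ 2 ℕ.* length Cs ≡⟨ cong₂ (λ a b → a ℕ.+ 2 ℕ.* b) edges (sym (proj₁ counts)) ⟩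
      sumDeg (union (Ts r)) ℕ.+ 2 ℕ.* length (Ts r) ≡⟨ sumDeg-trees (Ts-Tree r) ⟩
      2 ℕ.* total (Ts r) ≡⟨ cong (2 ℕ.*_) (trans (sym (size-≡ (Ts-≅ r))) (size-≡ H≅)) ⟩
      2 ℕ.* total Cs ∎)
    sizes≡′ : sizes Cs ≡ suc n ℕ.* 2 ℕ.^ r
    sizes≡′ = trans (sym (treeSums-trees cs trees)) (trans (sym (proj₂ counts)) (trans (treeSums-trees (Ts-Conn r) (Ts-Tree r)) (cong (suc n ℕ.*_) (sizes-K2 r))))

-- The signless Laplacian spectrum

opaque
  chiQ : ∀ {n} → Graph n → ℤ → ℤ
  chiQ G = chi (SLap 1ℤ G)

  chiQ-def : ∀ {n} (G : Graph n) y → chiQ G y ≡ chi (SLap 1ℤ G) y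
  chiQ-def G y = refl

chiQ-≅ : ∀ {n m} {G : Graph n} {H : Graph m} → G ≅ H → ∀ y → chiQ G y ≡ chiQ H y
chiQ-≅ {G = G} {H} p y = trans (chiQ-def G y) (trans (chi-SLap-≅ 1ℤ p y) (sym (chiQ-def H y)))

chiQ-⊔ : ∀ {n m} (G : Graph n) (H : Graph m) y → chiQ (G ⊔ H) y ≡ chiQ G y * chiQ H y
chiQ-⊔ G H y = trans (chiQ-def (G ⊔ H) y) (trans (chi-SLap-⊔ G H 1ℤ y) (sym (cong₂ _*_ (chiQ-def G y) (chiQ-def H y))))

chiQ-signless : ∀ {n} (G : Graph n) y → chiQ G y ≡ chi (signlessLaplacian G) y
chiQ-signless G y = trans (chiQ-def G y) (sym (chi-cong (signless-SLap G) y))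

prodℤ : ∀ {n} → (Fin n → ℤ) → ℤ
prodℤ {zero}  s = 1ℤ
prodℤ {suc n} s = s zero * prodℤ (s ∘ suc)

det-scale-rows : ∀ {n} (s : Fin n → ℤ) (M : Matrix n) → det (λ i j → s i * M i j) ≡ prodℤ s * det M
det-scale-rows {zero}  s M = refl
det-scale-rows {suc n} s M = begin
  det (λ i j → s i * M i j) ≡⟨ det-row (λ i j → s i * M i j) ⟩
  sumℤ (λ j → sg j * ((s zero * M zero j) * det (λ a b → s (suc a) * minor zero j M a b)))
    ≡⟨ sumℤ-cong (λ j → trans (cong (λ z → sg j * ((s zero * M zero j) * z)) (det-scale-rows (s ∘ suc) (minor zero j M)))
         (pull (sg j) (s zero) (M zero j) (prodℤ (s ∘ suc)) (det (minor zero j M)))) ⟩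
  sumℤ (λ j → prodℤ s * (sg j * cof M j)) ≡⟨ sumℤ-* (prodℤ s) (λ j → sg j * cof M j) ⟩
  prodℤ s * sumℤ (λ j → sg j * cof M j) ≡⟨ cong (prodℤ s *_) (det-row M) ⟨
  prodℤ s * det M ∎
  where
  pull : ∀ g s m p d → g * ((s * m) * (p * d)) ≡ (s * p) * (g * (m * d))
  pull = solve-∀

sign-conjugate : ∀ {n} (s : Fin n → ℤ) (M : Matrix n) → (∀ i → s i * s i ≡ 1ℤ) → det (λ i j → s i * (s j * M i j)) ≡ det M
sign-conjugate s M unit = begin
  det (λ i j → s i * (s j * M i j)) ≡⟨ det-scale-rows s (λ i j → s j * M i j) ⟩
  prodℤ s * det (λ i j → s j * M i j) ≡⟨ cong (prodℤ s *_) (trans (sym (det-ᵀ (λ i j → s j * M i j)))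
                                            (trans (det-scale-rows s (M ᵀ)) (cong (prodℤ s *_) (det-ᵀ M)))) ⟩
  prodℤ s * (prodℤ s * det M) ≡⟨ ℤ.*-assoc (prodℤ s) (prodℤ s) (det M) ⟨
  prodℤ s * prodℤ s * det M ≡⟨ cong (_* det M) (square s unit) ⟩
  1ℤ * det M ≡⟨ ℤ.*-identityˡ (det M) ⟩
  det M ∎
  where
  square : ∀ {n} (s : Fin n → ℤ) → (∀ i → s i * s i ≡ 1ℤ) → prodℤ s * prodℤ s ≡ 1ℤ
  square {zero}  s u = refl
  square {suc n} s u = trans (regroup (s zero) (prodℤ (s ∘ suc))) (cong₂ _*_ (u zero) (square (s ∘ suc) (u ∘ suc)))
    where
    regroup : ∀ a p → (a * p) * (a * p) ≡ (a * a) * (p * p)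
    regroup = solve-∀

-- Conjugation by the diagonal matrix of colour signs fixes the diagonal and negates A.
bipartite-chiQ : ∀ {n} (G : Graph n) → Bipartite G → ∀ y → chiQ G y ≡ chiL G y
bipartite-chiQ {n} G (c , proper) y = trans (chiQ-def G y) (trans (trans (det-cong entries)
  (sign-conjugate s (shifted (SLap -1ℤ G) y) unit)) (sym (chiL-def G y)))
  where
  colour-sign : Bool → ℤ
  colour-sign b = if b then 1ℤ else -1ℤ
  s : Fin n → ℤ
  s i = colour-sign (c i)
  unit : ∀ i → s i * s i ≡ 1ℤ
  unit i with c i
  ... | true  = refl
  ... | false = refl
  opposite : ∀ b → colour-sign (not b) * (colour-sign b * -1ℤ) ≡ 1ℤ
  opposite true  = refl
  opposite false = refl
  off-diagonal : ∀ i j → adjMatrix G i j ≡ s i * (s j * (-1ℤ * adjMatrix G i j))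
  off-diagonal i j with adj G i j in e
  ... | true  = sym (trans (cong (λ b → colour-sign b * (s j * -1ℤ)) (proper i j e)) (opposite (c j)))
  ... | false = sym (vanish (s i) (s j))
    where
    vanish : ∀ x z → x * (z * (-1ℤ * 0ℤ)) ≡ 0ℤ
    vanish = solve-∀
  diagonal : ∀ i j → δ i j ≡ s i * (s j * δ i j)
  diagonal i j with i ≟ j
  ... | yes refl = sym (trans (cong (s i *_) (ℤ.*-identityʳ (s i))) (unit i))
  ... | no _     = sym (vanish (s i) (s j))
    where
    vanish : ∀ x z → x * (z * 0ℤ) ≡ 0ℤ
    vanish = solve-∀
  entries : ∀ i j → shifted (SLap 1ℤ G) y i j ≡ s i * (s j * shifted (SLap -1ℤ G) y i j)
  entries i j = begin
    (δ i j * d + 1ℤ * a) + y * δ i j ≡⟨ cong₂ (λ x z → (x * d + 1ℤ * z) + y * x) (diagonal i j) (off-diagonal i j) ⟩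
    (s i * (s j * δ i j) * d + 1ℤ * (s i * (s j * (-1ℤ * a)))) + y * (s i * (s j * δ i j)) ≡⟨ collect (s i) (s j) (δ i j) d a y ⟩
    s i * (s j * ((δ i j * d + -1ℤ * a) + y * δ i j)) ∎
    where
    d = pos (degree G i)
    a = adjMatrix G i j
    collect : ∀ s t x d a y → (s * (t * x) * d + 1ℤ * (s * (t * (-1ℤ * a)))) + y * (s * (t * x)) ≡ s * (t * ((x * d + -1ℤ * a) + y * x))
    collect = solve-∀

-- Bipartite components contribute a simple root 0; every other one contributes det Q, a non-zero multiple of 4.
union-Lead-Q : ∀ {Cs} → All Connected Cs → ∃ λ k → ∃ λ c → c ≢ 0ℤ × Lead (chiQ (union Cs)) k c ×
               (All (Bipartite ∘ proj₂) Cs ⊎ ∃ λ q → c ≡ pos 4 * q)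
union-Lead-Q [] = 0 , 1ℤ , (λ ()) , (lead λ h → 0ℤ , trans (chiQ-def emptyGraph h) (unit h)) , inj₁ []
  where
  unit : ∀ h → 1ℤ ≡ 1ℤ * (1ℤ + h * 0ℤ)
  unit = solve-∀
union-Lead-Q {(n , C) ∷ Cs} (p ∷ ps) with union-Lead-Q ps | bipartite? C
... | k , c , c≢0 , L , alt | yes bip = suc k , pos (treeSum C) * c , nonzero ,
      Lead-cong (λ y → sym (chiQ-⊔ C (union Cs) y)) (Lead-* (Lead-cong (λ y → sym (bipartite-chiQ C bip y)) (chiL-Lead C)) L) ,
      divisible alt
  where
  nonzero : pos (treeSum C) * c ≢ 0ℤ
  nonzero e = c≢0 (*-≡0ˡ (pos (treeSum C)) c (pos-≢0 (ℕ.≤-trans (ℕ.s≤s ℕ.z≤n) (treeSum-≥ C p))) e)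
  pull : ∀ t q → t * (pos 4 * q) ≡ pos 4 * (t * q)
  pull = solve-∀
  divisible : All (Bipartite ∘ proj₂) Cs ⊎ (∃ λ q → c ≡ pos 4 * q) →
              All (Bipartite ∘ proj₂) ((n , C) ∷ Cs) ⊎ ∃ λ q → pos (treeSum C) * c ≡ pos 4 * q
  divisible (inj₁ bips)    = inj₁ (bip ∷ bips)
  divisible (inj₂ (q , e)) = inj₂ (pos (treeSum C) * q , trans (cong (pos (treeSum C) *_) e) (pull (pos (treeSum C)) q))
... | k , c , c≢0 , L , alt | no ¬bip = k , detQ * c , nonzero ,
      Lead-cong (λ y → trans (cong (_* chiQ (union Cs) y) (trans (cong (chi (SLap 1ℤ C)) (ℤ.+-identityˡ y)) (sym (chiQ-def C y)))) (sym (chiQ-⊔ C (union Cs) y)))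
        (Lead-* (chi-Lead₀ (SLap 1ℤ C) 0ℤ) L) ,
      inj₂ (q * c , trans (cong (_* c) (proj₂ (signless-divisible-by-4 C))) (ℤ.*-assoc (pos 4) q c))
  where
  detQ = chi (SLap 1ℤ C) 0ℤ
  q = proj₁ (signless-divisible-by-4 C)
  nonzero : detQ * c ≢ 0ℤ
  nonzero e = c≢0 (*-≡0ˡ detQ c (signless-nonsingular C p ¬bip) e)

module _ {n} (T : Graph (suc n)) (isTree : IsTree T) (odd : suc n % 2 ≡ 1) where

  private
    conn = isTree-Conn isTree
    tree = isTree-Tree isTree
    T+K2 : Graph (suc n ℕ.+ 2)
    T+K2 = T ⊔ rK2 1
    Ts : List Component
    Ts = (n , T) ∷ K2ᶜ ∷ []
    T+K2≅ : T+K2 ≅ union Ts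
    T+K2≅ = ⊔-congʳ T (rK2-union 1)
    Ts-Conn : All Connected Ts
    Ts-Conn = conn ∷ K2-Conn ∷ []
    Ts-Tree : All Tree Ts
    Ts-Tree = tree ∷ refl ∷ []
    Ts-bip : Bipartite (union Ts)
    Ts-bip = bipartite-union (trees-bipartite Ts-Conn Ts-Tree)

    module _ (H : Graph (suc n ℕ.+ 2)) (e : ∀ y → chiQ T+K2 y ≡ chiQ H y)
             (Cs : List Component) (cs : All Connected Cs) (H≅ : H ≅ union Cs) where

      e′ : ∀ y → chiQ (union Ts) y ≡ chiQ (union Cs) y
      e′ y = trans (sym (chiQ-≅ T+K2≅ y)) (trans (e y) (chiQ-≅ H≅ y))

      from-bipartite : All (Bipartite ∘ proj₂) Cs → ∀ y → chiL T+K2 y ≡ chiL H y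
      from-bipartite bips y = begin
        chiL T+K2 y       ≡⟨ chiL-≅ T+K2≅ y ⟩
        chiL (union Ts) y ≡⟨ bipartite-chiQ (union Ts) Ts-bip y ⟨
        chiQ (union Ts) y ≡⟨ e′ y ⟩
        chiQ (union Cs) y ≡⟨ bipartite-chiQ (union Cs) (bipartite-union bips) y ⟩
        chiL (union Cs) y ≡⟨ chiL-≅ H≅ y ⟨
        chiL H y          ∎

      -- As T ⊔ K₂ is bipartite, its lowest coefficient can be read off from L; it is twice the
      -- order of T, so divisibility by 4 would make that order even.
      not-divisible : ∀ {k c} → c ≢ 0ℤ → Lead (chiQ (union Cs)) k c → ∀ q → c ≢ pos 4 * q
      not-divisible {k} {c} c≢0 L q c≡4q = 1≢0 (trans (sym odd) (trans (cong (_% 2) even) (m*n%n≡0 ℤ.∣ q ∣ 2)))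
        where
        1≢0 : 1 ≢ 0
        1≢0 ()
        L′ : Lead (chiQ (union Cs)) 2 (pos (treeSums Ts))
        L′ = Lead-cong (λ y → trans (sym (bipartite-chiQ (union Ts) Ts-bip y)) (e′ y)) (union-Lead Ts)
        c≡ : c ≡ pos (treeSums Ts)
        c≡ = proj₂ (Lead-unique c≢0 (pos-≢0 (ℕ.≤-trans (sizes-≥1 Ts) (treeSums-≥ Ts-Conn))) L L′)
        rearrange : ∀ q → 4 ℕ.* q ≡ q ℕ.* 2 ℕ.* 2
        rearrange = ℕ-solve-∀
        even : suc n ≡ ℤ.∣ q ∣ ℕ.* 2
        even = ℕ.*-cancelʳ-≡ (suc n) (ℤ.∣ q ∣ ℕ.* 2) 2 (begin
          suc n ℕ.* 2            ≡⟨ treeSums-trees Ts-Conn Ts-Tree ⟨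
          treeSums Ts            ≡⟨ cong ℤ.∣_∣ (trans (sym c≡) c≡4q) ⟩
          ℤ.∣ pos 4 * q ∣        ≡⟨ ℤ.abs-* (pos 4) q ⟩
          4 ℕ.* ℤ.∣ q ∣          ≡⟨ rearrange ℤ.∣ q ∣ ⟩
          ℤ.∣ q ∣ ℕ.* 2 ℕ.* 2    ∎)

      from-alternative : (∃ λ k → ∃ λ c → c ≢ 0ℤ × Lead (chiQ (union Cs)) k c × (All (Bipartite ∘ proj₂) Cs ⊎ ∃ λ q → c ≡ pos 4 * q)) →
                         ∀ y → chiL T+K2 y ≡ chiL H y
      from-alternative (k , c , c≢0 , L , inj₁ bips)       = from-bipartite bips
      from-alternative (k , c , c≢0 , L , inj₂ (q , c≡4q)) = ⊥-elim (not-divisible c≢0 L q c≡4q)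

  chiQ⇒chiL : (H : Graph (suc n ℕ.+ 2)) → (∀ y → chiQ T+K2 y ≡ chiQ H y) → ∀ y → chiL T+K2 y ≡ chiL H y
  chiQ⇒chiL H e = from-alternative H e (proj₁ (components H)) (proj₁ (proj₂ (components H))) (proj₂ (proj₂ (components H)))
    (union-Lead-Q (proj₁ (proj₂ (components H))))

theorem3p1 : ∀ {n : ℕ} (T : Graph n) → IsTree T → DLS T →
    (∀ (r : ℕ) → 1 ≤ r → DLS (T ⊔ rK2 r)) × (n % 2 ≡ 1 → DQS (T ⊔ rK2 1))
theorem3p1 {zero}  T isTree dls = case IsTree.nonempty isTree of λ ()
theorem3p1 {suc n} T isTree dls = L-part , Q-part
  where
  L-part : ∀ r → 1 ≤ r → DLS (T ⊔ rK2 r)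
  L-part r _ H cosp@(refl , _) = chiL-unique T isTree dls r H (LCospectral⇒chiL (T ⊔ rK2 r) H cosp)
  Q-part : suc n % 2 ≡ 1 → DQS (T ⊔ rK2 1)
  Q-part odd H (refl , e) = chiL-unique T isTree dls 1 H (chiQ⇒chiL T isTree odd H (λ y →
    trans (chiQ-signless (T ⊔ rK2 1) y)
      (trans (charPoly⇒chi (signlessLaplacian (T ⊔ rK2 1)) (signlessLaplacian H) e y) (sym (chiQ-signless H y)))))
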